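{- Fix a positive integer $n$ and a real number $\varepsilon>0$. Let $S\subset\mathbb{N}$ be a set of cardinality $N$, and let $\{v_1,\ldots,v_n\}$ be chosen uniformly at random from all $n$-element subsets of $S$. If $$\sqrt{\frac{n^3 3^{n-1}}{2^{n+1}\varepsilon^{2n}}}+1<N^{\frac{1}{n+1}},$$ then $$\mathbb{P}\left[\mathrm{ML}(v_1,\ldots,v_n)\ge\frac12-\varepsilon\right]>1-\frac{\left(2N^{\frac{1}{n+1}}+1\right)^n}{N-n}.$$
   Context: For a real number $x$, $\Vert x\Vert$ denotes the distance from $x$ to the nearest integer. For positive integers $v_1,\ldots,v_n$, the maximum loneliness is $\mathrm{ML}(v_1,\ldots,v_n)=\max_{t\in\mathbb{R}}\min_{1\le i\le n}\Vert t v_i\Vert$. Here $\mathbb{N}=\{1,2,3,\ldots\}$. -}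

module Defs where

open import Data.Bool using (Bool; true; false; T)
open import Data.Empty using (⊥-elim)
open import Data.Integer as ℤ using (ℤ; +_; -[1+_])
import Data.Integer.DivMod as ℤ
import Data.Integer.Properties as ℤ
open import Data.List using (List; []; _∷_; _++_; map; length; filterᵇ)
open import Data.List.Membership.Propositional using (_∈_)
open import Data.List.Relation.Unary.Any using (here; there)
open import Data.Nat as ℕ using (ℕ; zero; suc; NonZero)
import Data.Nat.Properties as ℕ
open import Data.Product using (∃-syntax; _×_; _,_)
open import Data.Rational as ℚ using (ℚ; 0ℚ; 1ℚ; ½)
import Data.Rational.Properties as ℚ
open import Data.Rational.Solver using (module +-*-Solver)
import Data.Rational.Unnormalised as ℚᵘ
import Data.Rational.Unnormalised.Properties as ℚᵘ
open import Data.Sum using (_⊎_; inj₁; inj₂)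
open import Data.Vec as Vec using (Vec; []; _∷_)
open import Function using (_⇔_; mk⇔)
open import Relation.Binary.PropositionalEquality using (_≡_; refl; sym; trans; cong; cong₂; subst; subst₂)
open import Relation.Nullary using (¬_; Dec; yes; no; does)
open +-*-Solver using (solve; _:+_; _:*_; _:-_; :-_; con; _:=_)

module Rational where

  open ℚ.≤-Reasoning

  half : ℚ → ℚ
  half q = ½ ℚ.* q

  half+half : ∀ q → half q ℚ.+ half q ≡ q
  half+half = solve 1 (λ q → con ½ :* q :+ con ½ :* q := q) refl

  half-pos : ∀ {q} → 0ℚ ℚ.< q → 0ℚ ℚ.< half q
  half-pos {q} 0<q = subst (ℚ._< half q) (ℚ.*-zeroʳ ½) (ℚ.*-monoʳ-<-pos ½ 0<q)

  *-pos : ∀ {p q} → 0ℚ ℚ.< p → 0ℚ ℚ.< q → 0ℚ ℚ.< p ℚ.* q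
  *-pos {p} {q} 0<p 0<q =
    subst (ℚ._< p ℚ.* q) (ℚ.*-zeroʳ p) (ℚ.*-monoʳ-<-pos p {{ℚ.positive 0<p}} 0<q)

  *-nonNeg : ∀ {p q} → 0ℚ ℚ.≤ p → 0ℚ ℚ.≤ q → 0ℚ ℚ.≤ p ℚ.* q
  *-nonNeg {p} {q} 0≤p 0≤q =
    subst (ℚ._≤ p ℚ.* q) (ℚ.*-zeroʳ p) (ℚ.*-monoˡ-≤-nonNeg p {{ℚ.nonNegative 0≤p}} 0≤q)

  +-nonNeg : ∀ {p q} → 0ℚ ℚ.≤ p → 0ℚ ℚ.≤ q → 0ℚ ℚ.≤ p ℚ.+ q
  +-nonNeg {p} {q} 0≤p 0≤q = ℚ.+-mono-≤ 0≤p 0≤q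

  *-mono : ∀ {p q r s} → 0ℚ ℚ.≤ r → 0ℚ ℚ.≤ q → p ℚ.≤ q → r ℚ.≤ s → p ℚ.* r ℚ.≤ q ℚ.* s
  *-mono {p} {q} {r} {s} 0≤r 0≤q p≤q r≤s = ℚ.≤-trans
    (ℚ.*-monoʳ-≤-nonNeg r {{ℚ.nonNegative 0≤r}} p≤q)
    (ℚ.*-monoˡ-≤-nonNeg q {{ℚ.nonNegative 0≤q}} r≤s)

  ≤-+ʳ : ∀ {p q} → 0ℚ ℚ.≤ q → p ℚ.≤ p ℚ.+ q
  ≤-+ʳ {p} {q} 0≤q = subst (ℚ._≤ p ℚ.+ q) (ℚ.+-identityʳ p) (ℚ.+-monoʳ-≤ p 0≤q)

  <-+ʳ : ∀ {p q} → 0ℚ ℚ.< q → p ℚ.< p ℚ.+ q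
  <-+ʳ {p} {q} 0<q = subst (ℚ._< p ℚ.+ q) (ℚ.+-identityʳ p) (ℚ.+-monoʳ-< p 0<q)

  ≤+⇒-≤ : ∀ {p q d} → p ℚ.≤ q ℚ.+ d → p ℚ.- q ℚ.≤ d
  ≤+⇒-≤ {p} {q} {d} h = subst (p ℚ.- q ℚ.≤_)
    (solve 2 (λ q d → (q :+ d) :- q := d) refl q d) (ℚ.+-monoˡ-≤ (ℚ.- q) h)

  -≤⇒≤+ : ∀ {p q d} → p ℚ.- q ℚ.≤ d → p ℚ.≤ q ℚ.+ d
  -≤⇒≤+ {p} {q} {d} h = subst₂ ℚ._≤_
    (solve 2 (λ p q → p :- q :+ q := p) refl p q) (ℚ.+-comm d q) (ℚ.+-monoˡ-≤ q h)

  p≤∣p∣ : ∀ p → p ℚ.≤ ℚ.∣ p ∣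
  p≤∣p∣ p with ℚ.≤-total 0ℚ p
  ... | inj₁ 0≤p = ℚ.≤-reflexive (sym (ℚ.0≤p⇒∣p∣≡p 0≤p))
  ... | inj₂ p≤0 = ℚ.≤-trans p≤0 (ℚ.0≤∣p∣ p)

  ∣-∣-swap : ∀ p q → ℚ.∣ p ℚ.- q ∣ ≡ ℚ.∣ q ℚ.- p ∣
  ∣-∣-swap p q = trans (cong ℚ.∣_∣ (solve 2 (λ p q → p :- q := :- (q :- p)) refl p q))
    (ℚ.∣-p∣≡∣p∣ (q ℚ.- p))

  ∣∣≤⇒≤ : ∀ {p q d} → ℚ.∣ p ℚ.- q ∣ ℚ.≤ d → p ℚ.≤ q ℚ.+ d
  ∣∣≤⇒≤ {p} {q} h = -≤⇒≤+ (ℚ.≤-trans (p≤∣p∣ (p ℚ.- q)) h)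

  ∣∣≤⇒≥ : ∀ {p q d} → ℚ.∣ p ℚ.- q ∣ ℚ.≤ d → q ℚ.≤ p ℚ.+ d
  ∣∣≤⇒≥ {p} {q} {d} h = ∣∣≤⇒≤ (subst (ℚ._≤ d) (∣-∣-swap p q) h)

  ≤⇒∣∣≤ : ∀ {p q d} → p ℚ.≤ q ℚ.+ d → q ℚ.≤ p ℚ.+ d → ℚ.∣ p ℚ.- q ∣ ℚ.≤ d
  ≤⇒∣∣≤ {p} {q} {d} h k with ℚ.∣p∣≡p∨∣p∣≡-p (p ℚ.- q)
  ... | inj₁ e = subst (ℚ._≤ d) (sym e) (≤+⇒-≤ h)
  ... | inj₂ e = subst (ℚ._≤ d)
    (sym (trans e (solve 2 (λ p q → :- (p :- q) := q :- p) refl p q))) (≤+⇒-≤ k)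

  recip : ∀ {q} → 0ℚ ℚ.< q → ∃[ r ] 0ℚ ℚ.< r × q ℚ.* r ≡ 1ℚ
  recip {q} 0<q =
    (ℚ.1/ q) {{nz}} , ℚ.positive⁻¹ _ {{ℚ.1/pos⇒pos q {{ℚ.positive 0<q}}}} , ℚ.*-inverseʳ q {{nz}}
    where nz = ℚ.>-nonZero 0<q

  productClose : ∀ {p p′ q q′ B C d e} → 0ℚ ℚ.≤ B → 0ℚ ℚ.≤ C →
    ℚ.∣ p ∣ ℚ.≤ B → ℚ.∣ q′ ∣ ℚ.≤ C → ℚ.∣ q ℚ.- q′ ∣ ℚ.≤ d → ℚ.∣ p ℚ.- p′ ∣ ℚ.≤ e →
    ℚ.∣ p ℚ.* q ℚ.- p′ ℚ.* q′ ∣ ℚ.≤ B ℚ.* d ℚ.+ C ℚ.* e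
  productClose {p} {p′} {q} {q′} {B} {C} {d} {e} 0≤B 0≤C p≤B q′≤C q≤d p≤e = begin
    ℚ.∣ p ℚ.* q ℚ.- p′ ℚ.* q′ ∣
      ≡⟨ cong ℚ.∣_∣ (solve 4 (λ p p′ q q′ →
           p :* q :- p′ :* q′ := p :* (q :- q′) :+ q′ :* (p :- p′)) refl p p′ q q′) ⟩
    ℚ.∣ p ℚ.* (q ℚ.- q′) ℚ.+ q′ ℚ.* (p ℚ.- p′) ∣
      ≤⟨ ℚ.∣p+q∣≤∣p∣+∣q∣ (p ℚ.* (q ℚ.- q′)) (q′ ℚ.* (p ℚ.- p′)) ⟩
    ℚ.∣ p ℚ.* (q ℚ.- q′) ∣ ℚ.+ ℚ.∣ q′ ℚ.* (p ℚ.- p′) ∣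
      ≡⟨ cong₂ ℚ._+_ (ℚ.∣p*q∣≡∣p∣*∣q∣ p (q ℚ.- q′)) (ℚ.∣p*q∣≡∣p∣*∣q∣ q′ (p ℚ.- p′)) ⟩
    ℚ.∣ p ∣ ℚ.* ℚ.∣ q ℚ.- q′ ∣ ℚ.+ ℚ.∣ q′ ∣ ℚ.* ℚ.∣ p ℚ.- p′ ∣
      ≤⟨ ℚ.+-mono-≤ (*-mono (ℚ.0≤∣p∣ (q ℚ.- q′)) 0≤B p≤B q≤d)
                    (*-mono (ℚ.0≤∣p∣ (p ℚ.- p′)) 0≤C q′≤C p≤e) ⟩
    B ℚ.* d ℚ.+ C ℚ.* e ∎

  /-≤ : ∀ i j m n .{{_ : NonZero m}} .{{_ : NonZero n}} →
    i ℤ.* + n ℤ.≤ j ℤ.* + m → i ℚ./ m ℚ.≤ j ℚ./ n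
  /-≤ i j m@(suc _) n@(suc _) h = ℚ.toℚᵘ-cancel-≤
    (ℚᵘ.≤-respˡ-≃ (ℚᵘ.≃-sym (ℚ.toℚᵘ-fromℚᵘ (ℚᵘ.mkℚᵘ i (ℕ.pred m))))
    (ℚᵘ.≤-respʳ-≃ (ℚᵘ.≃-sym (ℚ.toℚᵘ-fromℚᵘ (ℚᵘ.mkℚᵘ j (ℕ.pred n)))) (ℚᵘ.*≤* h)))

  /-< : ∀ i j m n .{{_ : NonZero m}} .{{_ : NonZero n}} →
    i ℤ.* + n ℤ.< j ℤ.* + m → i ℚ./ m ℚ.< j ℚ./ n
  /-< i j m@(suc _) n@(suc _) h = ℚ.toℚᵘ-cancel-<
    (ℚᵘ.<-respˡ-≃ (ℚᵘ.≃-sym (ℚ.toℚᵘ-fromℚᵘ (ℚᵘ.mkℚᵘ i (ℕ.pred m))))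
    (ℚᵘ.<-respʳ-≃ (ℚᵘ.≃-sym (ℚ.toℚᵘ-fromℚᵘ (ℚᵘ.mkℚᵘ j (ℕ.pred n)))) (ℚᵘ.*<* h)))

  /-+ : ∀ i j n .{{_ : NonZero n}} → (i ℤ.+ j) ℚ./ n ≡ i ℚ./ n ℚ.+ j ℚ./ n
  /-+ i j n@(suc d) = ℚ.toℚᵘ-injective
    (ℚᵘ.≃-trans (ℚ.toℚᵘ-fromℚᵘ (ℚᵘ.mkℚᵘ (i ℤ.+ j) d))
    (ℚᵘ.≃-trans (ℚᵘ.*≡* eq)
    (ℚᵘ.≃-trans
      (ℚᵘ.≃-sym (ℚᵘ.+-cong (ℚ.toℚᵘ-fromℚᵘ (ℚᵘ.mkℚᵘ i d)) (ℚ.toℚᵘ-fromℚᵘ (ℚᵘ.mkℚᵘ j d))))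
      (ℚᵘ.≃-sym (ℚ.toℚᵘ-homo-+ (i ℚ./ n) (j ℚ./ n))))))
    where
    eq : (i ℤ.+ j) ℤ.* + (n ℕ.* n) ≡ (i ℤ.* + n ℤ.+ j ℤ.* + n) ℤ.* + n
    eq = trans (cong ((i ℤ.+ j) ℤ.*_) (ℤ.pos-* n n))
      (trans (sym (ℤ.*-assoc (i ℤ.+ j) (+ n) (+ n)))
             (cong (ℤ._* + n) (ℤ.*-distribʳ-+ (+ n) i j)))

  /1-mono-≤ : ∀ {i j} → i ℤ.≤ j → i ℚ./ 1 ℚ.≤ j ℚ./ 1
  /1-mono-≤ {i} {j} h = /-≤ i j 1 1 (subst₂ ℤ._≤_ (sym (ℤ.*-identityʳ i)) (sym (ℤ.*-identityʳ j)) h)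

  floor-≤ : ∀ q → ℚ.floor q ℚ./ 1 ℚ.≤ q
  floor-≤ q@record{} = subst (ℚ.floor q ℚ./ 1 ℚ.≤_) (ℚ.↥p/↧p≡p q)
    (/-≤ (ℚ.floor q) (ℚ.↥ q) 1 (ℚ.↧ₙ q)
      (subst (ℚ.floor q ℤ.* ℚ.↧ q ℤ.≤_) (sym (ℤ.*-identityʳ (ℚ.↥ q))) (ℤ.[n/d]*d≤n (ℚ.↥ q) (ℚ.↧ q))))

  <-floor+1 : ∀ q → q ℚ.< ℚ.floor q ℚ./ 1 ℚ.+ 1ℚ
  <-floor+1 q@record{} = subst₂ ℚ._<_ (ℚ.↥p/↧p≡p q) (/-+ (ℚ.floor q) (+ 1) 1)
    (/-< (ℚ.↥ q) (ℚ.floor q ℤ.+ + 1) (ℚ.↧ₙ q) 1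
      (subst₂ ℤ._<_ (sym (ℤ.*-identityʳ (ℚ.↥ q)))
        (cong (ℤ._* ℚ.↧ q) (trans (cong ℤ.suc (sym (ℤ.div-pos-is-/ℕ (ℚ.↥ q) (ℚ.↧ₙ q)))) (ℤ.+-comm (+ 1) (ℚ.floor q))))
        (ℤ.n<s[n/ℕd]*d (ℚ.↥ q) (ℚ.↧ₙ q))))

  archimedean : ∀ {δ} → 0ℚ ℚ.< δ → ∃[ K ] ∀ n → K ℕ.≤ n → + 1 ℚ./ suc n ℚ.≤ δ
  archimedean {δ@(ℚ.mkℚ (+ zero) d _)} (ℚ.*<* h) = ⊥-elim (ℤ.<-irrefl refl (subst (+ 0 ℤ.<_) refl h))
  archimedean {δ@(ℚ.mkℚ -[1+ _ ] d _)} (ℚ.*<* ())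
  archimedean {δ@(ℚ.mkℚ (+ suc a) d _)} _ = d , λ n d≤n →
    subst (+ 1 ℚ./ suc n ℚ.≤_) (ℚ.↥p/↧p≡p δ) (/-≤ (+ 1) (+ suc a) (suc n) (suc d)
      (subst₂ ℤ._≤_ (ℤ.pos-* 1 (suc d)) (ℤ.pos-* (suc a) (suc n))
        (ℤ.+≤+ (ℕ.*-mono-≤ {1} {suc a} (ℕ.s≤s ℕ.z≤n) (ℕ.s≤s d≤n)))))

  infixr 8 _^_

  _^_ : ℚ → ℕ → ℚ
  q ^ zero  = 1ℚ
  q ^ suc k = q ℚ.* q ^ k

  ^-nonNeg : ∀ {q} → 0ℚ ℚ.≤ q → ∀ k → 0ℚ ℚ.≤ q ^ k
  ^-nonNeg 0≤q zero    = ℚ.<⇒≤ (ℚ.positive⁻¹ 1ℚ)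
  ^-nonNeg 0≤q (suc k) = *-nonNeg 0≤q (^-nonNeg 0≤q k)

  ^-pos : ∀ {q} → 0ℚ ℚ.< q → ∀ k → 0ℚ ℚ.< q ^ k
  ^-pos 0<q zero    = ℚ.positive⁻¹ 1ℚ
  ^-pos 0<q (suc k) = *-pos 0<q (^-pos 0<q k)

  ^-mono-≤ : ∀ {p q} → 0ℚ ℚ.≤ p → p ℚ.≤ q → ∀ k → p ^ k ℚ.≤ q ^ k
  ^-mono-≤ 0≤p p≤q zero    = ℚ.≤-refl
  ^-mono-≤ 0≤p p≤q (suc k) =
    *-mono (^-nonNeg 0≤p k) (ℚ.≤-trans 0≤p p≤q) p≤q (^-mono-≤ 0≤p p≤q k)

  ^-cancel-< : ∀ {p q} → 0ℚ ℚ.≤ q → ∀ k → p ^ k ℚ.< q ^ k → p ℚ.< q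
  ^-cancel-< {p} {q} 0≤q k h with p ℚ.<? q
  ... | yes p<q = p<q
  ... | no  p≮q = ⊥-elim (ℚ.<-irrefl refl (ℚ.<-≤-trans h (^-mono-≤ 0≤q (ℚ.≮⇒≥ p≮q) k)))

  ^-superadditive : ∀ {p q} → 0ℚ ℚ.≤ p → 0ℚ ℚ.≤ q → ∀ k →
    p ^ suc k ℚ.+ q ^ suc k ℚ.≤ (p ℚ.+ q) ^ suc k
  ^-superadditive {p} {q} 0≤p 0≤q zero =
    ℚ.≤-reflexive (sym (ℚ.*-distribʳ-+ 1ℚ p q))
  ^-superadditive {p} {q} 0≤p 0≤q (suc k) = begin
    p ℚ.* P ℚ.+ q ℚ.* Q
      ≤⟨ ≤-+ʳ (+-nonNeg (*-nonNeg 0≤p (^-nonNeg 0≤q (suc k))) (*-nonNeg 0≤q (^-nonNeg 0≤p (suc k)))) ⟩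
    p ℚ.* P ℚ.+ q ℚ.* Q ℚ.+ (p ℚ.* Q ℚ.+ q ℚ.* P)
      ≡⟨ solve 4 (λ p q P Q → p :* P :+ q :* Q :+ (p :* Q :+ q :* P) := (p :+ q) :* (P :+ Q)) refl p q P Q ⟩
    (p ℚ.+ q) ℚ.* (P ℚ.+ Q)
      ≤⟨ ℚ.*-monoˡ-≤-nonNeg (p ℚ.+ q) {{ℚ.nonNegative (+-nonNeg 0≤p 0≤q)}} (^-superadditive 0≤p 0≤q k) ⟩
    (p ℚ.+ q) ℚ.* (p ℚ.+ q) ^ suc k ∎
    where P = p ^ suc k
          Q = q ^ suc k

  1≤^ : ∀ {q} → 1ℚ ℚ.≤ q → ∀ k → 1ℚ ℚ.≤ q ^ k
  1≤^ 1≤q zero    = ℚ.≤-refl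
  1≤^ 1≤q (suc k) = *-mono {1ℚ} {_} {1ℚ} 0≤1 (ℚ.≤-trans 0≤1 1≤q) 1≤q (1≤^ 1≤q k)
    where 0≤1 = ℚ.<⇒≤ (ℚ.positive⁻¹ 1ℚ)

  q≤q^ : ∀ {q} → 1ℚ ℚ.≤ q → ∀ k → q ℚ.≤ q ^ suc k
  q≤q^ {q} 1≤q k = subst (ℚ._≤ q ^ suc k) (ℚ.*-identityʳ q)
    (ℚ.*-monoˡ-≤-nonNeg q {{ℚ.nonNegative (ℚ.≤-trans (ℚ.<⇒≤ (ℚ.positive⁻¹ 1ℚ)) 1≤q)}} (1≤^ 1≤q k))

  distℤ : ℚ → ℚ
  distℤ q = (q ℚ.- ⌊q⌋) ℚ.⊓ (⌊q⌋ ℚ.+ 1ℚ ℚ.- q)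
    where ⌊q⌋ = ℚ.floor q ℚ./ 1

  -- distℤ q is attained by an integer and is a lower bound for the distance to every integer.

  distℤ-attained : ∀ q → ∃[ k ] distℤ q ≡ ℚ.∣ q ℚ.- k ℚ./ 1 ∣
  distℤ-attained q with ℚ.⊓-sel (q ℚ.- ℚ.floor q ℚ./ 1) (ℚ.floor q ℚ./ 1 ℚ.+ 1ℚ ℚ.- q)
  ... | inj₁ e = ℚ.floor q , trans e (sym (ℚ.0≤p⇒∣p∣≡p
    (subst (ℚ._≤ q ℚ.- ⌊q⌋) (ℚ.+-inverseʳ ⌊q⌋) (ℚ.+-monoˡ-≤ (ℚ.- ⌊q⌋) (floor-≤ q)))))
    where ⌊q⌋ = ℚ.floor q ℚ./ 1
  ... | inj₂ e = ℚ.floor q ℤ.+ + 1 , trans e (trans (sym (ℚ.0≤p⇒∣p∣≡p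
      (subst (ℚ._≤ c ℚ.- q) (ℚ.+-inverseʳ q) (ℚ.+-monoˡ-≤ (ℚ.- q) (ℚ.<⇒≤ (<-floor+1 q))))))
      (trans (∣-∣-swap c q) (cong (λ r → ℚ.∣ q ℚ.- r ∣) (sym (/-+ (ℚ.floor q) (+ 1) 1)))))
    where c = ℚ.floor q ℚ./ 1 ℚ.+ 1ℚ

  distℤ-≤ : ∀ q k → distℤ q ℚ.≤ ℚ.∣ q ℚ.- k ℚ./ 1 ∣
  distℤ-≤ q k with k ℤ.≤? ℚ.floor q
  ... | yes k≤ = begin
    distℤ q            ≤⟨ ℚ.p⊓q≤p (q ℚ.- ⌊q⌋) (⌊q⌋ ℚ.+ 1ℚ ℚ.- q) ⟩
    q ℚ.- ⌊q⌋          ≤⟨ ℚ.+-monoʳ-≤ q (ℚ.neg-antimono-≤ (/1-mono-≤ k≤)) ⟩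
    q ℚ.- k ℚ./ 1      ≤⟨ p≤∣p∣ (q ℚ.- k ℚ./ 1) ⟩
    ℚ.∣ q ℚ.- k ℚ./ 1 ∣ ∎
    where ⌊q⌋ = ℚ.floor q ℚ./ 1
  ... | no k≰ = begin
    distℤ q             ≤⟨ ℚ.p⊓q≤q (q ℚ.- ⌊q⌋) (⌊q⌋ ℚ.+ 1ℚ ℚ.- q) ⟩
    ⌊q⌋ ℚ.+ 1ℚ ℚ.- q    ≡⟨ cong (ℚ._- q) (trans (sym (/-+ (ℚ.floor q) (+ 1) 1))
                             (cong (ℚ._/ 1) (ℤ.+-comm (ℚ.floor q) (+ 1)))) ⟩
    ℤ.suc (ℚ.floor q) ℚ./ 1 ℚ.- q
                        ≤⟨ ℚ.+-monoˡ-≤ (ℚ.- q) (/1-mono-≤ (ℤ.i<j⇒suc[i]≤j (ℤ.≰⇒> k≰))) ⟩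
    k ℚ./ 1 ℚ.- q       ≤⟨ p≤∣p∣ (k ℚ./ 1 ℚ.- q) ⟩
    ℚ.∣ k ℚ./ 1 ℚ.- q ∣ ≡⟨ ∣-∣-swap (k ℚ./ 1) q ⟩
    ℚ.∣ q ℚ.- k ℚ./ 1 ∣ ∎
    where ⌊q⌋ = ℚ.floor q ℚ./ 1

  distℤ-lipschitz : ∀ p q → distℤ p ℚ.≤ distℤ q ℚ.+ ℚ.∣ p ℚ.- q ∣
  distℤ-lipschitz p q with distℤ-attained q
  ... | k , e = begin
    distℤ p                           ≤⟨ distℤ-≤ p k ⟩
    ℚ.∣ p ℚ.- k′ ∣                    ≡⟨ cong ℚ.∣_∣ (solve 3 (λ p q k → p :- k := q :- k :+ (p :- q)) refl p q k′) ⟩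
    ℚ.∣ q ℚ.- k′ ℚ.+ (p ℚ.- q) ∣      ≤⟨ ℚ.∣p+q∣≤∣p∣+∣q∣ (q ℚ.- k′) (p ℚ.- q) ⟩
    ℚ.∣ q ℚ.- k′ ∣ ℚ.+ ℚ.∣ p ℚ.- q ∣  ≡⟨ cong (ℚ._+ ℚ.∣ p ℚ.- q ∣) (sym e) ⟩
    distℤ q ℚ.+ ℚ.∣ p ℚ.- q ∣ ∎
    where k′ = k ℚ./ 1

  -- Reciprocal, with the junk value 0 at 0.
  inv : ℚ → ℚ
  inv q with q ℚ.≟ 0ℚ
  ... | yes _   = 0ℚ
  ... | no  q≢0 = (ℚ.1/ q) {{ℚ.≢-nonZero q≢0}}

  *-inv : ∀ {q} → 0ℚ ℚ.< q → q ℚ.* inv q ≡ 1ℚ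
  *-inv {q} 0<q with q ℚ.≟ 0ℚ
  ... | yes q≡0 = ⊥-elim (ℚ.<-irrefl (sym q≡0) 0<q)
  ... | no  q≢0 = ℚ.*-inverseʳ q {{ℚ.≢-nonZero q≢0}}

  inv-close : ∀ {p q c δ} → 0ℚ ℚ.< c → 0ℚ ℚ.≤ δ → c ℚ.≤ p → c ℚ.≤ q →
    q ℚ.≤ p ℚ.+ δ ℚ.* (c ℚ.* c) → inv p ℚ.≤ inv q ℚ.+ δ
  inv-close {p} {q} {c} {δ} 0<c 0≤δ c≤p c≤q q≤ =
    ℚ.*-cancelˡ-≤-pos (p ℚ.* q) {{ℚ.positive (*-pos 0<p 0<q)}} (begin
      p ℚ.* q ℚ.* inv p                      ≡⟨ solve 3 (λ p q r → p :* q :* r := q :* (p :* r)) refl p q (inv p) ⟩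
      q ℚ.* (p ℚ.* inv p)                    ≡⟨ trans (cong (q ℚ.*_) (*-inv 0<p)) (ℚ.*-identityʳ q) ⟩
      q                                      ≤⟨ q≤ ⟩
      p ℚ.+ δ ℚ.* (c ℚ.* c)
        ≤⟨ ℚ.+-monoʳ-≤ p (ℚ.*-monoˡ-≤-nonNeg δ {{ℚ.nonNegative 0≤δ}}
             (*-mono (ℚ.<⇒≤ 0<c) (ℚ.<⇒≤ 0<p) c≤p c≤q)) ⟩
      p ℚ.+ δ ℚ.* (p ℚ.* q)                  ≡⟨ cong (ℚ._+ δ ℚ.* (p ℚ.* q)) (trans (sym (ℚ.*-identityʳ p)) (cong (p ℚ.*_) (sym (*-inv 0<q)))) ⟩
      p ℚ.* (q ℚ.* inv q) ℚ.+ δ ℚ.* (p ℚ.* q)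
        ≡⟨ solve 4 (λ p q r d → p :* (q :* r) :+ d :* (p :* q) := p :* q :* (r :+ d)) refl p q (inv q) δ ⟩
      p ℚ.* q ℚ.* (inv q ℚ.+ δ) ∎)
    where 0<p = ℚ.<-≤-trans 0<c c≤p
          0<q = ℚ.<-≤-trans 0<c c≤q

  module _ {P : ℕ → Set} (P? : ∀ j → Dec (P j)) where

    -- The largest j ≤ f satisfying P, or 0 if there is none.
    largest : ℕ → ℕ
    largest zero    = zero
    largest (suc f) with P? (suc f)
    ... | yes _ = suc f
    ... | no  _ = largest f

    largest-holds : ∀ f → P (largest f) ⊎ largest f ≡ 0
    largest-holds zero    = inj₂ refl
    largest-holds (suc f) with P? (suc f)
    ... | yes h = inj₁ h
    ... | no  _ = largest-holds f

    largest-fails : ∀ f → ¬ P (suc f) → ¬ P (suc (largest f))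
    largest-fails zero    h = h
    largest-fails (suc f) h with P? (suc f)
    ... | yes _ = h
    ... | no  n = largest-fails f n

  -- The largest multiple of 1 / (m + 1) whose k-th power is at most q (0 if q is negative);
  -- the numerator of a multiple to be considered is at most (m + 1) (∣ ↥ q ∣ + 1).
  rootNumerator : ℕ → ℕ → ℚ → ℕ
  rootNumerator k m q =
    largest (λ j → (+ j ℚ./ suc m) ^ k ℚ.≤? q) (suc m ℕ.* suc ℤ.∣ ℚ.↥ q ∣)

  opaque
    rootApprox : ℕ → ℕ → ℚ → ℚ
    rootApprox k m q = + rootNumerator k m q ℚ./ suc m

  /-nonNeg : ∀ j m → 0ℚ ℚ.≤ + j ℚ./ suc m
  /-nonNeg j m = ℚ.nonNegative⁻¹ (+ j ℚ./ suc m) {{ℚ.normalize-nonNeg j (suc m)}}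

  step-pos : ∀ m → 0ℚ ℚ.< + 1 ℚ./ suc m
  step-pos m = ℚ.positive⁻¹ (+ 1 ℚ./ suc m) {{ℚ.normalize-pos 1 (suc m)}}

  opaque
    unfolding rootApprox

    rootApprox-nonNeg : ∀ k m q → 0ℚ ℚ.≤ rootApprox k m q
    rootApprox-nonNeg k m q = /-nonNeg (rootNumerator k m q) m

    rootApprox-≤ : ∀ k m q → rootApprox (suc k) m q ^ suc k ℚ.≤ q ℚ.⊔ 0ℚ
    rootApprox-≤ k m q = helper (rootNumerator (suc k) m q)
      (largest-holds (λ j → (+ j ℚ./ suc m) ^ suc k ℚ.≤? q) (suc m ℕ.* suc ℤ.∣ ℚ.↥ q ∣))
      where
      helper : ∀ j → (+ j ℚ./ suc m) ^ suc k ℚ.≤ q ⊎ j ≡ 0 → (+ j ℚ./ suc m) ^ suc k ℚ.≤ q ℚ.⊔ 0ℚ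
      helper j (inj₁ h)    = ℚ.≤-trans h (ℚ.p≤p⊔q q 0ℚ)
      helper _ (inj₂ refl) = ℚ.≤-trans (ℚ.≤-reflexive
        (trans (cong (_^ suc k) (ℚ.0/n≡0 (suc m))) (ℚ.*-zeroˡ (0ℚ ^ k)))) (ℚ.p≤q⊔p q 0ℚ)

  <-numerator : ∀ q → q ℚ.< + suc ℤ.∣ ℚ.↥ q ∣ ℚ./ 1
  <-numerator q = subst (ℚ._< + suc a ℚ./ 1) (ℚ.↥p/↧p≡p q) (/-< (ℚ.↥ q) (+ suc a) (ℚ.↧ₙ q) 1
    (subst (ℤ._< + suc a ℤ.* ℚ.↧ q) (sym (ℤ.*-identityʳ (ℚ.↥ q)))
      (ℤ.≤-<-trans (i≤∣i∣ (ℚ.↥ q)) (ℤ.<-≤-trans (ℤ.+<+ (ℕ.n<1+n a))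
        (subst (+ suc a ℤ.≤_) (ℤ.pos-* (suc a) (ℚ.↧ₙ q)) (ℤ.+≤+ (ℕ.m≤m*n (suc a) (ℚ.↧ₙ q))))))))
    where
    a = ℤ.∣ ℚ.↥ q ∣
    i≤∣i∣ : ∀ i → i ℤ.≤ + ℤ.∣ i ∣
    i≤∣i∣ (+ n)    = ℤ.≤-refl
    i≤∣i∣ -[1+ n ] = ℤ.-≤+

  /-scale : ∀ a m → + a ℚ./ 1 ℚ.≤ + suc (suc m ℕ.* a) ℚ./ suc m
  /-scale a m = /-≤ (+ a) (+ suc (suc m ℕ.* a)) 1 (suc m)
    (subst₂ ℤ._≤_ (trans (cong +_ (ℕ.*-comm (suc m) a)) (ℤ.pos-* a (suc m)))
      (sym (ℤ.*-identityʳ (+ suc (suc m ℕ.* a)))) (ℤ.+≤+ (ℕ.n≤1+n (suc m ℕ.* a))))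

  <-^-chain : ∀ {q M g} k → 1ℚ ℚ.≤ M → q ℚ.< M → M ℚ.≤ g → q ℚ.< g ^ suc k
  <-^-chain k 1≤M q<M M≤g = ℚ.<-≤-trans q<M (ℚ.≤-trans (q≤q^ 1≤M k)
    (^-mono-≤ (ℚ.≤-trans (ℚ.<⇒≤ (ℚ.positive⁻¹ 1ℚ)) 1≤M) M≤g (suc k)))

  ⊔-< : ∀ {q r} → q ℚ.< r → 0ℚ ℚ.< r → q ℚ.⊔ 0ℚ ℚ.< r
  ⊔-< {q} {r} q<r 0<r with ℚ.⊔-sel q 0ℚ
  ... | inj₁ e = subst (ℚ._< r) (sym e) q<r
  ... | inj₂ e = subst (ℚ._< r) (sym e) 0<r

  /-suc : ∀ j m → + suc j ℚ./ suc m ≡ + j ℚ./ suc m ℚ.+ + 1 ℚ./ suc m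
  /-suc j m = trans (cong (λ i → + i ℚ./ suc m) (ℕ.+-comm 1 j)) (/-+ (+ j) (+ 1) (suc m))

  opaque
    unfolding rootApprox

    <-rootApprox : ∀ k m q → q ℚ.⊔ 0ℚ ℚ.< (rootApprox (suc k) m q ℚ.+ + 1 ℚ./ suc m) ^ suc k
    <-rootApprox k m q = helper (rootNumerator (suc k) m q)
      (largest-fails (λ j → (+ j ℚ./ suc m) ^ suc k ℚ.≤? q) (suc m ℕ.* suc ℤ.∣ ℚ.↥ q ∣) (above (suc m ℕ.* suc ℤ.∣ ℚ.↥ q ∣) bound))
      where
      above : ∀ f → q ℚ.< (+ suc f ℚ./ suc m) ^ suc k → ¬ (+ suc f ℚ./ suc m) ^ suc k ℚ.≤ q
      above f q< ≤q = ℚ.<-irrefl refl (ℚ.<-≤-trans q< ≤q)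
      bound : q ℚ.< (+ suc (suc m ℕ.* suc ℤ.∣ ℚ.↥ q ∣) ℚ./ suc m) ^ suc k
      bound = <-^-chain k (/1-mono-≤ {+ 1} {+ suc ℤ.∣ ℚ.↥ q ∣} (ℤ.+≤+ (ℕ.s≤s ℕ.z≤n)))
        (<-numerator q) (/-scale (suc ℤ.∣ ℚ.↥ q ∣) m)
      helper : ∀ j → ¬ (+ suc j ℚ./ suc m) ^ suc k ℚ.≤ q →
        q ℚ.⊔ 0ℚ ℚ.< (+ j ℚ./ suc m ℚ.+ + 1 ℚ./ suc m) ^ suc k
      helper j h = ⊔-<
        (subst (λ r → q ℚ.< r ^ suc k) (/-suc j m) (ℚ.≰⇒> h))
        (^-pos {+ j ℚ./ suc m ℚ.+ + 1 ℚ./ suc m} (ℚ.+-mono-≤-< (/-nonNeg j m) (step-pos m)) (suc k))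

  ⊔-clip : ∀ {p q d} → 0ℚ ℚ.≤ d → p ℚ.≤ q ℚ.+ d → p ℚ.⊔ 0ℚ ℚ.≤ q ℚ.⊔ 0ℚ ℚ.+ d
  ⊔-clip {p} {q} {d} 0≤d h = ℚ.⊔-lub
    (ℚ.≤-trans h (ℚ.+-monoˡ-≤ d (ℚ.p≤p⊔q q 0ℚ)))
    (+-nonNeg (ℚ.p≤q⊔p q 0ℚ) 0≤d)

  rootClose : ∀ k {a b s δ p q} → 0ℚ ℚ.≤ b → 0ℚ ℚ.≤ s → 0ℚ ℚ.< δ →
    a ^ suc k ℚ.≤ p ℚ.⊔ 0ℚ → q ℚ.⊔ 0ℚ ℚ.< (b ℚ.+ s) ^ suc k →
    s ℚ.≤ half δ → p ℚ.≤ q ℚ.+ half δ ^ suc k → a ℚ.≤ b ℚ.+ δ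
  rootClose k {a} {b} {s} {δ} {p} {q} 0≤b 0≤s 0<δ a≤ <b s≤d h = ℚ.<⇒≤ (ℚ.<-≤-trans
    (^-cancel-< (+-nonNeg 0≤bs 0≤d) (suc k) (begin-strict
      a ^ suc k                        ≤⟨ a≤ ⟩
      p ℚ.⊔ 0ℚ                         ≤⟨ ⊔-clip {p} {q} (^-nonNeg 0≤d (suc k)) h ⟩
      q ℚ.⊔ 0ℚ ℚ.+ d ^ suc k           <⟨ ℚ.+-monoˡ-< (d ^ suc k) <b ⟩
      (b ℚ.+ s) ^ suc k ℚ.+ d ^ suc k  ≤⟨ ^-superadditive 0≤bs 0≤d k ⟩
      (b ℚ.+ s ℚ.+ d) ^ suc k          ∎))
    (begin
      b ℚ.+ s ℚ.+ d    ≤⟨ ℚ.+-monoˡ-≤ d (ℚ.+-monoʳ-≤ b s≤d) ⟩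
      b ℚ.+ d ℚ.+ d    ≡⟨ trans (ℚ.+-assoc b d d) (cong (b ℚ.+_) (half+half δ)) ⟩
      b ℚ.+ δ          ∎))
    where
    d = half δ
    0≤d = ℚ.<⇒≤ (half-pos 0<δ)
    0≤bs = +-nonNeg 0≤b 0≤s

open Rational hiding (_^_)

Eventually : (ℕ → Set) → Set
Eventually P = ∃[ K ] ∀ n → K ℕ.≤ n → P n

both : ∀ {P Q : ℕ → Set} → Eventually P → Eventually Q → Eventually (λ n → P n × Q n)
both (K , p) (L , q) = K ℕ.⊔ L , λ n h →
  p n (ℕ.≤-trans (ℕ.m≤m⊔n K L) h) , q n (ℕ.≤-trans (ℕ.m≤n⊔m K L) h)

-- The real numbers are Cauchy sequences of rationals, with _≈_ as equality.
record ℝ : Set where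
  constructor mkℝ
  field
    seq    : ℕ → ℚ
    cauchy : ∀ δ → 0ℚ ℚ.< δ → ∃[ K ] ∀ m n → K ℕ.≤ m → K ℕ.≤ n → ℚ.∣ seq m ℚ.- seq n ∣ ℚ.≤ δ

open ℝ public

infix 4 _≈_ _<_ _≤_

_≈_ : ℝ → ℝ → Set
x ≈ y = ∀ δ → 0ℚ ℚ.< δ → Eventually (λ n → ℚ.∣ seq x n ℚ.- seq y n ∣ ℚ.≤ δ)

_<_ : ℝ → ℝ → Set
x < y = ∃[ δ ] 0ℚ ℚ.< δ × Eventually (λ n → seq x n ℚ.+ δ ℚ.≤ seq y n)

_≤_ : ℝ → ℝ → Set
x ≤ y = ∀ δ → 0ℚ ℚ.< δ → Eventually (λ n → seq x n ℚ.≤ seq y n ℚ.+ δ)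

OneSided : (ℕ → ℚ) → Set
OneSided x = ∀ δ → 0ℚ ℚ.< δ → ∃[ K ] ∀ m n → K ℕ.≤ m → K ℕ.≤ n → x m ℚ.≤ x n ℚ.+ δ

oneSided : ∀ x → OneSided (seq x)
oneSided x δ 0<δ with cauchy x δ 0<δ
... | K , h = K , λ m n K≤m K≤n → ∣∣≤⇒≤ (h m n K≤m K≤n)

fromOneSided : ∀ x → OneSided x → ℝ
fromOneSided x h = mkℝ x λ δ 0<δ → let K , k = h δ 0<δ in
  K , λ m n K≤m K≤n → ≤⇒∣∣≤ (k m n K≤m K≤n) (k n m K≤n K≤m)

fromℚ : ℚ → ℝ
fromℚ q = fromOneSided (λ _ → q) λ δ 0<δ → 0 , λ _ _ _ _ → ≤-+ʳ (ℚ.<⇒≤ 0<δ)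

fromℕ : ℕ → ℝ
fromℕ n = fromℚ (+ n ℚ./ 1)

0ℝ 1ℝ ½ℝ : ℝ
0ℝ = fromℚ 0ℚ
1ℝ = fromℚ 1ℚ
½ℝ = fromℚ ½

infix  8 -_ √_
infixr 8 _^_
infixl 7 _*_ _⊓_
infixl 6 _+_ _-_

_+_ : ℝ → ℝ → ℝ
x + y = fromOneSided (λ n → seq x n ℚ.+ seq y n) λ δ 0<δ →
  let K , k = oneSided x (half δ) (half-pos 0<δ)
      L , l = oneSided y (half δ) (half-pos 0<δ)
  in K ℕ.⊔ L , λ m n h h′ → subst (seq x m ℚ.+ seq y m ℚ.≤_)
    (trans (solve 3 (λ a b d → a :+ d :+ (b :+ d) := a :+ b :+ (d :+ d)) refl (seq x n) (seq y n) (half δ))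
           (cong (seq x n ℚ.+ seq y n ℚ.+_) (half+half δ)))
    (ℚ.+-mono-≤ (k m n (ℕ.m⊔n≤o⇒m≤o K L h) (ℕ.m⊔n≤o⇒m≤o K L h′))
                (l m n (ℕ.m⊔n≤o⇒n≤o K L h) (ℕ.m⊔n≤o⇒n≤o K L h′)))

-_ : ℝ → ℝ
- x = mkℝ (λ n → ℚ.- seq x n) λ δ 0<δ →
  let K , k = cauchy x δ 0<δ in
  K , λ m n h h′ → subst (ℚ._≤ δ)
    (cong ℚ.∣_∣ (solve 2 (λ a b → a :- b := :- b :- (:- a)) refl (seq x n) (seq x m))) (k n m h′ h)

_-_ : ℝ → ℝ → ℝ
x - y = x + - y

_⊓_ : ℝ → ℝ → ℝ
x ⊓ y = fromOneSided (λ n → seq x n ℚ.⊓ seq y n) λ δ 0<δ →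
  let K , k = oneSided x δ 0<δ
      L , l = oneSided y δ 0<δ
  in K ℕ.⊔ L , λ m n h h′ → close {a′ = seq x n} {b′ = seq y n} {δ = δ}
    (k m n (ℕ.m⊔n≤o⇒m≤o K L h) (ℕ.m⊔n≤o⇒m≤o K L h′))
    (l m n (ℕ.m⊔n≤o⇒n≤o K L h) (ℕ.m⊔n≤o⇒n≤o K L h′))
  where
  close : ∀ {a a′ b b′ δ} → a ℚ.≤ a′ ℚ.+ δ → b ℚ.≤ b′ ℚ.+ δ → a ℚ.⊓ b ℚ.≤ a′ ℚ.⊓ b′ ℚ.+ δ
  close {a} {a′} {b} {b′} {δ} p q with ℚ.⊓-sel a′ b′
  ... | inj₁ e = subst (λ c → a ℚ.⊓ b ℚ.≤ c ℚ.+ δ) (sym e) (ℚ.≤-trans (ℚ.p⊓q≤p a b) p)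
  ... | inj₂ e = subst (λ c → a ℚ.⊓ b ℚ.≤ c ℚ.+ δ) (sym e) (ℚ.≤-trans (ℚ.p⊓q≤q a b) q)

bounded : ∀ x → ∃[ B ] 0ℚ ℚ.< B × Eventually (λ n → ℚ.∣ seq x n ∣ ℚ.≤ B)
bounded x with cauchy x 1ℚ (ℚ.positive⁻¹ 1ℚ)
... | K , k = ℚ.∣ c ∣ ℚ.+ 1ℚ , ℚ.+-mono-≤-< (ℚ.0≤∣p∣ c) (ℚ.positive⁻¹ 1ℚ) , K , λ n K≤n →
  ℚ.≤-trans (ℚ.≤-reflexive (cong ℚ.∣_∣ (solve 2 (λ a c → a := c :+ (a :- c)) refl (seq x n) c)))
    (ℚ.≤-trans (ℚ.∣p+q∣≤∣p∣+∣q∣ c (seq x n ℚ.- c)) (ℚ.+-monoʳ-≤ ℚ.∣ c ∣ (k n K K≤n ℕ.≤-refl)))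
  where c = seq x K

split : ∀ {B C δ} → 0ℚ ℚ.< B → 0ℚ ℚ.< C → 0ℚ ℚ.< δ →
  ∃[ d ] ∃[ e ] 0ℚ ℚ.< d × 0ℚ ℚ.< e × B ℚ.* d ℚ.+ C ℚ.* e ≡ δ
split {B} {C} {δ} 0<B 0<C 0<δ with recip 0<B | recip 0<C
... | b , 0<b , Bb≡1 | c , 0<c , Cc≡1 =
  h ℚ.* b , h ℚ.* c , *-pos (half-pos 0<δ) 0<b , *-pos (half-pos 0<δ) 0<c ,
  trans (cong₂ ℚ._+_ (part B b Bb≡1) (part C c Cc≡1)) (half+half δ)
  where
  h = half δ
  part : ∀ B b → B ℚ.* b ≡ 1ℚ → B ℚ.* (h ℚ.* b) ≡ h
  part B b e = trans (solve 3 (λ B h b → B :* (h :* b) := h :* (B :* b)) refl B h b)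
    (trans (cong (h ℚ.*_) e) (ℚ.*-identityʳ h))

_*_ : ℝ → ℝ → ℝ
x * y = mkℝ (λ n → seq x n ℚ.* seq y n) λ δ 0<δ →
  let B , 0<B , I , i = bounded x
      C , 0<C , J , j = bounded y
      d , e , 0<d , 0<e , eq = split 0<B 0<C 0<δ
      K , k = cauchy y d 0<d
      L , l = cauchy x e 0<e
      left  = λ {n} (h : (I ℕ.⊔ J) ℕ.⊔ (K ℕ.⊔ L) ℕ.≤ n) → ℕ.m⊔n≤o⇒m≤o (I ℕ.⊔ J) (K ℕ.⊔ L) h
      right = λ {n} (h : (I ℕ.⊔ J) ℕ.⊔ (K ℕ.⊔ L) ℕ.≤ n) → ℕ.m⊔n≤o⇒n≤o (I ℕ.⊔ J) (K ℕ.⊔ L) h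
  in (I ℕ.⊔ J) ℕ.⊔ (K ℕ.⊔ L) , λ m n h h′ →
    subst (ℚ.∣ seq x m ℚ.* seq y m ℚ.- seq x n ℚ.* seq y n ∣ ℚ.≤_) eq
      (productClose (ℚ.<⇒≤ 0<B) (ℚ.<⇒≤ 0<C)
        (i m (ℕ.m⊔n≤o⇒m≤o I J (left h))) (j n (ℕ.m⊔n≤o⇒n≤o I J (left h′)))
        (k m n (ℕ.m⊔n≤o⇒m≤o K L (right h)) (ℕ.m⊔n≤o⇒m≤o K L (right h′)))
        (l m n (ℕ.m⊔n≤o⇒n≤o K L (right h)) (ℕ.m⊔n≤o⇒n≤o K L (right h′))))

_^_ : ℝ → ℕ → ℝ
x ^ zero  = 1ℝ
x ^ suc k = x * x ^ k

seq-^ : ∀ x k n → seq (x ^ k) n ≡ seq x n Rational.^ k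
seq-^ x zero    n = refl
seq-^ x (suc k) n = cong (seq x n ℚ.*_) (seq-^ x k n)

positiveBound : ∀ {x} → 0ℝ < x → ∃[ c ] 0ℚ ℚ.< c × Eventually (λ n → c ℚ.≤ seq x n)
positiveBound {x} (c , 0<c , K , k) =
  c , 0<c , K , λ n K≤n → subst (ℚ._≤ seq x n) (ℚ.+-identityˡ c) (k n K≤n)

infixl 7 _/_[_]

_⁻¹[_] : (x : ℝ) → 0ℝ < x → ℝ
x ⁻¹[ 0<x ] = fromOneSided (λ n → inv (seq x n)) λ δ 0<δ →
  let c , 0<c , K , k = positiveBound {x} 0<x
      L , l = oneSided x (δ ℚ.* (c ℚ.* c)) (*-pos 0<δ (*-pos 0<c 0<c))
  in K ℕ.⊔ L , λ m n h h′ → inv-close 0<c (ℚ.<⇒≤ 0<δ)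
    (k m (ℕ.m⊔n≤o⇒m≤o K L h)) (k n (ℕ.m⊔n≤o⇒m≤o K L h′))
    (l n m (ℕ.m⊔n≤o⇒n≤o K L h′) (ℕ.m⊔n≤o⇒n≤o K L h))

*-⁻¹ : ∀ x (0<x : 0ℝ < x) → x * x ⁻¹[ 0<x ] ≈ 1ℝ
*-⁻¹ x 0<x δ 0<δ with positiveBound {x} 0<x
... | c , 0<c , K , k = K , λ n K≤n → subst (λ r → ℚ.∣ r ℚ.- 1ℚ ∣ ℚ.≤ δ)
  (sym (*-inv (ℚ.<-≤-trans 0<c (k n K≤n)))) (ℚ.<⇒≤ 0<δ)

_/_[_] : (x y : ℝ) → 0ℝ < y → ℝ
x / y [ 0<y ] = x * y ⁻¹[ 0<y ]

*-positive : ∀ {x y} → 0ℝ < x → 0ℝ < y → 0ℝ < x * y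
*-positive {x} {y} 0<x 0<y with positiveBound {x} 0<x | positiveBound {y} 0<y
... | c , 0<c , p | d , 0<d , q with both p q
... | K , k = c ℚ.* d , *-pos 0<c 0<d , K , λ n K≤n → let c≤ , d≤ = k n K≤n in
  subst (ℚ._≤ seq x n ℚ.* seq y n) (sym (ℚ.+-identityˡ (c ℚ.* d)))
    (*-mono (ℚ.<⇒≤ 0<d) (ℚ.<⇒≤ (ℚ.<-≤-trans 0<c c≤)) c≤ d≤)

fromℚ-mono-< : ∀ {p q} → p ℚ.< q → fromℚ p < fromℚ q
fromℚ-mono-< {p} {q} p<q = q ℚ.- p ,
  subst (ℚ._< q ℚ.- p) (ℚ.+-inverseʳ p) (ℚ.+-monoˡ-< (ℚ.- p) p<q) ,
  0 , λ _ _ → ℚ.≤-reflexive (solve 2 (λ p q → p :+ (q :- p) := q) refl p q)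

^-positive : ∀ {x} → 0ℝ < x → ∀ k → 0ℝ < x ^ k
^-positive         0<x zero    = fromℚ-mono-< (ℚ.positive⁻¹ 1ℚ)
^-positive {x} 0<x (suc k) = *-positive {x} {x ^ k} 0<x (^-positive {x} 0<x k)

fromℕ-mono-< : ∀ {m n} → m ℕ.< n → fromℕ m < fromℕ n
fromℕ-mono-< {m} {n} m<n = fromℚ-mono-< (/-< (+ m) (+ n) 1 1
  (subst₂ ℤ._<_ (sym (ℤ.*-identityʳ (+ m))) (sym (ℤ.*-identityʳ (+ n))) (ℤ.+<+ m<n)))

<⇒0<- : ∀ {x y} → x < y → 0ℝ < y - x
<⇒0<- {x} {y} (δ , 0<δ , K , k) = δ , 0<δ , K , λ n K≤n →
  subst (ℚ._≤ seq y n ℚ.- seq x n)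
    (solve 2 (λ a d → a :+ d :- a := con 0ℚ :+ d) refl (seq x n) δ)
    (ℚ.+-monoˡ-≤ (ℚ.- seq x n) (k n K≤n))

-- root k x is the k-th root of x, with negative x replaced by 0. Its n-th term is the
-- largest multiple of 1 / (n + 1) whose k-th power does not exceed the n-th term of x.
root : (k : ℕ) .{{_ : NonZero k}} → ℝ → ℝ
root (suc k) x = fromOneSided (λ n → rootApprox (suc k) n (seq x n)) λ δ 0<δ →
  let d = half δ
      0<d = half-pos 0<δ
      K , p = archimedean 0<d
      L , l = oneSided x (d Rational.^ suc k) (^-pos 0<d (suc k))
  in K ℕ.⊔ L , λ m n h h′ → close m n 0<δ (p n (ℕ.m⊔n≤o⇒m≤o K L h′))
       (l m n (ℕ.m⊔n≤o⇒n≤o K L h) (ℕ.m⊔n≤o⇒n≤o K L h′))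
  where
  close : ∀ m n {δ} → 0ℚ ℚ.< δ → + 1 ℚ./ suc n ℚ.≤ half δ →
    seq x m ℚ.≤ seq x n ℚ.+ half δ Rational.^ suc k →
    rootApprox (suc k) m (seq x m) ℚ.≤ rootApprox (suc k) n (seq x n) ℚ.+ δ
  close m n 0<δ = rootClose k {p = seq x m} {q = seq x n}
    (rootApprox-nonNeg (suc k) n (seq x n)) (/-nonNeg 1 n) 0<δ
    (rootApprox-≤ k m (seq x m)) (<-rootApprox k n (seq x n))

*-cong : ∀ {x x′ y y′} → x ≈ x′ → y ≈ y′ → x * y ≈ x′ * y′
*-cong {x} {x′} {y} {y′} x≈x′ y≈y′ δ 0<δ =
  let B , 0<B , i = bounded x
      C , 0<C , j = bounded y′
      d , e , 0<d , 0<e , eq = split 0<B 0<C 0<δ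
      K , k = both (both i j) (both (y≈y′ d 0<d) (x≈x′ e 0<e))
  in K , λ n K≤n → let (p , q) , (r , s) = k n K≤n in
    subst (ℚ.∣ seq x n ℚ.* seq y n ℚ.- seq x′ n ℚ.* seq y′ n ∣ ℚ.≤_) eq
      (productClose (ℚ.<⇒≤ 0<B) (ℚ.<⇒≤ 0<C) p q r s)

^-cong : ∀ {x y} → x ≈ y → ∀ k → x ^ k ≈ y ^ k
^-cong         x≈y zero    δ 0<δ = 0 , λ _ _ → ℚ.<⇒≤ 0<δ
^-cong {x} {y} x≈y (suc k) = *-cong {x} {y} {x ^ k} {y ^ k} x≈y (^-cong {x} {y} x≈y k)

root-nonNeg : ∀ k .{{_ : NonZero k}} x → 0ℝ ≤ root k x
root-nonNeg (suc k) x δ 0<δ = 0 , λ n _ →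
  +-nonNeg (rootApprox-nonNeg (suc k) n (seq x n)) (ℚ.<⇒≤ 0<δ)

root-^ : ∀ k .{{_ : NonZero k}} {x} → 0ℝ ≤ x → root k x ^ k ≈ x
root-^ k@(suc k-1) {x} 0≤x δ 0<δ =
  let K , h = both (^-cong {y} {z} y≈z k (half δ) (half-pos 0<δ)) (0≤x (half δ) (half-pos 0<δ)) in
  K , λ n K≤n → let yz , 0≤ = h n K≤n in squeeze n
    (∣∣≤⇒≥ {seq y n Rational.^ k} {seq z n Rational.^ k} (subst₂ (λ a b → ℚ.∣ a ℚ.- b ∣ ℚ.≤ half δ) (seq-^ y k n) (seq-^ z k n) yz)) 0≤
  where
  step y z : ℝ
  step = fromOneSided (λ n → + 1 ℚ./ suc n) λ δ 0<δ → let K , h = archimedean 0<δ in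
    K , λ m n K≤m _ → ℚ.≤-trans (h m K≤m)
      (ℚ.≤-trans (≤-+ʳ (/-nonNeg 1 n)) (ℚ.≤-reflexive (ℚ.+-comm δ (+ 1 ℚ./ suc n))))
  y = root k x
  z = y + step
  y≈z : y ≈ z
  y≈z δ 0<δ = let K , h = archimedean 0<δ in K , λ n K≤n → ≤⇒∣∣≤ {seq y n} {seq z n}
    (ℚ.≤-trans (≤-+ʳ (/-nonNeg 1 n)) (≤-+ʳ (ℚ.<⇒≤ 0<δ)))
    (ℚ.+-monoʳ-≤ (seq y n) (h n K≤n))
  half≤ : half δ ℚ.≤ δ
  half≤ = subst (half δ ℚ.≤_) (half+half δ) (≤-+ʳ (ℚ.<⇒≤ (half-pos 0<δ)))
  sandwich : ∀ {p q a b} → a ℚ.≤ q ℚ.⊔ 0ℚ → q ℚ.⊔ 0ℚ ℚ.< b → p ≡ a →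
    b ℚ.≤ a ℚ.+ half δ → 0ℚ ℚ.≤ q ℚ.+ half δ → ℚ.∣ p ℚ.- q ∣ ℚ.≤ δ
  sandwich {_} {q} {a} lo hi refl b≤ 0≤ = ≤⇒∣∣≤
    (ℚ.≤-trans lo (ℚ.≤-trans (ℚ.⊔-lub {q ℚ.+ half δ} {q} {0ℚ} (≤-+ʳ (ℚ.<⇒≤ (half-pos 0<δ))) 0≤) (ℚ.+-monoʳ-≤ q half≤)))
    (ℚ.≤-trans (ℚ.p≤p⊔q q 0ℚ) (ℚ.≤-trans (ℚ.<⇒≤ hi) (ℚ.≤-trans b≤ (ℚ.+-monoʳ-≤ a half≤))))
  squeeze : ∀ n → seq z n Rational.^ k ℚ.≤ seq y n Rational.^ k ℚ.+ half δ →
    0ℚ ℚ.≤ seq x n ℚ.+ half δ → ℚ.∣ seq (y ^ k) n ℚ.- seq x n ∣ ℚ.≤ δ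
  squeeze n = sandwich {a = seq y n Rational.^ k} {b = seq z n Rational.^ k} (rootApprox-≤ k-1 n (seq x n)) (<-rootApprox k-1 n (seq x n)) (seq-^ y k n)

√_ : ℝ → ℝ
√ x = root 2 x

-- Distance to the nearest integer: distℤ is 1-Lipschitz, so it acts on sequences termwise.
‖_‖ : ℝ → ℝ
‖ x ‖ = fromOneSided (λ n → distℤ (seq x n)) λ δ 0<δ →
  let K , k = cauchy x δ 0<δ in
  K , λ m n h h′ → ℚ.≤-trans (distℤ-lipschitz (seq x m) (seq x n))
    (ℚ.+-monoʳ-≤ (distℤ (seq x n)) (k m n h h′))

denominator>0 : ∀ n {ε} → 0ℝ < ε → 0ℝ < fromℕ (2 ℕ.^ (n ℕ.+ 1)) * ε ^ (2 ℕ.* n)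
denominator>0 n {ε} ε>0 = *-positive {fromℕ (2 ℕ.^ (n ℕ.+ 1))} {ε ^ (2 ℕ.* n)}
  (fromℕ-mono-< (ℕ.m^n>0 2 (n ℕ.+ 1))) (^-positive {ε} ε>0 (2 ℕ.* n))

N-n>0 : ∀ {n N} → n ℕ.< N → 0ℝ < fromℕ N - fromℕ n
N-n>0 {n} {N} n<N = <⇒0<- {fromℕ n} {fromℕ N} (fromℕ-mono-< n<N)

loneliness : ∀ {n} .{{_ : NonZero n}} → Vec ℕ n → ℝ → ℝ
loneliness {suc _} v t = Vec.foldr₁ _⊓_ (Vec.map (λ vᵢ → ‖ t * fromℕ vᵢ ‖) v)

IsMaximum : (ℝ → ℝ) → ℝ → Set
IsMaximum f m = (∃[ t ] f t ≈ m) × (∀ t → f t ≤ m)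

infix 4 ML_≥_

-- Part of the claim ML v ≥ x is that the maximum over t is attained.
ML_≥_ : ∀ {n} .{{_ : NonZero n}} → Vec ℕ n → ℝ → Set
ML v ≥ x = ∃[ m ] IsMaximum (loneliness v) m × x ≤ m

-- The n-element subsets of a duplicate-free list, each listed once in the order of the list.
subsets : ∀ {A : Set} (n : ℕ) → List A → List (Vec A n)
subsets zero    xs       = [] ∷ []
subsets (suc n) []       = []
subsets (suc n) (x ∷ xs) = map (x ∷_) (subsets n xs) ++ subsets (suc n) xs

ratio : ℕ → ℕ → ℚ
ratio a zero      = 0ℚ
ratio a b@(suc _) = + a ℚ./ b

-- Uniform probability on the entries of Ω (with value 0 if Ω is empty).
ℙ : ∀ {A : Set} → List A → (A → Bool) → ℝ
ℙ Ω E = fromℚ (ratio (length (filterᵇ E Ω)) (length Ω))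

-- For an event that need not be decidable (an inequality between reals is not), exceeding p
-- means containing a decidable event of probability exceeding p. For decidable events this
-- is the plain comparison, by ℙ>⇔.
ℙ[_∣_]>_ : ∀ {A : Set} → List A → (A → Set) → ℝ → Set
ℙ[ Ω ∣ E ]> p = ∃[ D ] (∀ x → x ∈ Ω → T (D x) → E x) × p < ℙ Ω D

ℙ>⇔ : ∀ {A : Set} (Ω : List A) {E : A → Set} (E? : ∀ x → Dec (E x)) p →
  (ℙ[ Ω ∣ E ]> p) ⇔ (p < ℙ Ω (λ x → does (E? x)))
ℙ>⇔ {A} Ω {E} E? p = mk⇔ to from
  where
  e : A → Bool
  e x = does (E? x)
  ratio-mono : ∀ {a b} n → a ℕ.≤ b → ratio a n ℚ.≤ ratio b n
  ratio-mono         zero    a≤b = ℚ.≤-refl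
  ratio-mono {a} {b} (suc n) a≤b = /-≤ (+ a) (+ b) (suc n) (suc n)
    (ℤ.*-monoʳ-≤-nonNeg (+ suc n) (ℤ.+≤+ a≤b))
  count-mono : ∀ (D : A → Bool) xs → (∀ x → x ∈ xs → T (D x) → E x) →
    length (filterᵇ D xs) ℕ.≤ length (filterᵇ e xs)
  count-mono D []       h = ℕ.z≤n
  count-mono D (x ∷ xs) h with D x | h x (here refl) | E? x
  ... | false | _ | no  _ = count-mono D xs (λ y y∈ → h y (there y∈))
  ... | false | _ | yes _ = ℕ.m≤n⇒m≤1+n (count-mono D xs (λ y y∈ → h y (there y∈)))
  ... | true  | _ | yes _ = ℕ.s≤s (count-mono D xs (λ y y∈ → h y (there y∈)))
  ... | true  | g | no ¬e = ⊥-elim (¬e (g _))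
  witness : ∀ {P : Set} (P? : Dec P) → T (does P?) → P
  witness (yes p) _ = p
  to : (ℙ[ Ω ∣ E ]> p) → p < ℙ Ω e
  to (D , D⊆E , δ , 0<δ , K , k) = δ , 0<δ , K , λ n K≤n →
    ℚ.≤-trans (k n K≤n) (ratio-mono (length Ω) (count-mono D Ω D⊆E))
  from : p < ℙ Ω e → ℙ[ Ω ∣ E ]> p
  from h = e , (λ x _ → witness (E? x)) , h

{-# OPTIONS --safe #-}

-- Let M = ⌊N^(1/(n+1))⌋. A random v is unlikely to satisfy a nontrivial relation c · v = 0 with integer
-- coefficients of size at most H ≈ M: such a relation determines one entry of v by the others, and there
-- are (2H + 1)ⁿ of them. If v satisfies none, a transference argument shows that the line ℝv comes
-- within ε of (½, …, ½) modulo 1. The quadratic form q(m) = |m|² + (H + 1)² (m · v)² is at least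
-- (H + 1)² on ℤⁿ ∖ 0. If q ≥ μ on the nonzero vectors of a lattice of rank k, every linear functional X
-- agrees modulo integral functionals with one satisfying X(m)² ≤ ((2ᵏ - 1) / 4μ) q(m): split off a
-- shortest vector m₀, round X at m₀, and induct on the form orthogonal to m₀, which is at least
-- ½ q(m₀) outside its radical. Apply this to X = (½, …, ½) and evaluate at vectors orthogonal to v.
--
-- The maximum over t is attained because, while all floors ⌊t vᵢ⌋ are constant, the loneliness is the
-- minimum of increasing and decreasing linear functions and peaks at some k / (vᵢ + vⱼ).
module Submission where

open import Defs
open import Data.Bool using (Bool; true; false; T; not; _∧_; _∨_)
open import Data.Bool.ListAction using (any)
open import Data.Empty using (⊥; ⊥-elim)
open import Data.Fin as Fin using (Fin; zero; suc)
import Data.Fin.Properties as Fin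
open import Data.Integer as ℤ using (ℤ; +_; -[1+_]; 0ℤ; 1ℤ)
import Data.Integer.DivMod as ℤ
import Data.Integer.Properties as ℤ
open import Data.Integer.Solver using () renaming (module +-*-Solver to ℤ-Solver)
open import Data.List as List using (List; []; _∷_; _++_; length; filterᵇ; cartesianProductWith)
import Data.List.Properties as List
open import Data.List.Membership.Propositional using (_∈_)
import Data.List.Membership.Propositional.Properties as ∈
open import Data.List.Relation.Unary.All as All using (All)
open import Data.List.Relation.Unary.AllPairs using (_∷_)
open import Data.List.Relation.Unary.Any using (here; there)
open import Data.List.Relation.Unary.Unique.Propositional using (Unique)
open import Data.Nat as ℕ using (ℕ; zero; suc; NonZero; _!)
import Data.Nat.Divisibility as ℕ
import Data.Nat.DivMod as ℕ
open import Data.Nat.Induction using (<-rec)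
import Data.Nat.Properties as ℕ
open import Data.Nat.Solver using () renaming (module +-*-Solver to ℕ-Solver)
open import Data.Product using (Σ; ∃-syntax; _×_; _,_; proj₁; proj₂)
open import Data.Rational as ℚ using (ℚ; 0ℚ; 1ℚ; ½)
import Data.Rational.Properties as ℚ
open import Data.Rational.Solver using () renaming (module +-*-Solver to ℚ-Solver)
import Data.Rational.Unnormalised as ℚᵘ
import Data.Rational.Unnormalised.Properties as ℚᵘ
open import Data.Sum using (_⊎_; inj₁; inj₂)
open import Data.Vec as Vec using (Vec; []; _∷_)
import Data.Vec.Properties as Vec
open import Data.Vec.Relation.Unary.All as VecAll using ([]; _∷_)
import Data.Vec.Relation.Unary.All.Properties as VecAll
open import Function using (_∘_)
open import Relation.Binary.PropositionalEquality using (_≡_; _≢_; refl; sym; trans; cong; cong₂; subst; subst₂; module ≡-Reasoning)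
open import Relation.Nullary using (¬_; Dec; yes; no; does)
open import Relation.Nullary.Decidable using (decidable-stable)

-- A shortest vector is chosen by classical reasoning, so transference yields its conclusion only
-- under a double negation. The exact maximum over t removes it: the maximising time is a computed
-- rational, and whether its loneliness is at least ½ - ε is, for rational ε, a decidable question.
-- That time depends on v alone, so each late term of the sequence ε can be treated as a rational
-- number of its own. The event, an inequality of reals, is replaced by the decidable event that v
-- has no relation of height H.
--
-- No quotient lattice is formed: every projection acts on the same vectors, with denominators
-- cleared, and only enlarges the radical. This is why integrality on the radical is carried through
-- the induction.
--
-- The constants meet as follows. For ε ≤ ½ the hypothesis gives n³ 6ⁿ⁻¹ ≤ 4 ε² M², while
-- transference asks for 2ⁿ - 1 ≤ 4 ε² (H + 1)². The room between the two pays for taking H near M /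
-- 2 when n ≥ 2. The summand 1 in the hypothesis makes up for passing from the root of N to its
-- floor M.

module ℤ-Order where

  -- Integer inequalities, with squares in place of roots and denominators cleared.

  open ℤ-Solver
  open ℤ.≤-Reasoning

  +-nonNeg : ∀ {i j} → 0ℤ ℤ.≤ i → 0ℤ ℤ.≤ j → 0ℤ ℤ.≤ i ℤ.+ j
  +-nonNeg 0≤i 0≤j = ℤ.+-mono-≤ 0≤i 0≤j

  *-nonNeg : ∀ {i j} → 0ℤ ℤ.≤ i → 0ℤ ℤ.≤ j → 0ℤ ℤ.≤ i ℤ.* j
  *-nonNeg {i} {j} 0≤i 0≤j = subst (ℤ._≤ i ℤ.* j) (ℤ.*-zeroʳ i)
    (ℤ.*-monoˡ-≤-nonNeg i {{ℤ.nonNegative 0≤i}} 0≤j)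

  square-nonNeg : ∀ i → 0ℤ ℤ.≤ i ℤ.* i
  square-nonNeg (+ n)    = *-nonNeg {+ n} {+ n} (ℤ.+≤+ ℕ.z≤n) (ℤ.+≤+ ℕ.z≤n)
  square-nonNeg -[1+ n ] = ℤ.+≤+ ℕ.z≤n

  *-mono-≤ : ∀ {i j k l} → 0ℤ ℤ.≤ k → 0ℤ ℤ.≤ j → i ℤ.≤ j → k ℤ.≤ l → i ℤ.* k ℤ.≤ j ℤ.* l
  *-mono-≤ {i} {j} {k} {l} 0≤k 0≤j i≤j k≤l = ℤ.≤-trans
    (ℤ.*-monoʳ-≤-nonNeg k {{ℤ.nonNegative 0≤k}} i≤j)
    (ℤ.*-monoˡ-≤-nonNeg j {{ℤ.nonNegative 0≤j}} k≤l)

  ≤-by : ∀ {i j d} → 0ℤ ℤ.≤ d → i ℤ.+ d ≡ j → i ℤ.≤ j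
  ≤-by {i} {d = d} 0≤d refl = subst (ℤ._≤ i ℤ.+ d) (ℤ.+-identityʳ i) (ℤ.+-monoʳ-≤ i 0≤d)

  *-cancelˡ-≤ : ∀ {i j k} → 0ℤ ℤ.< k → k ℤ.* i ℤ.≤ k ℤ.* j → i ℤ.≤ j
  *-cancelˡ-≤ {i} {j} {k} 0<k = ℤ.*-cancelˡ-≤-pos i j k {{ℤ.positive 0<k}}

  *-pos : ∀ {i j} → 0ℤ ℤ.< i → 0ℤ ℤ.< j → 0ℤ ℤ.< i ℤ.* j
  *-pos {i} {j} 0<i 0<j = subst (ℤ._< i ℤ.* j) (ℤ.*-zeroʳ i)
    (ℤ.*-monoˡ-<-pos i {{ℤ.positive 0<i}} 0<j)

  square-cancel-≤ : ∀ {i j} → 0ℤ ℤ.≤ j → i ℤ.* i ℤ.≤ j ℤ.* j → i ℤ.≤ j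
  square-cancel-≤ {i} {j} 0≤j i²≤j² with i ℤ.≤? j
  ... | yes i≤j = i≤j
  ... | no  i≰j = ⊥-elim (ℤ.<-irrefl refl (ℤ.≤-<-trans i²≤j² (ℤ.≤-<-trans
      (ℤ.*-monoˡ-≤-nonNeg j {{ℤ.nonNegative 0≤j}} (ℤ.<⇒≤ j<i))
      (ℤ.*-monoʳ-<-pos i {{ℤ.positive (ℤ.≤-<-trans 0≤j j<i)}} j<i))))
    where j<i = ℤ.≰⇒> i≰j

  square-zero : ∀ {i} → i ℤ.* i ℤ.≤ 0ℤ → i ≡ 0ℤ
  square-zero {i} i²≤0 with ℤ.i*j≡0⇒i≡0∨j≡0 i (ℤ.≤-antisym i²≤0 (square-nonNeg i))
  ... | inj₁ e = e
  ... | inj₂ e = e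

  -- The cross term satisfies 2ab ≤ αw + βu, because (2ab)² ≤ 4αβuw ≤ (αw + βu)², the last step
  -- being the square of αw - βu.
  cauchySchwarz : ∀ {a b α β u w} → 0ℤ ℤ.≤ α → 0ℤ ℤ.≤ β → 0ℤ ℤ.≤ u → 0ℤ ℤ.≤ w →
    a ℤ.* a ℤ.≤ α ℤ.* u → b ℤ.* b ℤ.≤ β ℤ.* w →
    (a ℤ.+ b) ℤ.* (a ℤ.+ b) ℤ.≤ (α ℤ.+ β) ℤ.* (u ℤ.+ w)
  cauchySchwarz {a} {b} {α} {β} {u} {w} 0≤α 0≤β 0≤u 0≤w a²≤ b²≤ = begin
    (a ℤ.+ b) ℤ.* (a ℤ.+ b)
      ≡⟨ solve 2 (λ a b → (a :+ b) :* (a :+ b) := a :* a :+ b :* b :+ con (+ 2) :* a :* b) refl a b ⟩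
    a ℤ.* a ℤ.+ b ℤ.* b ℤ.+ + 2 ℤ.* a ℤ.* b
      ≤⟨ ℤ.+-mono-≤ (ℤ.+-mono-≤ a²≤ b²≤) (square-cancel-≤
           (+-nonNeg (*-nonNeg 0≤α 0≤w) (*-nonNeg 0≤β 0≤u)) cross) ⟩
    α ℤ.* u ℤ.+ β ℤ.* w ℤ.+ (α ℤ.* w ℤ.+ β ℤ.* u)
      ≡⟨ solve 4 (λ α β u w → α :* u :+ β :* w :+ (α :* w :+ β :* u) := (α :+ β) :* (u :+ w))
           refl α β u w ⟩
    (α ℤ.+ β) ℤ.* (u ℤ.+ w) ∎
    where
    d = α ℤ.* w ℤ.- β ℤ.* u
    cross : + 2 ℤ.* a ℤ.* b ℤ.* (+ 2 ℤ.* a ℤ.* b) ℤ.≤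
      (α ℤ.* w ℤ.+ β ℤ.* u) ℤ.* (α ℤ.* w ℤ.+ β ℤ.* u)
    cross = begin
      + 2 ℤ.* a ℤ.* b ℤ.* (+ 2 ℤ.* a ℤ.* b)
        ≡⟨ solve 2 (λ a b → con (+ 2) :* a :* b :* (con (+ 2) :* a :* b)
             := con (+ 4) :* (a :* a :* (b :* b))) refl a b ⟩
      + 4 ℤ.* (a ℤ.* a ℤ.* (b ℤ.* b))
        ≤⟨ ℤ.*-monoˡ-≤-nonNeg (+ 4) (*-mono-≤ (square-nonNeg b) (*-nonNeg 0≤α 0≤u) a²≤ b²≤) ⟩
      + 4 ℤ.* (α ℤ.* u ℤ.* (β ℤ.* w))
        ≤⟨ ≤-by (square-nonNeg d) (solve 4 (λ α β u w →
             con (+ 4) :* (α :* u :* (β :* w)) :+ (α :* w :- β :* u) :* (α :* w :- β :* u)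
             := (α :* w :+ β :* u) :* (α :* w :+ β :* u)) refl α β u w) ⟩
      (α ℤ.* w ℤ.+ β ℤ.* u) ℤ.* (α ℤ.* w ℤ.+ β ℤ.* u) ∎

  nearestMultiple : ∀ x E → 0ℤ ℤ.< E →
    ∃[ r ] + 4 ℤ.* ((x ℤ.- r ℤ.* E) ℤ.* (x ℤ.- r ℤ.* E)) ℤ.≤ E ℤ.* E
  nearestMultiple x (+ zero) (ℤ.+<+ ())
  nearestMultiple x E@(ℤ.+[1+ e ]) _ = r , (begin
    + 4 ℤ.* ((x ℤ.- r ℤ.* E) ℤ.* (x ℤ.- r ℤ.* E))
      ≡⟨ trans (step-square (x ℤ.- r ℤ.* E)) (cong (λ y → y ℤ.* y) 2s) ⟩
    (ρ ℤ.- E) ℤ.* (ρ ℤ.- E)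
      ≤⟨ ≤-by (*-nonNeg {ρ} (ℤ.+≤+ ℕ.z≤n) (ℤ.i≤j⇒0≤j-i (ℤ.<⇒≤ ρ<2E)))
           (solve 2 (λ ρ E → (ρ :- E) :* (ρ :- E) :+ ρ :* (con (+ 2) :* E :- ρ) := E :* E) refl ρ E) ⟩
    E ℤ.* E ∎)
    where
    -- Rounding x / E means taking the floor of (2x + E) / 2E. The remainder ρ then gives 2 (x - rE)
    -- = ρ - E with 0 ≤ ρ < 2E.
    y = + 2 ℤ.* x ℤ.+ E
    r = y ℤ./ℕ (2 ℕ.* suc e)
    ρ = + (y ℤ.%ℕ (2 ℕ.* suc e))
    ρ<2E : ρ ℤ.< + 2 ℤ.* E
    ρ<2E = subst (ρ ℤ.<_) (ℤ.pos-* 2 (suc e)) (ℤ.+<+ (ℤ.n%ℕd<d y (2 ℕ.* suc e)))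
    division : y ≡ ρ ℤ.+ r ℤ.* (+ 2 ℤ.* E)
    division = trans (ℤ.a≡a%ℕn+[a/ℕn]*n y (2 ℕ.* suc e))
      (cong (λ z → ρ ℤ.+ r ℤ.* z) (ℤ.pos-* 2 (suc e)))
    2s : + 2 ℤ.* (x ℤ.- r ℤ.* E) ≡ ρ ℤ.- E
    2s = trans
      (solve 3 (λ x r E → con (+ 2) :* (x :- r :* E) := con (+ 2) :* x :+ E :- r :* (con (+ 2) :* E) :- E)
        refl x r E)
      (trans (cong (λ z → z ℤ.- r ℤ.* (+ 2 ℤ.* E) ℤ.- E) division)
      (solve 3 (λ ρ r E → ρ :+ r :* (con (+ 2) :* E) :- r :* (con (+ 2) :* E) :- E := ρ :- E)
        refl ρ r E))
    step-square : ∀ s → + 4 ℤ.* (s ℤ.* s) ≡ + 2 ℤ.* s ℤ.* (+ 2 ℤ.* s)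
    step-square = solve 1 (λ s → con (+ 4) :* (s :* s) := con (+ 2) :* s :* (con (+ 2) :* s)) refl

  gap≤0-arith : ∀ q s {t} → t ≡ 0ℤ → q ℤ.* t ℤ.- s ℤ.* s ℤ.≤ 0ℤ
  gap≤0-arith q s refl = subst (ℤ._≤ 0ℤ)
    (solve 2 (λ q s → :- (s :* s) := q :* con 0ℤ :- s :* s) refl q s)
    (ℤ.neg-mono-≤ (square-nonNeg s))

  -- This is where half of the minimum survives a projection: q is the least positive norm, t the
  -- norm of a vector whose product s with the shortest vector is at most q / 2 in absolute value,
  -- and the right side is its norm after projection, scaled by 2q.
  gap≥-arith : ∀ {q s t} → 0ℤ ℤ.≤ q → q ℤ.≤ t → + 4 ℤ.* (s ℤ.* s) ℤ.≤ q ℤ.* q →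
    q ℤ.* q ℤ.≤ + 2 ℤ.* (q ℤ.* t ℤ.- s ℤ.* s)
  gap≥-arith {q} {s} {t} 0≤q q≤t small = ≤-by
    (+-nonNeg
      (+-nonNeg (*-nonNeg {+ 2} (ℤ.+≤+ ℕ.z≤n) (*-nonNeg 0≤q (ℤ.i≤j⇒0≤j-i q≤t)))
                (ℤ.i≤j⇒0≤j-i small))
      (*-nonNeg {+ 2} (ℤ.+≤+ ℕ.z≤n) (square-nonNeg s)))
    (solve 3 (λ q t s → q :* q :+ (con (+ 2) :* (q :* (t :- q)) :+ (q :* q :- con (+ 4) :* (s :* s))
        :+ con (+ 2) :* (s :* s))
      := con (+ 2) :* (q :* t :- s :* s)) refl q t s)

  gap≡0-arith : ∀ q {i j t} → q ℤ.* t ℤ.- (i ℤ.- j) ℤ.* (i ℤ.- j) ≡ 0ℤ → t ≡ 0ℤ → i ≡ j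
  gap≡0-arith q {i} {j} e refl = ℤ.i-j≡0⇒i≡j i j (square-zero (ℤ.≤-reflexive (trans
    (solve 2 (λ q t → t := :- (q :* con 0ℤ :- t)) refl q ((i ℤ.- j) ℤ.* (i ℤ.- j))) (cong ℤ.-_ e))))

  integral-arith : ∀ q E j r {x x₀ h y} → h ≡ j ℤ.* q → 1ℤ ℤ.* x ℤ.+ ℤ.- j ℤ.* x₀ ≡ E ℤ.* y →
    q ℤ.* x ℤ.+ ℤ.- (x₀ ℤ.- r ℤ.* E) ℤ.* h ≡ E ℤ.* q ℤ.* (y ℤ.+ j ℤ.* r)
  integral-arith q E j r {x} {x₀} {_} {y} refl e = begin-equality
    q ℤ.* x ℤ.+ ℤ.- (x₀ ℤ.- r ℤ.* E) ℤ.* (j ℤ.* q)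
      ≡⟨ solve 6 (λ q x x₀ j r E → q :* x :+ :- (x₀ :- r :* E) :* (j :* q)
           := q :* (con 1ℤ :* x :+ :- j :* x₀) :+ q :* (j :* r :* E)) refl q x x₀ j r E ⟩
    q ℤ.* (1ℤ ℤ.* x ℤ.+ ℤ.- j ℤ.* x₀) ℤ.+ q ℤ.* (j ℤ.* r ℤ.* E)
      ≡⟨ cong (λ z → q ℤ.* z ℤ.+ q ℤ.* (j ℤ.* r ℤ.* E)) e ⟩
    q ℤ.* (E ℤ.* y) ℤ.+ q ℤ.* (j ℤ.* r ℤ.* E)
      ≡⟨ solve 5 (λ q E y j r → q :* (E :* y) :+ q :* (j :* r :* E) := E :* q :* (y :+ j :* r)) refl q E y j r ⟩
    E ℤ.* q ℤ.* (y ℤ.+ j ℤ.* r) ∎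

  -- The error x - Ey, multiplied by q, is the error of the projected functional plus S h, where S
  -- is the rounding error at the shortest vector. Likewise q n is the gap plus h². `cauchySchwarz`
  -- with weights 2aE² and E² adds the two bounds, and the sum of the weights is the new constant.
  lift-arith : ∀ {a E q n h x y S μ} → 0ℤ ℤ.≤ a → 0ℤ ℤ.< q → μ ℤ.≤ q → 0ℤ ℤ.≤ q ℤ.* n ℤ.- h ℤ.* h →
    + 4 ℤ.* (S ℤ.* S) ℤ.≤ E ℤ.* E →
    + 4 ℤ.* (q ℤ.* q) ℤ.* ((q ℤ.* x ℤ.+ ℤ.- S ℤ.* h ℤ.- E ℤ.* q ℤ.* y) ℤ.* (q ℤ.* x ℤ.+ ℤ.- S ℤ.* h ℤ.- E ℤ.* q ℤ.* y))
      ℤ.≤ a ℤ.* (E ℤ.* q ℤ.* (E ℤ.* q)) ℤ.* (+ 2 ℤ.* (q ℤ.* n ℤ.- h ℤ.* h)) →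
    + 4 ℤ.* μ ℤ.* ((x ℤ.- E ℤ.* y) ℤ.* (x ℤ.- E ℤ.* y)) ℤ.≤ (1ℤ ℤ.+ + 2 ℤ.* a) ℤ.* (E ℤ.* E) ℤ.* n
  lift-arith {a} {E} {q} {n} {h} {x} {y} {S} {μ} 0≤a 0<q μ≤q 0≤gap close bound = ℤ.≤-trans
    (ℤ.*-monoʳ-≤-nonNeg (F ℤ.* F) {{ℤ.nonNegative (square-nonNeg F)}} (ℤ.*-monoˡ-≤-nonNeg (+ 4) μ≤q))
    (*-cancelˡ-≤ 0<q (begin
      q ℤ.* (+ 4 ℤ.* q ℤ.* (F ℤ.* F))
        ≡⟨ solve 6 (λ q x E y S h →
             q :* (con (+ 4) :* q :* ((x :- E :* y) :* (x :- E :* y)))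
             := (con (+ 2) :* (q :* x :+ :- S :* h :- E :* q :* y) :+ con (+ 2) :* (S :* h))
                :* (con (+ 2) :* (q :* x :+ :- S :* h :- E :* q :* y) :+ con (+ 2) :* (S :* h)))
             refl q x E y S h ⟩
      (+ 2 ℤ.* F′ ℤ.+ + 2 ℤ.* (S ℤ.* h)) ℤ.* (+ 2 ℤ.* F′ ℤ.+ + 2 ℤ.* (S ℤ.* h))
        ≤⟨ cauchySchwarz {+ 2 ℤ.* F′} {+ 2 ℤ.* (S ℤ.* h)} {+ 2 ℤ.* a ℤ.* (E ℤ.* E)}
             (*-nonNeg {+ 2 ℤ.* a} (*-nonNeg {+ 2} (ℤ.+≤+ ℕ.z≤n) 0≤a) (square-nonNeg E))
             (square-nonNeg E) 0≤gap (square-nonNeg h) first second ⟩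
      (+ 2 ℤ.* a ℤ.* (E ℤ.* E) ℤ.+ E ℤ.* E) ℤ.* (gap ℤ.+ h ℤ.* h)
        ≡⟨ solve 5 (λ a E q n h → (con (+ 2) :* a :* (E :* E) :+ E :* E) :* (q :* n :- h :* h :+ h :* h)
             := q :* ((con 1ℤ :+ con (+ 2) :* a) :* (E :* E) :* n)) refl a E q n h ⟩
      q ℤ.* ((1ℤ ℤ.+ + 2 ℤ.* a) ℤ.* (E ℤ.* E) ℤ.* n) ∎))
    where
    F   = x ℤ.- E ℤ.* y
    F′  = q ℤ.* x ℤ.+ ℤ.- S ℤ.* h ℤ.- E ℤ.* q ℤ.* y
    gap = q ℤ.* n ℤ.- h ℤ.* h
    first : + 2 ℤ.* F′ ℤ.* (+ 2 ℤ.* F′) ℤ.≤ + 2 ℤ.* a ℤ.* (E ℤ.* E) ℤ.* gap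
    first = *-cancelˡ-≤ (*-pos 0<q 0<q) (begin
      q ℤ.* q ℤ.* (+ 2 ℤ.* F′ ℤ.* (+ 2 ℤ.* F′))
        ≡⟨ solve 2 (λ q f → q :* q :* (con (+ 2) :* f :* (con (+ 2) :* f))
             := con (+ 4) :* (q :* q) :* (f :* f)) refl q F′ ⟩
      + 4 ℤ.* (q ℤ.* q) ℤ.* (F′ ℤ.* F′)
        ≤⟨ bound ⟩
      a ℤ.* (E ℤ.* q ℤ.* (E ℤ.* q)) ℤ.* (+ 2 ℤ.* gap)
        ≡⟨ solve 4 (λ a E q g → a :* (E :* q :* (E :* q)) :* (con (+ 2) :* g)
             := q :* q :* (con (+ 2) :* a :* (E :* E) :* g)) refl a E q gap ⟩
      q ℤ.* q ℤ.* (+ 2 ℤ.* a ℤ.* (E ℤ.* E) ℤ.* gap) ∎)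
    second : + 2 ℤ.* (S ℤ.* h) ℤ.* (+ 2 ℤ.* (S ℤ.* h)) ℤ.≤ E ℤ.* E ℤ.* (h ℤ.* h)
    second = begin
      + 2 ℤ.* (S ℤ.* h) ℤ.* (+ 2 ℤ.* (S ℤ.* h))
        ≡⟨ solve 2 (λ S h → con (+ 2) :* (S :* h) :* (con (+ 2) :* (S :* h))
             := con (+ 4) :* (S :* S) :* (h :* h)) refl S h ⟩
      + 4 ℤ.* (S ℤ.* S) ℤ.* (h ℤ.* h)
        ≤⟨ ℤ.*-monoʳ-≤-nonNeg (h ℤ.* h) {{ℤ.nonNegative (square-nonNeg h)}} close ⟩
      E ℤ.* E ℤ.* (h ℤ.* h) ∎

-- Transference for positive semidefinite integral forms.

transferenceConstant : ℕ → ℕ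
transferenceConstant zero    = 0
-- This solves to 2ᵏ - 1 at k. The 1 is the cost of rounding at the shortest vector, and the factor
-- 2 arises because the projected form keeps only half of the minimum.
transferenceConstant (suc k) = 1 ℕ.+ 2 ℕ.* transferenceConstant k

-- Nothing is assumed about A and comb, as only the values of linear functions on A are ever compared.
module Transference {A : Set} (comb : ℤ → A → ℤ → A → A) where

  open ℤ-Order
  open ℤ-Solver
  open ℤ.≤-Reasoning

  Linear : (A → ℤ) → Set
  Linear f = ∀ a m c p → f (comb a m c p) ≡ a ℤ.* f m ℤ.+ c ℤ.* f p

  linear-combination : ∀ {f g} → Linear f → Linear g → ∀ x y →
    Linear (λ m → x ℤ.* f m ℤ.+ y ℤ.* g m)
  linear-combination {f} {g} f-lin g-lin x y a m c p =
    trans (cong₂ (λ s t → x ℤ.* s ℤ.+ y ℤ.* t) (f-lin a m c p) (g-lin a m c p))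
      (solve 8 (λ x y a c fm fp gm gp →
        x :* (a :* fm :+ c :* fp) :+ y :* (a :* gm :+ c :* gp)
        := a :* (x :* fm :+ y :* gm) :+ c :* (x :* fp :+ y :* gp))
        refl x y a c (f m) (f p) (g m) (g p))

  record PSDForm : Set where
    field
      _·_        : A → A → ℤ
      symmetric  : ∀ m p → m · p ≡ p · m
      linear     : ∀ p → Linear (_· p)
      normNonNeg : ∀ m → 0ℤ ℤ.≤ m · m

    norm : A → ℤ
    norm m = m · m

    norm-comb : ∀ a m c p →
      norm (comb a m c p) ≡ a ℤ.* a ℤ.* norm m ℤ.+ + 2 ℤ.* a ℤ.* c ℤ.* (m · p) ℤ.+ c ℤ.* c ℤ.* norm p
    norm-comb a m c p = trans (linear (comb a m c p) a m c p) (trans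
      (cong₂ (λ s t → a ℤ.* s ℤ.+ c ℤ.* t) (expand m) (expand p))
      (trans (cong (λ z → a ℤ.* (a ℤ.* norm m ℤ.+ c ℤ.* z) ℤ.+ c ℤ.* (a ℤ.* (m · p) ℤ.+ c ℤ.* norm p)) (symmetric p m))
        (solve 5 (λ a c mm mp pp → a :* (a :* mm :+ c :* mp) :+ c :* (a :* mp :+ c :* pp)
          := a :* a :* mm :+ con (+ 2) :* a :* c :* mp :+ c :* c :* pp)
          refl a c (norm m) (m · p) (norm p))))
      where
      expand : ∀ q → q · comb a m c p ≡ a ℤ.* (m · q) ℤ.+ c ℤ.* (p · q)
      expand q = trans (symmetric q _) (linear q a m c p)

  open PSDForm

  Functional : Set
  Functional = Σ (A → ℤ) Linear

  Vanishes : A → Functional → Set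
  Vanishes m ℓ = proj₁ ℓ m ≡ 0ℤ

  -- The codimension of the radical is bounded by functionals rather than by a basis, since the
  -- carrier has no module laws from which a basis could be used.
  RankAtMost : ℕ → PSDForm → Set
  RankAtMost k φ = Σ (Vec Functional k) λ ℓs → ∀ m → VecAll.All (Vanishes m) ℓs → norm φ m ≡ 0ℤ

  -- The last component, stated for every predicate P, expresses that ℓ and the rest exhaust the
  -- list, whatever the order.
  pivot : ∀ {k} m (ℓs : Vec Functional (suc k)) → ¬ VecAll.All (Vanishes m) ℓs →
    ∃[ ℓ ] ¬ Vanishes m ℓ × Σ (Vec Functional k) λ rest →
      ∀ {P : Functional → Set} → P ℓ → VecAll.All P rest → VecAll.All P ℓs
  pivot m (ℓ ∷ ℓs) ¬all with proj₁ ℓ m ℤ.≟ 0ℤ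
  ... | no  ℓm≢0 = ℓ , ℓm≢0 , ℓs , _∷_
  pivot m (ℓ ∷ [])        ¬all | yes ℓm≡0 = ⊥-elim (¬all (ℓm≡0 ∷ []))
  pivot m (ℓ ∷ ℓs@(_ ∷ _)) ¬all | yes ℓm≡0 with pivot m ℓs (λ all → ¬all (ℓm≡0 ∷ all))
  ... | f , fm≢0 , rest , back =
    f , fm≢0 , ℓ ∷ rest , λ where pf (pℓ ∷ prest) → pℓ ∷ back pf prest

  module Projection (φ : PSDForm) (m₀ : A) (0<norm : 0ℤ ℤ.< norm φ m₀) where

    open PSDForm φ using () renaming (_·_ to _∙_)

    q₀ : ℤ
    q₀ = norm φ m₀

    gap : A → ℤ
    gap m = q₀ ℤ.* norm φ m ℤ.- (m ∙ m₀) ℤ.* (m ∙ m₀)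

    -- `gap` is the Gram determinant of m and m₀: adding a multiple of m₀ to m does not change it,
    -- and scaling m by a multiplies it by a². The right side is the Gram determinant of the
    -- combination and m₀, written out.
    gap-comb : ∀ a c m → a ℤ.* a ℤ.* gap m ≡ q₀ ℤ.* norm φ (comb a m c m₀)
      ℤ.- (a ℤ.* (m ∙ m₀) ℤ.+ c ℤ.* q₀) ℤ.* (a ℤ.* (m ∙ m₀) ℤ.+ c ℤ.* q₀)
    gap-comb a c m = trans
      (solve 5 (λ a c q₀ mm m0 → a :* a :* (q₀ :* mm :- m0 :* m0)
        := q₀ :* (a :* a :* mm :+ con (+ 2) :* a :* c :* m0 :+ c :* c :* q₀)
           :- (a :* m0 :+ c :* q₀) :* (a :* m0 :+ c :* q₀))
        refl a c q₀ (norm φ m) (m ∙ m₀))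
      (cong (λ z → q₀ ℤ.* z ℤ.- (a ℤ.* (m ∙ m₀) ℤ.+ c ℤ.* q₀) ℤ.* (a ℤ.* (m ∙ m₀) ℤ.+ c ℤ.* q₀))
        (sym (norm-comb φ a m c m₀)))

    -- The vector q₀ m - (m ∙ m₀) m₀ is orthogonal to m₀, so its Gram determinant with m₀ is just q₀
    -- times its norm.
    gap-nonNeg : ∀ m → 0ℤ ℤ.≤ gap m
    gap-nonNeg m = *-cancelˡ-≤ (*-pos 0<norm 0<norm) (begin
      q₀ ℤ.* q₀ ℤ.* 0ℤ                       ≡⟨ ℤ.*-zeroʳ (q₀ ℤ.* q₀) ⟩
      0ℤ                                     ≤⟨ *-nonNeg (ℤ.<⇒≤ 0<norm) (normNonNeg φ p) ⟩
      q₀ ℤ.* norm φ p                        ≡⟨ solve 3 (λ q₀ t m0 → q₀ :* t := q₀ :* t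
                                                  :- (q₀ :* m0 :+ :- m0 :* q₀) :* (q₀ :* m0 :+ :- m0 :* q₀))
                                                  refl q₀ (norm φ p) (m ∙ m₀) ⟩
      q₀ ℤ.* norm φ p ℤ.- (q₀ ℤ.* (m ∙ m₀) ℤ.+ ℤ.- (m ∙ m₀) ℤ.* q₀) ℤ.* (q₀ ℤ.* (m ∙ m₀) ℤ.+ ℤ.- (m ∙ m₀) ℤ.* q₀)
                                             ≡⟨ gap-comb q₀ (ℤ.- (m ∙ m₀)) m ⟨
      q₀ ℤ.* q₀ ℤ.* gap m                    ∎)
      where p = comb q₀ m (ℤ.- (m ∙ m₀)) m₀

    gap≤ : ∀ a c m → norm φ (comb a m c m₀) ≡ 0ℤ → a ℤ.* a ℤ.* gap m ℤ.≤ 0ℤ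
    gap≤ a c m e = subst (ℤ._≤ 0ℤ)
      (sym (trans (gap-comb a c m) (trans (cong (λ z → q₀ ℤ.* z ℤ.- s ℤ.* s) e)
        (solve 2 (λ q₀ s → q₀ :* con 0ℤ :- s :* s := :- (s :* s)) refl q₀ s))))
      (ℤ.neg-mono-≤ (square-nonNeg s))
      where s = a ℤ.* (m ∙ m₀) ℤ.+ c ℤ.* q₀

    -- 2 q₀ times the form induced on the orthogonal complement of m₀; the factor clears denominators.
    projected : PSDForm
    projected = record
      { _·_        = λ m p → + 2 ℤ.* (q₀ ℤ.* (m ∙ p) ℤ.- (m ∙ m₀) ℤ.* (p ∙ m₀))
      ; symmetric  = λ m p → cong (+ 2 ℤ.*_) (cong₂ ℤ._-_
          (cong (q₀ ℤ.*_) (symmetric φ m p)) (ℤ.*-comm (m ∙ m₀) (p ∙ m₀)))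
      ; linear     = λ r a m c p → trans
          (cong₂ (λ s t → + 2 ℤ.* (q₀ ℤ.* s ℤ.- t ℤ.* (r ∙ m₀))) (linear φ r a m c p) (linear φ m₀ a m c p))
          (solve 8 (λ q₀ a c mr pr m0 p0 r0 →
            con (+ 2) :* (q₀ :* (a :* mr :+ c :* pr) :- (a :* m0 :+ c :* p0) :* r0)
            := a :* (con (+ 2) :* (q₀ :* mr :- m0 :* r0)) :+ c :* (con (+ 2) :* (q₀ :* pr :- p0 :* r0)))
            refl q₀ a c (m ∙ r) (p ∙ r) (m ∙ m₀) (p ∙ m₀) (r ∙ m₀))
      ; normNonNeg = λ m → *-nonNeg {+ 2} (ℤ.+≤+ ℕ.z≤n) (gap-nonNeg m)
      }

    gap-zero : ∀ m → norm projected m ≡ 0ℤ → gap m ≡ 0ℤ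
    gap-zero m e with ℤ.i*j≡0⇒i≡0∨j≡0 (+ 2) e
    ... | inj₂ gap≡0 = gap≡0

    -- Some functional f of the list is nonzero at m₀, as m₀ is not null. Every other ℓ is replaced
    -- by f(m₀) ℓ - ℓ(m₀) f, which vanishes at m₀. If all of these vanish at m, the original
    -- functionals vanish at f(m₀) m - f(m) m₀. That vector is then null, so m and m₀ have Gram
    -- determinant 0.
    projected-rank : ∀ {k} → RankAtMost (suc k) φ → RankAtMost k projected
    projected-rank (ℓs , radical)
      with pivot m₀ ℓs (λ all → ℤ.<-irrefl (sym (radical m₀ all)) 0<norm)
    ... | (f , f-lin) , f₀≢0 , rest , back = Vec.map eliminate rest , λ m vanish →
      let p = comb (f m₀) m (ℤ.- f m) m₀
          norm≡0 = radical p (back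
            (trans (f-lin (f m₀) m (ℤ.- f m) m₀)
              (solve 2 (λ s t → s :* t :+ :- t :* s := con 0ℤ) refl (f m₀) (f m)))
            (VecAll.map (λ {ℓ} → vanishes-on m {ℓ}) (VecAll.map⁻ vanish)))
      in cong (+ 2 ℤ.*_) (ℤ.≤-antisym
           (*-cancelˡ-≤ (f₀²>0 f₀≢0) (subst (f m₀ ℤ.* f m₀ ℤ.* gap m ℤ.≤_)
             (sym (ℤ.*-zeroʳ (f m₀ ℤ.* f m₀))) (gap≤ (f m₀) (ℤ.- f m) m norm≡0)))
           (gap-nonNeg m))
      where
      eliminate : Functional → Functional
      eliminate (ℓ , ℓ-lin) = _ , linear-combination ℓ-lin f-lin (f m₀) (ℤ.- ℓ m₀)
      vanishes-on : ∀ m {ℓ} → Vanishes m (eliminate ℓ) → Vanishes (comb (f m₀) m (ℤ.- f m) m₀) ℓ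
      vanishes-on m {ℓ , ℓ-lin} e = trans (ℓ-lin (f m₀) m (ℤ.- f m) m₀)
        (trans (solve 4 (λ f₀ fm ℓm ℓ₀ → f₀ :* ℓm :+ :- fm :* ℓ₀ := f₀ :* ℓm :+ :- ℓ₀ :* fm)
          refl (f m₀) (f m) (ℓ m) (ℓ m₀)) e)
      f₀²>0 : f m₀ ≢ 0ℤ → 0ℤ ℤ.< f m₀ ℤ.* f m₀
      f₀²>0 ≢0 = ℤ.≰⇒> (λ ≤0 → ≢0 (square-zero ≤0))

  record Separated (φ : PSDForm) (μ : ℤ) : Set where
    constructor separated
    field separation : ∀ m → norm φ m ≡ 0ℤ ⊎ μ ℤ.≤ norm φ m

  open Separated

  -- The functional to be approximated is X / E. Wherever the norm is 0 and μ is positive, the bound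
  -- in `Approximable` forces X = E Y, so this condition is necessary.
  IntegralOnRadical : PSDForm → (A → ℤ) → ℤ → Set
  IntegralOnRadical φ X E = ∀ m → norm φ m ≡ 0ℤ → ∃[ y ] X m ≡ E ℤ.* y

  Approximable : PSDForm → ℕ → ℤ → (A → ℤ) → ℤ → Set
  Approximable φ k μ X E = ∃[ Y ] Linear Y × ∀ m →
    + 4 ℤ.* μ ℤ.* ((X m ℤ.- E ℤ.* Y m) ℤ.* (X m ℤ.- E ℤ.* Y m))
      ℤ.≤ + transferenceConstant k ℤ.* (E ℤ.* E) ℤ.* norm φ m

  module Step (φ : PSDForm) (m₀ : A) (0<norm : 0ℤ ℤ.< norm φ m₀)
    (minimal : Separated φ (norm φ m₀)) where

    open PSDForm φ using () renaming (_·_ to _∙_)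
    open Projection φ m₀ 0<norm public

    -- Size reduction: a multiple j m₀ is subtracted to make the product with m₀ at most q₀ / 2 in
    -- absolute value. The gap stays the same and is expressed through the reduced vector.
    Reduction : A → Set
    Reduction m = ∃[ j ] + 4 ℤ.* (((m ∙ m₀) ℤ.- j ℤ.* q₀) ℤ.* ((m ∙ m₀) ℤ.- j ℤ.* q₀)) ℤ.≤ q₀ ℤ.* q₀
      × gap m ≡ q₀ ℤ.* norm φ (comb 1ℤ m (ℤ.- j) m₀) ℤ.- ((m ∙ m₀) ℤ.- j ℤ.* q₀) ℤ.* ((m ∙ m₀) ℤ.- j ℤ.* q₀)

    reduce : ∀ m → Reduction m
    reduce m with nearestMultiple (m ∙ m₀) q₀ 0<norm
    ... | j , small = j , small , trans (trans (sym (ℤ.*-identityˡ (gap m))) (gap-comb 1ℤ (ℤ.- j) m))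
      (solve 4 (λ q₀ t m0 j → q₀ :* t :- (con 1ℤ :* m0 :+ :- j :* q₀) :* (con 1ℤ :* m0 :+ :- j :* q₀)
        := q₀ :* t :- (m0 :- j :* q₀) :* (m0 :- j :* q₀)) refl q₀ (norm φ (comb 1ℤ m (ℤ.- j) m₀)) (m ∙ m₀) j)

    projected-separated : Separated projected (q₀ ℤ.* q₀)
    projected-separated = separated λ m → helper m (reduce m)
      where
      helper : ∀ m → Reduction m → norm projected m ≡ 0ℤ ⊎ q₀ ℤ.* q₀ ℤ.≤ norm projected m
      helper m (j , small , e) = alternatives (separation minimal (comb 1ℤ m (ℤ.- j) m₀))
        where
        s = (m ∙ m₀) ℤ.- j ℤ.* q₀
        t = norm φ (comb 1ℤ m (ℤ.- j) m₀)
        alternatives : t ≡ 0ℤ ⊎ q₀ ℤ.≤ t → norm projected m ≡ 0ℤ ⊎ q₀ ℤ.* q₀ ℤ.≤ norm projected m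
        alternatives (inj₁ t≡0) = inj₁ (cong (+ 2 ℤ.*_) (ℤ.≤-antisym
          (subst (ℤ._≤ 0ℤ) (sym e) (gap≤0-arith q₀ s t≡0)) (gap-nonNeg m)))
        alternatives (inj₂ q₀≤t) = inj₂ (subst (λ g → q₀ ℤ.* q₀ ℤ.≤ + 2 ℤ.* g) (sym e)
          (gap≥-arith {q₀} {s} {t} (ℤ.<⇒≤ 0<norm) q₀≤t small))

    -- The multiple is an integer because a fractional remainder would be shorter than m₀.
    radical-multiple : ∀ m → norm projected m ≡ 0ℤ →
      ∃[ j ] (m ∙ m₀) ≡ j ℤ.* q₀ × norm φ (comb 1ℤ m (ℤ.- j) m₀) ≡ 0ℤ
    radical-multiple m e = helper (reduce m)
      where
      helper : Reduction m → ∃[ j ] (m ∙ m₀) ≡ j ℤ.* q₀ × norm φ (comb 1ℤ m (ℤ.- j) m₀) ≡ 0ℤ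
      helper (j , small , gap≡) = alternatives (separation minimal (comb 1ℤ m (ℤ.- j) m₀))
        where
        s = (m ∙ m₀) ℤ.- j ℤ.* q₀
        t = norm φ (comb 1ℤ m (ℤ.- j) m₀)
        ≡0 : q₀ ℤ.* t ℤ.- s ℤ.* s ≡ 0ℤ
        ≡0 = trans (sym gap≡) (gap-zero m e)
        alternatives : t ≡ 0ℤ ⊎ q₀ ℤ.≤ t →
          ∃[ j ] (m ∙ m₀) ≡ j ℤ.* q₀ × norm φ (comb 1ℤ m (ℤ.- j) m₀) ≡ 0ℤ
        alternatives (inj₁ t≡0) = j , gap≡0-arith q₀ {m ∙ m₀} {j ℤ.* q₀} {t} ≡0 t≡0 , t≡0
        alternatives (inj₂ q₀≤t) = ⊥-elim (ℤ.<-irrefl refl (ℤ.<-≤-trans (*-pos 0<norm 0<norm)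
          (subst (λ g → q₀ ℤ.* q₀ ℤ.≤ + 2 ℤ.* g) ≡0
            (gap≥-arith {q₀} {s} {t} (ℤ.<⇒≤ 0<norm) q₀≤t small))))

    module Target (X : A → ℤ) (X-linear : Linear X) (E r : ℤ)
      (close : + 4 ℤ.* ((X m₀ ℤ.- r ℤ.* E) ℤ.* (X m₀ ℤ.- r ℤ.* E)) ℤ.≤ E ℤ.* E) where

      -- As a functional, X′ / (E q₀) is X / E corrected by a multiple of the product with m₀,
      -- chosen such that its value at m₀ is exactly the integer r.
      X′ : A → ℤ
      X′ m = q₀ ℤ.* X m ℤ.+ ℤ.- (X m₀ ℤ.- r ℤ.* E) ℤ.* (m ∙ m₀)

      X′-linear : Linear X′
      X′-linear = linear-combination X-linear (linear φ m₀) q₀ (ℤ.- (X m₀ ℤ.- r ℤ.* E))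

      -- A null vector of the projected form is a null vector of φ plus j m₀ with j an integer. On
      -- the first part X is E y by hypothesis, and the second contributes j r.
      X′-integral : IntegralOnRadical φ X E → IntegralOnRadical projected X′ (E ℤ.* q₀)
      X′-integral integral m e = multiple (radical-multiple m e)
        where
        witness : ∀ j → (m ∙ m₀) ≡ j ℤ.* q₀ → ∃[ y ] X (comb 1ℤ m (ℤ.- j) m₀) ≡ E ℤ.* y →
          ∃[ y ] X′ m ≡ E ℤ.* q₀ ℤ.* y
        witness j m∙m₀≡ (y , Xp≡) = y ℤ.+ j ℤ.* r ,
          integral-arith q₀ E j r {X m} {X m₀} {m ∙ m₀} {y} m∙m₀≡ (trans (sym (X-linear 1ℤ m (ℤ.- j) m₀)) Xp≡)
        multiple : ∃[ j ] (m ∙ m₀) ≡ j ℤ.* q₀ × norm φ (comb 1ℤ m (ℤ.- j) m₀) ≡ 0ℤ →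
          ∃[ y ] X′ m ≡ E ℤ.* q₀ ℤ.* y
        multiple (j , m∙m₀≡ , norm≡0) = witness j m∙m₀≡ (integral (comb 1ℤ m (ℤ.- j) m₀) norm≡0)

      lift : ∀ {k μ} → μ ℤ.≤ q₀ → Approximable projected k (q₀ ℤ.* q₀) X′ (E ℤ.* q₀) →
        Approximable φ (suc k) μ X E
      lift {k} {μ} μ≤q₀ (Y , Y-linear , bound) = Y , Y-linear , λ m →
        subst (λ z → + 4 ℤ.* μ ℤ.* ((X m ℤ.- E ℤ.* Y m) ℤ.* (X m ℤ.- E ℤ.* Y m))
            ℤ.≤ z ℤ.* (E ℤ.* E) ℤ.* norm φ m)
          (cong (λ z → 1ℤ ℤ.+ z) (sym (ℤ.pos-* 2 (transferenceConstant k))))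
          (lift-arith {+ transferenceConstant k} {E} {q₀} {norm φ m} {m ∙ m₀} {X m} {Y m} {X m₀ ℤ.- r ℤ.* E}
            (ℤ.+≤+ ℕ.z≤n) 0<norm μ≤q₀ (gap-nonNeg m) close (bound m))

  approximate-zero : ∀ φ k μ {X} → Linear X → ∀ E → 0ℤ ℤ.< E → IntegralOnRadical φ X E →
    (∀ m → norm φ m ≡ 0ℤ) → Approximable φ k μ X E
  approximate-zero φ k μ {X} X-linear E 0<E integral zero-form = Y , Y-linear , λ m →
    ℤ.≤-reflexive (trans
      (cong (λ z → + 4 ℤ.* μ ℤ.* (z ℤ.* z)) (ℤ.i≡j⇒i-j≡0 (proj₂ (integral m (zero-form m)))))
      (trans (ℤ.*-zeroʳ (+ 4 ℤ.* μ)) (sym (trans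
        (cong (+ transferenceConstant k ℤ.* (E ℤ.* E) ℤ.*_) (zero-form m))
        (ℤ.*-zeroʳ (+ transferenceConstant k ℤ.* (E ℤ.* E)))))))
    where
    Y : A → ℤ
    Y m = proj₁ (integral m (zero-form m))
    X≡EY : ∀ m → X m ≡ E ℤ.* Y m
    X≡EY m = proj₂ (integral m (zero-form m))
    Y-linear : Linear Y
    Y-linear a m c p = ℤ.*-cancelˡ-≡ E _ _ {{ℤ.>-nonZero 0<E}} (trans (sym (X≡EY (comb a m c p)))
      (trans (X-linear a m c p) (trans (cong₂ (λ s t → a ℤ.* s ℤ.+ c ℤ.* t) (X≡EY m) (X≡EY p))
        (solve 5 (λ E a c s t → a :* (E :* s) :+ c :* (E :* t) := E :* (a :* s :+ c :* t))
          refl E a c (Y m) (Y p)))))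

  -- The double negation is due to the choice of a shortest vector.
  transference : ∀ k φ → RankAtMost k φ → ∀ μ → Separated φ μ →
    ∀ X → Linear X → ∀ E → 0ℤ ℤ.< E → IntegralOnRadical φ X E → ¬ ¬ Approximable φ k μ X E
  transference k φ rank μ sep X X-linear E 0<E integral none =
    none (approximate-zero φ k μ X-linear E 0<E integral λ m → zero-form m (norm φ m) refl)
    where
    stepDown : ∀ k → RankAtMost k φ → ¬ Approximable φ k μ X E → ∀ m₀ → 0ℤ ℤ.< norm φ m₀ →
      Separated φ (norm φ m₀) → ⊥
    -- An empty list of functionals makes every vector null, m₀ included.
    stepDown zero    (_ , radical) none m₀ 0<norm minimal = ℤ.<-irrefl (sym (radical m₀ (emptyAll _))) 0<norm
      where
      emptyAll : ∀ {P : Functional → Set} (ℓs : Vec Functional 0) → VecAll.All P ℓs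
      emptyAll [] = []
    stepDown (suc k) rank none m₀ 0<norm minimal with separation sep m₀
    ... | inj₁ e    = ℤ.<-irrefl (sym e) 0<norm
    ... | inj₂ μ≤q₀ = transference k projected (projected-rank rank) (q₀ ℤ.* q₀) projected-separated
      X′ X′-linear (E ℤ.* q₀) (*-pos 0<E 0<norm) (X′-integral integral)
      (λ approx → none (lift {k} μ≤q₀ approx))
      where
      open Step φ m₀ 0<norm minimal
      open Target X X-linear E (proj₁ (nearestMultiple (X m₀) E 0<E)) (proj₂ (nearestMultiple (X m₀) E 0<E))

    no-positive : ∀ j m → norm φ m ≡ + j → ¬ 0 ℕ.< j
    -- Strong induction on the value of the norm: if no vector has a smaller positive norm, then m
    -- is itself a shortest vector and `stepDown` applies. Hence the form is zero, which is the case
    -- settled directly.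
    no-positive = <-rec _ λ j smaller m e 0<j → stepDown k rank none m
      (subst (0ℤ ℤ.<_) (sym e) (ℤ.+<+ 0<j)) (separated λ p → minimal j smaller e p (norm φ p) refl)
      where
      minimal : ∀ j {m} → (∀ {i} → i ℕ.< j → ∀ p → norm φ p ≡ + i → ¬ 0 ℕ.< i) → norm φ m ≡ + j →
        ∀ p z → norm φ p ≡ z → norm φ p ≡ 0ℤ ⊎ norm φ m ℤ.≤ norm φ p
      minimal j smaller e p (+ zero)  ep = inj₁ ep
      minimal j smaller e p (+ suc i) ep with suc i ℕ.<? j
      ... | yes i<j = ⊥-elim (smaller i<j p ep (ℕ.s≤s ℕ.z≤n))
      ... | no  i≮j = inj₂ (subst₂ ℤ._≤_ (sym e) (sym ep) (ℤ.+≤+ (ℕ.≮⇒≥ i≮j)))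
      minimal j smaller e p -[1+ i ] ep with subst (0ℤ ℤ.≤_) ep (normNonNeg φ p)
      ... | ()

    zero-form : ∀ m z → norm φ m ≡ z → norm φ m ≡ 0ℤ
    zero-form m (+ zero)  e = e
    zero-form m (+ suc j) e = ⊥-elim (no-positive (suc j) m e (ℕ.s≤s ℕ.z≤n))
    zero-form m -[1+ j ]  e with subst (0ℤ ℤ.≤_) e (normNonNeg φ m)
    ... | ()

-- The penalised form on ℤⁿ and the point (½, ..., ½).

dot : ∀ {n} → Vec ℤ n → Vec ℤ n → ℤ
dot []       []       = 0ℤ
dot (x ∷ xs) (y ∷ ys) = x ℤ.* y ℤ.+ dot xs ys

RelationFree : ∀ {n} → ℕ → Vec ℤ n → Set
RelationFree M v = ∀ c → VecAll.All (λ x → ℤ.∣ x ∣ ℕ.≤ M) c → dot c v ≡ 0ℤ → VecAll.All (_≡ 0ℤ) c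

module IntegerVectors where

  open ℤ-Order
  open ℤ-Solver
  open ℤ.≤-Reasoning

  comb : ∀ {n} → ℤ → Vec ℤ n → ℤ → Vec ℤ n → Vec ℤ n
  comb a m c p = Vec.zipWith (λ x y → a ℤ.* x ℤ.+ c ℤ.* y) m p

  open module T {n} = Transference (comb {n}) using (Linear; PSDForm; RankAtMost; Separated; separated; IntegralOnRadical; transference)

  dot-comm : ∀ {n} (m p : Vec ℤ n) → dot m p ≡ dot p m
  dot-comm []       []       = refl
  dot-comm (x ∷ xs) (y ∷ ys) = cong₂ ℤ._+_ (ℤ.*-comm x y) (dot-comm xs ys)

  dot-linear : ∀ {n} (r : Vec ℤ n) → Linear (λ m → dot m r)
  dot-linear []       a []       c []       = sym (cong₂ ℤ._+_ (ℤ.*-zeroʳ a) (ℤ.*-zeroʳ c))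
  dot-linear (z ∷ zs) a (x ∷ xs) c (y ∷ ys) = trans
    (cong (λ t → (a ℤ.* x ℤ.+ c ℤ.* y) ℤ.* z ℤ.+ t) (dot-linear zs a xs c ys))
    (solve 7 (λ a c x y z s t → (a :* x :+ c :* y) :* z :+ (a :* s :+ c :* t)
      := a :* (x :* z :+ s) :+ c :* (y :* z :+ t)) refl a c x y z (dot xs zs) (dot ys zs))

  dot-nonNeg : ∀ {n} (m : Vec ℤ n) → 0ℤ ℤ.≤ dot m m
  dot-nonNeg []       = ℤ.≤-refl
  dot-nonNeg (x ∷ xs) = +-nonNeg (square-nonNeg x) (dot-nonNeg xs)

  dot-zeroˡ : ∀ {n} {m : Vec ℤ n} → VecAll.All (_≡ 0ℤ) m → ∀ p → dot m p ≡ 0ℤ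
  dot-zeroˡ []           []       = refl
  dot-zeroˡ (refl ∷ all) (y ∷ ys) = trans (ℤ.+-identityˡ _) (dot-zeroˡ all ys)

  dot-definite : ∀ {n} (m : Vec ℤ n) → dot m m ℤ.≤ 0ℤ → VecAll.All (_≡ 0ℤ) m
  dot-definite []       _ = []
  dot-definite (x ∷ xs) h =
    square-zero (ℤ.≤-trans (≤-by (dot-nonNeg xs) refl) h) ∷
    dot-definite xs (ℤ.≤-trans (≤-by (square-nonNeg x) (ℤ.+-comm (dot xs xs) (x ℤ.* x))) h)

  unit : ∀ {n} → Fin n → Vec ℤ n
  unit zero    = 1ℤ ∷ Vec.replicate _ 0ℤ
  unit (suc i) = 0ℤ ∷ unit i

  dot-unit : ∀ {n} (i : Fin n) p → dot (unit i) p ≡ Vec.lookup p i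
  dot-unit zero (y ∷ ys) = trans (cong₂ ℤ._+_ (ℤ.*-identityˡ y) (dot-replicate ys)) (ℤ.+-identityʳ y)
    where
    dot-replicate : ∀ {n} (p : Vec ℤ n) → dot (Vec.replicate n 0ℤ) p ≡ 0ℤ
    dot-replicate []       = refl
    dot-replicate (y ∷ ys) = trans (ℤ.+-identityˡ _) (dot-replicate ys)
  dot-unit (suc i) (y ∷ ys) = trans (ℤ.+-identityˡ _) (dot-unit i ys)

  lookup-unit : ∀ {n} (i : Fin n) → Vec.lookup (unit i) i ≡ 1ℤ
  lookup-unit zero    = refl
  lookup-unit (suc i) = lookup-unit i

  square-∣∣ : ∀ x → x ℤ.* x ≡ + (ℤ.∣ x ∣ ℕ.* ℤ.∣ x ∣)
  square-∣∣ (+ n)    = sym (ℤ.pos-* n n)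
  square-∣∣ -[1+ n ] = refl

  dot-large : ∀ {n} M (m : Vec ℤ n) → ¬ VecAll.All (λ x → ℤ.∣ x ∣ ℕ.≤ M) m →
    + (suc M ℕ.* suc M) ℤ.≤ dot m m
  dot-large M []       ¬all = ⊥-elim (¬all [])
  dot-large M (x ∷ xs) ¬all with ℤ.∣ x ∣ ℕ.≤? M
  ... | yes ≤M = ℤ.≤-trans (dot-large M xs (λ all → ¬all (≤M ∷ all)))
    (≤-by (square-nonNeg x) (ℤ.+-comm (dot xs xs) (x ℤ.* x)))
  ... | no  ≰M = ℤ.≤-trans (subst (+ (suc M ℕ.* suc M) ℤ.≤_) (sym (square-∣∣ x))
      (ℤ.+≤+ (ℕ.*-mono-≤ (ℕ.≰⇒> ≰M) (ℕ.≰⇒> ≰M))))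
    (≤-by (dot-nonNeg xs) refl)

  module Relation {n} (M : ℕ) (v : Vec ℤ n) where

    μ : ℕ
    μ = suc M ℕ.* suc M

    penalty : Vec ℤ n → Vec ℤ n → ℤ
    penalty m p = + μ ℤ.* (dot m v ℤ.* dot p v)

    penalty-nonNeg : ∀ m → 0ℤ ℤ.≤ penalty m m
    penalty-nonNeg m = *-nonNeg {+ μ} (ℤ.+≤+ ℕ.z≤n) (square-nonNeg (dot m v))

    -- The penalty makes every vector that is not a relation long.
    form : PSDForm
    form = record
      { _·_        = λ m p → dot m p ℤ.+ penalty m p
      ; symmetric  = λ m p → cong₂ (λ s t → s ℤ.+ + μ ℤ.* t) (dot-comm m p) (ℤ.*-comm (dot m v) (dot p v))
      ; linear     = λ r a m c p → trans
          (cong₂ (λ s t → s ℤ.+ + μ ℤ.* (t ℤ.* dot r v)) (dot-linear r a m c p) (dot-linear v a m c p))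
          (solve 8 (λ a c mr pr mv pv rv μ → (a :* mr :+ c :* pr) :+ μ :* ((a :* mv :+ c :* pv) :* rv)
            := a :* (mr :+ μ :* (mv :* rv)) :+ c :* (pr :+ μ :* (pv :* rv)))
            refl a c (dot m r) (dot p r) (dot m v) (dot p v) (dot r v) (+ μ))
      ; normNonNeg = λ m → +-nonNeg (dot-nonNeg m) (penalty-nonNeg m)
      }

    norm : Vec ℤ n → ℤ
    norm m = dot m m ℤ.+ penalty m m

    norm-zero : ∀ {m} → VecAll.All (_≡ 0ℤ) m → norm m ≡ 0ℤ
    norm-zero {m} all = trans (cong₂ (λ s t → s ℤ.+ + μ ℤ.* (t ℤ.* t)) (dot-zeroˡ all m) (dot-zeroˡ all v))
      (trans (ℤ.+-identityˡ _) (ℤ.*-zeroʳ (+ μ)))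

    norm-definite : ∀ m → norm m ≡ 0ℤ → VecAll.All (_≡ 0ℤ) m
    norm-definite m e = dot-definite m (ℤ.≤-trans (≤-by (penalty-nonNeg m) refl) (ℤ.≤-reflexive e))

    form-rank : RankAtMost n form
    form-rank = Vec.tabulate (λ i → (λ m → dot m (unit i)) , dot-linear (unit i)) , λ m vanish →
      norm-zero {m} (VecAll.lookup⁻ {xs = m} λ i →
        trans (sym (dot-unit i m)) (trans (dot-comm (unit i) m) (VecAll.tabulate⁻ vanish i)))

    -- A vector that is not a relation pays a penalty of at least μ, and a relation with a
    -- coordinate beyond M is long by itself. What remains are the short relations, and these are 0.
    form-separated : RelationFree M v → Separated form (+ μ)
    form-separated free = separated sep
      where
      sep : ∀ m → norm m ≡ 0ℤ ⊎ + μ ℤ.≤ norm m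
      sep m with dot m v ℤ.≟ 0ℤ | VecAll.all? (λ x → ℤ.∣ x ∣ ℕ.≤? M) m
      ... | yes e  | yes small  = inj₁ (norm-zero (free m small e))
      ... | yes _  | no  ¬small = inj₂ (ℤ.≤-trans (dot-large M m ¬small) (≤-by (penalty-nonNeg m) refl))
      ... | no  ≢0 | _          = inj₂ (begin
        + μ                ≡⟨ ℤ.*-identityʳ (+ μ) ⟨
        + μ ℤ.* 1ℤ         ≤⟨ ℤ.*-monoˡ-≤-nonNeg (+ μ) (1≤square ≢0) ⟩
        penalty m m        ≤⟨ ≤-by (dot-nonNeg m) (ℤ.+-comm (penalty m m) (dot m m)) ⟩
        norm m             ∎)
        where
        1≤square : ∀ {x} → x ≢ 0ℤ → 1ℤ ℤ.≤ x ℤ.* x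
        1≤square {x} ≢0 = ℤ.i<j⇒suc[i]≤j (ℤ.≰⇒> (λ ≤0 → ≢0 (square-zero ≤0)))

    private
      V = dot v v

    -- Testing against V eᵢ - vᵢ v, which is orthogonal to v, removes the penalty.
    probe : Fin n → Vec ℤ n
    probe i = comb V (unit i) (ℤ.- Vec.lookup v i) v

    -- As the probe is orthogonal to v, its norm is its squared length V² - V vᵢ².
    norm-probe : ∀ i → norm (probe i) ℤ.≤ V ℤ.* V
    norm-probe i = ≤-by (*-nonNeg (dot-nonNeg v) (square-nonNeg vᵢ)) (begin-equality
      norm (probe i) ℤ.+ V ℤ.* (vᵢ ℤ.* vᵢ)
        ≡⟨ cong₂ (λ s t → s ℤ.+ + μ ℤ.* (t ℤ.* t) ℤ.+ V ℤ.* (vᵢ ℤ.* vᵢ)) probe-probe probe-v ⟩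
      V ℤ.* (V ℤ.* 1ℤ ℤ.+ ℤ.- vᵢ ℤ.* vᵢ) ℤ.+ ℤ.- vᵢ ℤ.* 0ℤ ℤ.+ + μ ℤ.* (0ℤ ℤ.* 0ℤ) ℤ.+ V ℤ.* (vᵢ ℤ.* vᵢ)
        ≡⟨ solve 3 (λ V x μ → V :* (V :* con 1ℤ :+ :- x :* x) :+ :- x :* con 0ℤ :+ μ :* (con 0ℤ :* con 0ℤ)
             :+ V :* (x :* x) := V :* V) refl V vᵢ (+ μ) ⟩
      V ℤ.* V ∎)
      where
      vᵢ = Vec.lookup v i
      probe-dot : ∀ p → dot (probe i) p ≡ V ℤ.* dot (unit i) p ℤ.+ ℤ.- vᵢ ℤ.* dot v p
      probe-dot p = dot-linear p V (unit i) (ℤ.- vᵢ) v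
      probe-v : dot (probe i) v ≡ 0ℤ
      probe-v = trans (probe-dot v) (trans (cong (λ z → V ℤ.* z ℤ.+ ℤ.- vᵢ ℤ.* V) (dot-unit i v))
        (solve 2 (λ V x → V :* x :+ :- x :* V := con 0ℤ) refl V vᵢ))
      probe-unit : dot (probe i) (unit i) ≡ V ℤ.* 1ℤ ℤ.+ ℤ.- vᵢ ℤ.* vᵢ
      probe-unit = trans (probe-dot (unit i)) (cong₂ (λ s t → V ℤ.* s ℤ.+ ℤ.- vᵢ ℤ.* t)
        (trans (dot-unit i (unit i)) (lookup-unit i)) (trans (dot-comm v (unit i)) (dot-unit i v)))
      probe-probe : dot (probe i) (probe i) ≡ V ℤ.* (V ℤ.* 1ℤ ℤ.+ ℤ.- vᵢ ℤ.* vᵢ) ℤ.+ ℤ.- vᵢ ℤ.* 0ℤ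
      probe-probe = trans (probe-dot (probe i)) (cong₂ (λ s t → V ℤ.* s ℤ.+ ℤ.- vᵢ ℤ.* t)
        (trans (dot-comm (unit i) (probe i)) probe-unit) (trans (dot-comm v (probe i)) probe-v))

  -- With V = dot v v, the i-th coordinate of (½, …, ½) - (g / 2V) v differs from an integer by w / 2V.
  nearHalves : ∀ {n} M (v : Vec ℤ n) → RelationFree M v → ¬ ¬ (∃[ g ] ∀ i → ∃[ y ]
    let w = dot v v ℤ.* (1ℤ ℤ.- + 2 ℤ.* y) ℤ.- Vec.lookup v i ℤ.* g in
    + (suc M ℕ.* suc M) ℤ.* (w ℤ.* w) ℤ.≤ + transferenceConstant n ℤ.* (dot v v ℤ.* dot v v))
  nearHalves {n} M v free none = transference n form form-rank (+ μ) (form-separated free)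
    X (dot-linear ones) (+ 2) (ℤ.+<+ (ℕ.s≤s ℕ.z≤n)) integral λ (Y , Y-linear , close) →
      -- X / 2 is the functional (½, ..., ½), and g / 2 is the product of (½, ..., ½) - Y with v.
      -- Thus g / 2V is the coefficient of the orthogonal projection of that difference onto the
      -- line through v.
      none (X v ℤ.- + 2 ℤ.* Y v , λ i → Y (unit i) , bound Y Y-linear close i)
    where
    open Relation M v
    ones = Vec.replicate n 1ℤ
    V = dot v v
    X : Vec ℤ n → ℤ
    X m = dot m ones
    integral : IntegralOnRadical form X (+ 2)
    -- The form is definite, so its radical consists of 0 alone.
    integral m e = 0ℤ , dot-zeroˡ (norm-definite m e) ones
    bound : ∀ Y → Linear Y → (∀ m → + 4 ℤ.* + μ ℤ.* ((X m ℤ.- + 2 ℤ.* Y m) ℤ.* (X m ℤ.- + 2 ℤ.* Y m))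
        ℤ.≤ + transferenceConstant n ℤ.* (+ 2 ℤ.* + 2) ℤ.* norm m) → ∀ i →
      let w = V ℤ.* (1ℤ ℤ.- + 2 ℤ.* Y (unit i)) ℤ.- Vec.lookup v i ℤ.* (X v ℤ.- + 2 ℤ.* Y v) in
      + μ ℤ.* (w ℤ.* w) ℤ.≤ + transferenceConstant n ℤ.* (V ℤ.* V)
    bound Y Y-linear close i = *-cancelˡ-≤ {k = + 4} (ℤ.+<+ (ℕ.s≤s ℕ.z≤n)) (begin
      + 4 ℤ.* (+ μ ℤ.* (w ℤ.* w))              ≡⟨ ℤ.*-assoc (+ 4) (+ μ) (w ℤ.* w) ⟨
      + 4 ℤ.* + μ ℤ.* (w ℤ.* w)                ≡⟨ cong (λ z → + 4 ℤ.* + μ ℤ.* (z ℤ.* z)) F≡w ⟨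
      + 4 ℤ.* + μ ℤ.* (F ℤ.* F)                ≤⟨ close (probe i) ⟩
      a ℤ.* (+ 2 ℤ.* + 2) ℤ.* norm (probe i)   ≤⟨ ℤ.*-monoˡ-≤-nonNeg (a ℤ.* (+ 2 ℤ.* + 2))
                                                    {{ℤ.nonNegative (*-nonNeg {a} {+ 4} (ℤ.+≤+ ℕ.z≤n) (ℤ.+≤+ ℕ.z≤n))}} (norm-probe i) ⟩
      a ℤ.* (+ 2 ℤ.* + 2) ℤ.* (V ℤ.* V)
        ≡⟨ solve 2 (λ a s → a :* (con (+ 2) :* con (+ 2)) :* s := con (+ 4) :* (a :* s)) refl a (V ℤ.* V) ⟩
      + 4 ℤ.* (a ℤ.* (V ℤ.* V))                ∎)
      where
      a = + transferenceConstant n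
      vᵢ = Vec.lookup v i
      w = V ℤ.* (1ℤ ℤ.- + 2 ℤ.* Y (unit i)) ℤ.- vᵢ ℤ.* (X v ℤ.- + 2 ℤ.* Y v)
      F = X (probe i) ℤ.- + 2 ℤ.* Y (probe i)
      F≡w : F ≡ w
      F≡w = trans (cong₂ (λ s t → s ℤ.- + 2 ℤ.* t)
          (trans (dot-linear ones V (unit i) (ℤ.- vᵢ) v)
            (cong (λ z → V ℤ.* z ℤ.+ ℤ.- vᵢ ℤ.* X v) (trans (dot-unit i ones) (Vec.lookup-replicate i 1ℤ))))
          (Y-linear V (unit i) (ℤ.- vᵢ) v))
        (solve 5 (λ V x s y t → V :* con 1ℤ :+ :- x :* s :- con (+ 2) :* (V :* y :+ :- x :* t)
          := V :* (con 1ℤ :- con (+ 2) :* y) :- x :* (s :- con (+ 2) :* t))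
          refl V vᵢ (X v) (Y (unit i)) (Y v))

open Rational using (
  /-≤; /-<; /-+; /-suc; /-nonNeg; /1-mono-≤; recip; inv; *-inv; *-nonNeg; *-pos; *-mono; +-nonNeg;
  ≤-+ʳ; p≤∣p∣; ∣-∣-swap; distℤ; distℤ-attained; distℤ-≤; largest; largest-holds; largest-fails;
  rootApprox; rootNumerator; rootApprox-≤; rootApprox-nonNeg; <-rootApprox; ^-nonNeg; ^-pos;
  ^-mono-≤; ^-cancel-<; archimedean)

-- From near halves to a lonely rational time.

module ℚ-Lemmas where

  open ℚ-Solver
  open ℚ.≤-Reasoning

  ι : ℤ → ℚ
  ι i = i ℚ./ 1

  ι-+ : ∀ i j → ι (i ℤ.+ j) ≡ ι i ℚ.+ ι j
  ι-+ i j = /-+ i j 1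

  ι-* : ∀ i j → ι (i ℤ.* j) ≡ ι i ℚ.* ι j
  ι-* i j = ℚ.toℚᵘ-injective
    (ℚᵘ.≃-trans (ℚ.toℚᵘ-fromℚᵘ (ℚᵘ.mkℚᵘ (i ℤ.* j) 0))
    (ℚᵘ.≃-trans
      (ℚᵘ.≃-sym (ℚᵘ.*-cong (ℚ.toℚᵘ-fromℚᵘ (ℚᵘ.mkℚᵘ i 0)) (ℚ.toℚᵘ-fromℚᵘ (ℚᵘ.mkℚᵘ j 0))))
      (ℚᵘ.≃-sym (ℚ.toℚᵘ-homo-* (ι i) (ι j)))))

  ι-neg : ∀ i → ι (ℤ.- i) ≡ ℚ.- ι i
  ι-neg i = ℚ.toℚᵘ-injective
    (ℚᵘ.≃-trans (ℚ.toℚᵘ-fromℚᵘ (ℚᵘ.mkℚᵘ (ℤ.- i) 0))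
    (ℚᵘ.≃-trans (ℚᵘ.≃-sym (ℚᵘ.-‿cong (ℚ.toℚᵘ-fromℚᵘ (ℚᵘ.mkℚᵘ i 0))))
      (ℚᵘ.≃-sym (ℚ.toℚᵘ-homo‿- (ι i)))))

  ι-- : ∀ i j → ι (i ℤ.- j) ≡ ι i ℚ.- ι j
  ι-- i j = trans (ι-+ i (ℤ.- j)) (cong (λ z → ι i ℚ.+ z) (ι-neg j))

  ι-pos : ∀ {i} → 0ℤ ℤ.< i → 0ℚ ℚ.< ι i
  ι-pos {i} 0<i = /-< 0ℤ i 1 1 (subst₂ ℤ._<_ (sym (ℤ.*-identityʳ 0ℤ)) (sym (ℤ.*-identityʳ i)) 0<i)

  ι-nonNeg : ∀ n → 0ℚ ℚ.≤ ι (+ n)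
  ι-nonNeg n = /1-mono-≤ {0ℤ} {+ n} (ℤ.+≤+ ℕ.z≤n)

  *-cancelˡ-≤ : ∀ {p q r} → 0ℚ ℚ.< r → r ℚ.* p ℚ.≤ r ℚ.* q → p ℚ.≤ q
  *-cancelˡ-≤ {r = r} 0<r = ℚ.*-cancelˡ-≤-pos r {{ℚ.positive 0<r}}

  square-nonNeg : ∀ p → 0ℚ ℚ.≤ p ℚ.* p
  square-nonNeg p with ℚ.≤-total 0ℚ p
  ... | inj₁ 0≤p = *-nonNeg 0≤p 0≤p
  ... | inj₂ p≤0 = subst (0ℚ ℚ.≤_) (solve 1 (λ p → :- p :* :- p := p :* p) refl p)
    (*-nonNeg (ℚ.neg-antimono-≤ p≤0) (ℚ.neg-antimono-≤ p≤0))

  square-cancel-≤ : ∀ {p q} → 0ℚ ℚ.≤ q → p ℚ.* p ℚ.≤ q ℚ.* q → p ℚ.≤ q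
  square-cancel-≤ {p} {q} 0≤q p²≤q² with p ℚ.≤? q
  ... | yes p≤q = p≤q
  ... | no  p≰q = ⊥-elim (ℚ.<-irrefl refl (ℚ.≤-<-trans p²≤q² (ℚ.≤-<-trans
      (ℚ.*-monoˡ-≤-nonNeg q {{ℚ.nonNegative 0≤q}} (ℚ.<⇒≤ q<p))
      (ℚ.*-monoˡ-<-pos p {{ℚ.positive (ℚ.≤-<-trans 0≤q q<p)}} q<p))))
    where q<p = ℚ.≰⇒> p≰q

  distℤ-nonNeg : ∀ q → 0ℚ ℚ.≤ distℤ q
  distℤ-nonNeg q with distℤ-attained q
  ... | k , e = subst (0ℚ ℚ.≤_) (sym e) (ℚ.0≤∣p∣ (q ℚ.- ι k))

  distℤ-≥ : ∀ {q l} a → ι a ℚ.+ l ℚ.≤ q → q ℚ.≤ ι a ℚ.+ 1ℚ ℚ.- l → l ℚ.≤ distℤ q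
  distℤ-≥ {q} {l} a lower upper with distℤ-attained q
  ... | k , e with k ℤ.≤? a
  ...   | yes k≤a = subst (l ℚ.≤_) (sym e) (begin
    l                      ≡⟨ solve 2 (λ a l → l := a :+ l :- a) refl (ι a) l ⟩
    ι a ℚ.+ l ℚ.- ι a      ≤⟨ ℚ.+-mono-≤ lower (ℚ.neg-antimono-≤ (/1-mono-≤ {k} {a} k≤a)) ⟩
    q ℚ.- ι k              ≤⟨ p≤∣p∣ (q ℚ.- ι k) ⟩
    ℚ.∣ q ℚ.- ι k ∣        ∎)
  ...   | no  k≰a = subst (l ℚ.≤_) (sym e) (begin
    l                                  ≡⟨ solve 2 (λ a l → l := a :- (a :- l)) refl (ι a ℚ.+ 1ℚ) l ⟩
    ι a ℚ.+ 1ℚ ℚ.- (ι a ℚ.+ 1ℚ ℚ.- l)  ≤⟨ ℚ.+-mono-≤ a+1≤k (ℚ.neg-antimono-≤ upper) ⟩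
    ι k ℚ.- q                          ≤⟨ p≤∣p∣ (ι k ℚ.- q) ⟩
    ℚ.∣ ι k ℚ.- q ∣                    ≡⟨ ∣-∣-swap (ι k) q ⟩
    ℚ.∣ q ℚ.- ι k ∣                    ∎)
    where
    a+1≤k : ι a ℚ.+ 1ℚ ℚ.≤ ι k
    a+1≤k = subst (ℚ._≤ ι k) (trans (ι-+ 1ℤ a) (ℚ.+-comm 1ℚ (ι a)))
      (/1-mono-≤ {ℤ.suc a} {k} (ℤ.i<j⇒suc[i]≤j (ℤ.≰⇒> k≰a)))

  distℤ-shift : ∀ q k → distℤ q ℚ.≤ distℤ (q ℚ.+ ι k)
  distℤ-shift q k with distℤ-attained (q ℚ.+ ι k)
  ... | j , e = subst (distℤ q ℚ.≤_) (sym (trans e (cong ℚ.∣_∣ (trans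
      (solve 3 (λ q k j → q :+ k :- j := q :- (j :- k)) refl q (ι k) (ι j))
      (cong (λ z → q ℚ.- z) (sym (ι-- j k)))))))
    (distℤ-≤ q (j ℤ.- k))

  -- With r = 1 / 2V and t = g r, the product t x equals -y + ½ - w / 2V, where w = V (1 - 2y) - x
  -- g. A bound on w thus keeps t x above -y + ½ - ε; a bound on -w gives the other side in
  -- `half-upper`.
  half-lower : ∀ {V r g x y ε} → 0ℚ ℚ.< V → (V ℚ.+ V) ℚ.* r ≡ 1ℚ →
    V ℚ.* (1ℚ ℚ.- (y ℚ.+ y)) ℚ.- x ℚ.* g ℚ.≤ (V ℚ.+ V) ℚ.* ε → ℚ.- y ℚ.+ (½ ℚ.- ε) ℚ.≤ g ℚ.* r ℚ.* x
  half-lower {V} {r} {g} {x} {y} {ε} 0<V Vr h = *-cancelˡ-≤ (ℚ.+-mono-< 0<V 0<V) (begin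
    (V ℚ.+ V) ℚ.* (ℚ.- y ℚ.+ (½ ℚ.- ε))
      ≡⟨ solve 5 (λ V y ε x g → (V :+ V) :* (:- y :+ (con ½ :- ε))
           := V :* (con 1ℚ :- (y :+ y)) :- x :* g :+ (x :* g :- (V :+ V) :* ε)) refl V y ε x g ⟩
    V ℚ.* (1ℚ ℚ.- (y ℚ.+ y)) ℚ.- x ℚ.* g ℚ.+ (x ℚ.* g ℚ.- (V ℚ.+ V) ℚ.* ε)
      ≤⟨ ℚ.+-monoˡ-≤ (x ℚ.* g ℚ.- (V ℚ.+ V) ℚ.* ε) h ⟩
    (V ℚ.+ V) ℚ.* ε ℚ.+ (x ℚ.* g ℚ.- (V ℚ.+ V) ℚ.* ε)
      ≡⟨ solve 3 (λ e x g → e :+ (x :* g :- e) := con 1ℚ :* (g :* x)) refl ((V ℚ.+ V) ℚ.* ε) x g ⟩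
    1ℚ ℚ.* (g ℚ.* x)
      ≡⟨ cong (ℚ._* (g ℚ.* x)) Vr ⟨
    (V ℚ.+ V) ℚ.* r ℚ.* (g ℚ.* x)
      ≡⟨ solve 4 (λ V r g x → (V :+ V) :* r :* (g :* x) := (V :+ V) :* (g :* r :* x)) refl V r g x ⟩
    (V ℚ.+ V) ℚ.* (g ℚ.* r ℚ.* x) ∎)

  half-upper : ∀ {V r g x y ε} → 0ℚ ℚ.< V → (V ℚ.+ V) ℚ.* r ≡ 1ℚ →
    ℚ.- (V ℚ.* (1ℚ ℚ.- (y ℚ.+ y)) ℚ.- x ℚ.* g) ℚ.≤ (V ℚ.+ V) ℚ.* ε →
    g ℚ.* r ℚ.* x ℚ.≤ ℚ.- y ℚ.+ 1ℚ ℚ.- (½ ℚ.- ε)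
  half-upper {V} {r} {g} {x} {y} {ε} 0<V Vr h = *-cancelˡ-≤ (ℚ.+-mono-< 0<V 0<V) (begin
    (V ℚ.+ V) ℚ.* (g ℚ.* r ℚ.* x)
      ≡⟨ solve 4 (λ V r g x → (V :+ V) :* (g :* r :* x) := (V :+ V) :* r :* (g :* x)) refl V r g x ⟩
    (V ℚ.+ V) ℚ.* r ℚ.* (g ℚ.* x)
      ≡⟨ cong (ℚ._* (g ℚ.* x)) Vr ⟩
    1ℚ ℚ.* (g ℚ.* x)
      ≡⟨ solve 4 (λ V y x g → con 1ℚ :* (g :* x)
           := :- (V :* (con 1ℚ :- (y :+ y)) :- x :* g) :+ V :* (con 1ℚ :- (y :+ y))) refl V y x g ⟩
    ℚ.- (V ℚ.* (1ℚ ℚ.- (y ℚ.+ y)) ℚ.- x ℚ.* g) ℚ.+ V ℚ.* (1ℚ ℚ.- (y ℚ.+ y))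
      ≤⟨ ℚ.+-monoˡ-≤ (V ℚ.* (1ℚ ℚ.- (y ℚ.+ y))) h ⟩
    (V ℚ.+ V) ℚ.* ε ℚ.+ V ℚ.* (1ℚ ℚ.- (y ℚ.+ y))
      ≡⟨ solve 3 (λ V y ε → (V :+ V) :* ε :+ V :* (con 1ℚ :- (y :+ y))
           := (V :+ V) :* (:- y :+ con 1ℚ :- (con ½ :- ε))) refl V y ε ⟩
    (V ℚ.+ V) ℚ.* (ℚ.- y ℚ.+ 1ℚ ℚ.- (½ ℚ.- ε)) ∎)

  deviation : ∀ {μ a V w ε} → 0ℚ ℚ.< μ → 0ℚ ℚ.≤ V → 0ℚ ℚ.≤ ε → μ ℚ.* (w ℚ.* w) ℚ.≤ a ℚ.* (V ℚ.* V) →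
    a ℚ.≤ ι (+ 4) ℚ.* (ε ℚ.* ε) ℚ.* μ → w ℚ.≤ (V ℚ.+ V) ℚ.* ε
  deviation {μ} {a} {V} {w} {ε} 0<μ 0≤V 0≤ε h a≤ =
    square-cancel-≤ (*-nonNeg (+-nonNeg 0≤V 0≤V) 0≤ε) (*-cancelˡ-≤ 0<μ (begin
      μ ℚ.* (w ℚ.* w)                           ≤⟨ h ⟩
      a ℚ.* (V ℚ.* V)                           ≤⟨ ℚ.*-monoʳ-≤-nonNeg (V ℚ.* V) {{ℚ.nonNegative (square-nonNeg V)}} a≤ ⟩
      ι (+ 4) ℚ.* (ε ℚ.* ε) ℚ.* μ ℚ.* (V ℚ.* V) ≡⟨ solve 3 (λ ε μ V → con (ι (+ 4)) :* (ε :* ε) :* μ :* (V :* V)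
                                                     := μ :* ((V :+ V) :* ε :* ((V :+ V) :* ε))) refl ε μ V ⟩
      μ ℚ.* ((V ℚ.+ V) ℚ.* ε ℚ.* ((V ℚ.+ V) ℚ.* ε)) ∎))

open ℚ-Lemmas

toℤ : ∀ {n} → Vec ℕ n → Vec ℤ n
toℤ = Vec.map (λ x → + x)

lonelyTime : ∀ {n} M (v : Vec ℕ n) → RelationFree M (toℤ v) → 0ℤ ℤ.< dot (toℤ v) (toℤ v) →
  ∀ ε → 0ℚ ℚ.≤ ε → ι (+ transferenceConstant n) ℚ.≤ ι (+ 4) ℚ.* (ε ℚ.* ε) ℚ.* ι (+ (suc M ℕ.* suc M)) →
  ¬ ¬ (∃[ t ] ∀ i → ½ ℚ.- ε ℚ.≤ distℤ (t ℚ.* ι (+ Vec.lookup v i)))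
lonelyTime {n} M v free 0<V ε 0≤ε large none = IntegerVectors.nearHalves M u free λ (g , near) →
  none (ι g ℚ.* r , λ i → subst (λ z → ½ ℚ.- ε ℚ.≤ distℤ (ι g ℚ.* r ℚ.* ι z)) (Vec.lookup-map i (λ x → + x) v)
    (close g i (near i)))
  where
  u = toℤ v
  V = dot u u
  0<ιV : 0ℚ ℚ.< ι V
  0<ιV = ι-pos {V} 0<V
  0<2V : 0ℚ ℚ.< ι V ℚ.+ ι V
  0<2V = ℚ.+-mono-< 0<ιV 0<ιV
  r = proj₁ (recip 0<2V)
  2Vr≡1 : (ι V ℚ.+ ι V) ℚ.* r ≡ 1ℚ
  2Vr≡1 = proj₂ (proj₂ (recip 0<2V))
  μ = suc M ℕ.* suc M
  0<μ : 0ℚ ℚ.< ι (+ μ)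
  0<μ = ι-pos {+ μ} (ℤ.+<+ (ℕ.s≤s ℕ.z≤n))
  close : ∀ g i → (∃[ y ] let w = V ℤ.* (1ℤ ℤ.- + 2 ℤ.* y) ℤ.- Vec.lookup u i ℤ.* g in
    + μ ℤ.* (w ℤ.* w) ℤ.≤ + transferenceConstant n ℤ.* (V ℤ.* V)) →
    ½ ℚ.- ε ℚ.≤ distℤ (ι g ℚ.* r ℚ.* ι (Vec.lookup u i))
  close g i (y , bound) = distℤ-≥ (ℤ.- y)
    (subst (λ z → z ℚ.+ (½ ℚ.- ε) ℚ.≤ ι g ℚ.* r ℚ.* ι x) (sym (ι-neg y))
      (half-lower {ι V} {r} {ι g} {ι x} {ι y} {ε} 0<ιV 2Vr≡1
        (deviation {ι (+ μ)} {a} {ι V} {W} {ε} 0<μ (ℚ.<⇒≤ 0<ιV) 0≤ε bound′ large)))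
    (subst (λ z → ι g ℚ.* r ℚ.* ι x ℚ.≤ z ℚ.+ 1ℚ ℚ.- (½ ℚ.- ε)) (sym (ι-neg y))
      (half-upper {ι V} {r} {ι g} {ι x} {ι y} {ε} 0<ιV 2Vr≡1
        (deviation {ι (+ μ)} {a} {ι V} {ℚ.- W} {ε} 0<μ (ℚ.<⇒≤ 0<ιV) 0≤ε
          (subst (λ z → ι (+ μ) ℚ.* z ℚ.≤ a ℚ.* (ι V ℚ.* ι V)) (neg-square W) bound′) large)))
    where
    x = Vec.lookup u i
    w = V ℤ.* (1ℤ ℤ.- + 2 ℤ.* y) ℤ.- x ℤ.* g
    a = ι (+ transferenceConstant n)
    W = ι V ℚ.* (1ℚ ℚ.- (ι y ℚ.+ ι y)) ℚ.- ι x ℚ.* ι g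
    neg-square : ∀ p → p ℚ.* p ≡ ℚ.- p ℚ.* ℚ.- p
    neg-square = ℚ-Solver.solve 1 (λ p → p ℚ-Solver.:* p ℚ-Solver.:= ℚ-Solver.:- p ℚ-Solver.:* ℚ-Solver.:- p) refl
    double : ∀ p → ι (+ 2) ℚ.* p ≡ p ℚ.+ p
    double = ℚ-Solver.solve 1 (λ p → ℚ-Solver.con (ι (+ 2)) ℚ-Solver.:* p ℚ-Solver.:= p ℚ-Solver.:+ p) refl
    ιw≡W : ι w ≡ W
    ιw≡W = trans (ι-- (V ℤ.* (1ℤ ℤ.- + 2 ℤ.* y)) (x ℤ.* g)) (cong₂ ℚ._-_
      (trans (ι-* V (1ℤ ℤ.- + 2 ℤ.* y)) (cong (ι V ℚ.*_)
        (trans (ι-- 1ℤ (+ 2 ℤ.* y)) (cong (λ z → 1ℚ ℚ.- z) (trans (ι-* (+ 2) y) (double (ι y)))))))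
      (ι-* x g))
    bound′ : ι (+ μ) ℚ.* (W ℚ.* W) ℚ.≤ a ℚ.* (ι V ℚ.* ι V)
    bound′ = subst₂ ℚ._≤_
      (trans (ι-* (+ μ) (w ℤ.* w)) (cong (ι (+ μ) ℚ.*_) (trans (ι-* w w) (cong₂ ℚ._*_ ιw≡W ιw≡W))))
      (trans (ι-* (+ transferenceConstant n) (V ℤ.* V)) (cong (a ℚ.*_) (ι-* V V)))
      (/1-mono-≤ {+ μ ℤ.* (w ℤ.* w)} {+ transferenceConstant n ℤ.* (V ℤ.* V)} bound)

-- The maximum of the loneliness over rational times.

lonelinessℚ : ∀ {n} → Vec ℕ (suc n) → ℚ → ℚ
lonelinessℚ v q = Vec.foldr₁ ℚ._⊓_ (Vec.map (λ vᵢ → distℤ (q ℚ.* ι (+ vᵢ))) v)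

lonelinessℚ-≤ : ∀ {n} (v : Vec ℕ (suc n)) q i → lonelinessℚ v q ℚ.≤ distℤ (q ℚ.* ι (+ Vec.lookup v i))
lonelinessℚ-≤ (x ∷ [])         q zero    = ℚ.≤-refl
lonelinessℚ-≤ (x ∷ v@(_ ∷ _)) q zero    = ℚ.p⊓q≤p _ (lonelinessℚ v q)
lonelinessℚ-≤ (x ∷ v@(_ ∷ _)) q (suc i) =
  ℚ.≤-trans (ℚ.p⊓q≤q (distℤ (q ℚ.* ι (+ x))) (lonelinessℚ v q)) (lonelinessℚ-≤ v q i)

lonelinessℚ-glb : ∀ {n} (v : Vec ℕ (suc n)) q {l} →
  (∀ i → l ℚ.≤ distℤ (q ℚ.* ι (+ Vec.lookup v i))) → l ℚ.≤ lonelinessℚ v q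
lonelinessℚ-glb (x ∷ [])         q h = h zero
lonelinessℚ-glb (x ∷ v@(_ ∷ _)) q h = ℚ.⊓-glb (h zero) (lonelinessℚ-glb v q (λ i → h (suc i)))

argmin : ∀ {n} (f : Fin (suc n) → ℚ) → ∃[ i ] ∀ j → f i ℚ.≤ f j
argmin {zero}  f = zero , λ where zero → ℚ.≤-refl
argmin {suc n} f with argmin (λ j → f (suc j))
... | i , least with ℚ.≤-total (f zero) (f (suc i))
...   | inj₁ f0≤ = zero , λ where zero    → ℚ.≤-refl
                                  (suc j) → ℚ.≤-trans f0≤ (least j)
...   | inj₂ ≤f0 = suc i , λ where zero    → ≤f0
                                   (suc j) → least j

module Exchange where

  open ℚ-Solver
  open ℚ.≤-Reasoning

  -- At t = crossing, level is both t x - a and b + 1 - t y.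
  module _ {x y r : ℚ} (xyr : (x ℚ.+ y) ℚ.* r ≡ 1ℚ) (a b : ℚ) where

    crossing level : ℚ
    crossing = (a ℚ.+ b ℚ.+ 1ℚ) ℚ.* r
    level    = ((b ℚ.+ 1ℚ) ℚ.* x ℚ.- a ℚ.* y) ℚ.* r

    scaled-level : (x ℚ.+ y) ℚ.* level ≡ (b ℚ.+ 1ℚ) ℚ.* x ℚ.- a ℚ.* y
    scaled-level = trans (solve 3 (λ s c r → s :* (c :* r) := s :* r :* c) refl (x ℚ.+ y) ((b ℚ.+ 1ℚ) ℚ.* x ℚ.- a ℚ.* y) r)
      (trans (cong (ℚ._* ((b ℚ.+ 1ℚ) ℚ.* x ℚ.- a ℚ.* y)) xyr) (ℚ.*-identityˡ _))

    crossing-lower : crossing ℚ.* x ≡ a ℚ.+ level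
    crossing-lower = trans
      (solve 5 (λ x y r a b → (a :+ b :+ con 1ℚ) :* r :* x
        := a :* ((x :+ y) :* r) :+ ((b :+ con 1ℚ) :* x :- a :* y) :* r) refl x y r a b)
      (cong (ℚ._+ level) (trans (cong (a ℚ.*_) xyr) (ℚ.*-identityʳ a)))

    crossing-upper : crossing ℚ.* y ≡ b ℚ.+ 1ℚ ℚ.- level
    crossing-upper = trans
      (solve 5 (λ x y r a b → (a :+ b :+ con 1ℚ) :* r :* y
        := (b :+ con 1ℚ) :* ((x :+ y) :* r) :- ((b :+ con 1ℚ) :* x :- a :* y) :* r) refl x y r a b)
      (cong (ℚ._- level) (trans (cong ((b ℚ.+ 1ℚ) ℚ.*_) xyr) (ℚ.*-identityʳ (b ℚ.+ 1ℚ))))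

    -- Multiplying the lower constraint by y and the upper one by x eliminates q and leaves (x + y)
    -- l on one side and the scaled level on the other.
    level-≥ : ∀ {q l} → 0ℚ ℚ.< x → 0ℚ ℚ.< y → a ℚ.+ l ℚ.≤ q ℚ.* x → q ℚ.* y ℚ.≤ b ℚ.+ 1ℚ ℚ.- l → l ℚ.≤ level
    level-≥ {q} {l} 0<x 0<y lower upper = *-cancelˡ-≤ (ℚ.+-mono-< 0<x 0<y) (begin
      (x ℚ.+ y) ℚ.* l
        ≡⟨ solve 4 (λ x y l a → (x :+ y) :* l := (a :+ l) :* y :+ (x :* l :- a :* y)) refl x y l a ⟩
      (a ℚ.+ l) ℚ.* y ℚ.+ (x ℚ.* l ℚ.- a ℚ.* y)
        ≤⟨ ℚ.+-monoˡ-≤ (x ℚ.* l ℚ.- a ℚ.* y) (begin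
             (a ℚ.+ l) ℚ.* y         ≤⟨ ℚ.*-monoʳ-≤-nonNeg y {{ℚ.nonNegative (ℚ.<⇒≤ 0<y)}} lower ⟩
             q ℚ.* x ℚ.* y           ≡⟨ solve 3 (λ q x y → q :* x :* y := q :* y :* x) refl q x y ⟩
             q ℚ.* y ℚ.* x           ≤⟨ ℚ.*-monoʳ-≤-nonNeg x {{ℚ.nonNegative (ℚ.<⇒≤ 0<x)}} upper ⟩
             (b ℚ.+ 1ℚ ℚ.- l) ℚ.* x  ∎) ⟩
      (b ℚ.+ 1ℚ ℚ.- l) ℚ.* x ℚ.+ (x ℚ.* l ℚ.- a ℚ.* y)
        ≡⟨ solve 5 (λ x y l a b → (b :+ con 1ℚ :- l) :* x :+ (x :* l :- a :* y)
             := (b :+ con 1ℚ) :* x :- a :* y) refl x y l a b ⟩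
      (b ℚ.+ 1ℚ) ℚ.* x ℚ.- a ℚ.* y
        ≡⟨ scaled-level ⟨
      (x ℚ.+ y) ℚ.* level ∎)

  -- At t the upper constraint of y is tight. Since l does not exceed the level of the pair z, y, a
  -- tight upper constraint of y leaves the lower constraint of z satisfied.
  above : ∀ {t y z b c l s} → 0ℚ ℚ.< y → 0ℚ ℚ.< z → t ℚ.* y ≡ b ℚ.+ 1ℚ ℚ.- l →
    (zyr : (z ℚ.+ y) ℚ.* s ≡ 1ℚ) → l ℚ.≤ level zyr c b → c ℚ.+ l ℚ.≤ t ℚ.* z
  above {t} {y} {z} {b} {c} {l} 0<y 0<z ty zyr l≤ = *-cancelˡ-≤ 0<y (begin
    y ℚ.* (c ℚ.+ l)
      ≡⟨ solve 4 (λ y z c l → y :* (c :+ l) := (z :+ y) :* l :+ (y :* c :- z :* l)) refl y z c l ⟩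
    (z ℚ.+ y) ℚ.* l ℚ.+ (y ℚ.* c ℚ.- z ℚ.* l)
      ≤⟨ ℚ.+-monoˡ-≤ (y ℚ.* c ℚ.- z ℚ.* l) (ℚ.≤-trans
           (ℚ.*-monoˡ-≤-nonNeg (z ℚ.+ y) {{ℚ.nonNegative (ℚ.<⇒≤ (ℚ.+-mono-< 0<z 0<y))}} l≤)
           (ℚ.≤-reflexive (scaled-level zyr c b))) ⟩
    (b ℚ.+ 1ℚ) ℚ.* z ℚ.- c ℚ.* y ℚ.+ (y ℚ.* c ℚ.- z ℚ.* l)
      ≡⟨ solve 5 (λ y z b c l → (b :+ con 1ℚ) :* z :- c :* y :+ (y :* c :- z :* l)
           := (b :+ con 1ℚ :- l) :* z) refl y z b c l ⟩
    (b ℚ.+ 1ℚ ℚ.- l) ℚ.* z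
      ≡⟨ cong (ℚ._* z) ty ⟨
    t ℚ.* y ℚ.* z
      ≡⟨ solve 3 (λ t y z → t :* y :* z := y :* (t :* z)) refl t y z ⟩
    y ℚ.* (t ℚ.* z) ∎)

  below : ∀ {t x z a c l s} → 0ℚ ℚ.< x → 0ℚ ℚ.< z → t ℚ.* x ≡ a ℚ.+ l →
    (xzr : (x ℚ.+ z) ℚ.* s ≡ 1ℚ) → l ℚ.≤ level xzr a c → t ℚ.* z ℚ.≤ c ℚ.+ 1ℚ ℚ.- l
  below {t} {x} {z} {a} {c} {l} 0<x 0<z tx xzr l≤ = *-cancelˡ-≤ 0<x (begin
    x ℚ.* (t ℚ.* z)
      ≡⟨ solve 3 (λ t x z → x :* (t :* z) := t :* x :* z) refl t x z ⟩
    t ℚ.* x ℚ.* z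
      ≡⟨ cong (ℚ._* z) tx ⟩
    (a ℚ.+ l) ℚ.* z
      ≡⟨ solve 4 (λ x z a l → (a :+ l) :* z := (x :+ z) :* l :+ (a :* z :- x :* l)) refl x z a l ⟩
    (x ℚ.+ z) ℚ.* l ℚ.+ (a ℚ.* z ℚ.- x ℚ.* l)
      ≤⟨ ℚ.+-monoˡ-≤ (a ℚ.* z ℚ.- x ℚ.* l) (ℚ.≤-trans
           (ℚ.*-monoˡ-≤-nonNeg (x ℚ.+ z) {{ℚ.nonNegative (ℚ.<⇒≤ (ℚ.+-mono-< 0<x 0<z))}} l≤)
           (ℚ.≤-reflexive (scaled-level xzr a c))) ⟩
    (c ℚ.+ 1ℚ) ℚ.* x ℚ.- a ℚ.* z ℚ.+ (a ℚ.* z ℚ.- x ℚ.* l)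
      ≡⟨ solve 5 (λ x z a c l → (c :+ con 1ℚ) :* x :- a :* z :+ (a :* z :- x :* l)
           := x :* (c :+ con 1ℚ :- l)) refl x z a c l ⟩
    x ℚ.* (c ℚ.+ 1ℚ ℚ.- l) ∎)

  lookup≤sum : ∀ {n} (v : Vec ℕ n) i → Vec.lookup v i ℕ.≤ Vec.sum v
  lookup≤sum (y ∷ v) zero    = ℕ.m≤m+n y (Vec.sum v)
  lookup≤sum (y ∷ v) (suc i) = ℕ.≤-trans (lookup≤sum v i) (ℕ.m≤n+m (Vec.sum v) y)

  ∣! : ∀ {m n} → 0 ℕ.< m → m ℕ.≤ n → m ℕ.∣ n !
  ∣! {suc m} _ m≤n = ℕ.∣-trans (ℕ.m∣m*n (m !)) (ℕ.m≤n⇒m!∣n! m≤n)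

  module _ {n} (v : Vec ℕ (suc n)) (v-pos : ∀ i → 0 ℕ.< Vec.lookup v i) where

    x : Fin (suc n) → ℚ
    x i = ι (+ Vec.lookup v i)

    0<x : ∀ i → 0ℚ ℚ.< x i
    0<x i = ι-pos {+ Vec.lookup v i} (ℤ.+<+ (v-pos i))

    reciprocal : ∀ i j → ∃[ r ] 0ℚ ℚ.< r × (x i ℚ.+ x j) ℚ.* r ≡ 1ℚ
    reciprocal i j = recip (ℚ.+-mono-< (0<x i) (0<x j))

    inverse : ∀ i j → (x i ℚ.+ x j) ℚ.* proj₁ (reciprocal i j) ≡ 1ℚ
    inverse i j = proj₂ (proj₂ (reciprocal i j))

    -- With the floors aᵢ of q vᵢ fixed, aᵢ + l ≤ t vᵢ and t vⱼ ≤ aⱼ + 1 - l have a common solution t for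
    -- all i and j exactly when l is at most the least level, and then the crossing of that level is one.
    exchange : ∀ q → ∃[ i ] ∃[ j ] ∃[ k ] lonelinessℚ v q ℚ.≤ lonelinessℚ v (ι k ℚ.* proj₁ (reciprocal i j))
    exchange q = i₀ , j₀ , k₀ , ℚ.≤-trans
      (level-≥ (inverse i₀ j₀) (a i₀) (a j₀) {q} {lonelinessℚ v q} (0<x i₀) (0<x j₀) (lower i₀) (upper j₀))
      (subst (λ t → l ℚ.≤ lonelinessℚ v t) t≡ (lonelinessℚ-glb v t λ m → distℤ-≥ (floors m)
        (above {t} {x j₀} {x m} {a j₀} {a m} {l} (0<x j₀) (0<x m)
          (crossing-upper (inverse i₀ j₀) (a i₀) (a j₀)) (inverse m j₀) (least m j₀))
        (below {t} {x i₀} {x m} {a i₀} {a m} {l} (0<x i₀) (0<x m)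
          (crossing-lower (inverse i₀ j₀) (a i₀) (a j₀)) (inverse i₀ m) (least i₀ m))))
      where
      floors : Fin (suc n) → ℤ
      floors i = ℚ.floor (q ℚ.* x i)
      a : Fin (suc n) → ℚ
      a i = ι (floors i)
      levels : Fin (suc n) → Fin (suc n) → ℚ
      levels i j = level (inverse i j) (a i) (a j)
      best : Fin (suc n) → Fin (suc n)
      best i = proj₁ (argmin (levels i))
      i₀ = proj₁ (argmin (λ i → levels i (best i)))
      j₀ = best i₀
      l = levels i₀ j₀
      t = crossing {x i₀} {x j₀} (inverse i₀ j₀) (a i₀) (a j₀)
      k₀ = floors i₀ ℤ.+ floors j₀ ℤ.+ 1ℤ
      t≡ : t ≡ ι k₀ ℚ.* proj₁ (reciprocal i₀ j₀)
      t≡ = cong (ℚ._* proj₁ (reciprocal i₀ j₀)) (sym (trans (ι-+ (floors i₀ ℤ.+ floors j₀) 1ℤ)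
        (cong (ℚ._+ 1ℚ) (ι-+ (floors i₀) (floors j₀)))))
      least : ∀ i j → l ℚ.≤ levels i j
      least i j = ℚ.≤-trans (proj₂ (argmin (λ i → levels i (best i))) i) (proj₂ (argmin (levels i)) j)
      lower : ∀ i → a i ℚ.+ lonelinessℚ v q ℚ.≤ q ℚ.* x i
      lower i = subst (a i ℚ.+ lonelinessℚ v q ℚ.≤_)
        (solve 2 (λ a p → a :+ (p :- a) := p) refl (a i) (q ℚ.* x i))
        (ℚ.+-monoʳ-≤ (a i) (ℚ.≤-trans (lonelinessℚ-≤ v q i) (ℚ.p⊓q≤p (q ℚ.* x i ℚ.- a i) (a i ℚ.+ 1ℚ ℚ.- q ℚ.* x i))))
      upper : ∀ i → q ℚ.* x i ℚ.≤ a i ℚ.+ 1ℚ ℚ.- lonelinessℚ v q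
      upper i = subst (ℚ._≤ a i ℚ.+ 1ℚ ℚ.- lonelinessℚ v q)
        (solve 2 (λ b p → b :- (b :- p) := p) refl (a i ℚ.+ 1ℚ) (q ℚ.* x i))
        (ℚ.+-monoʳ-≤ (a i ℚ.+ 1ℚ) (ℚ.neg-antimono-≤ (ℚ.≤-trans (lonelinessℚ-≤ v q i)
          (ℚ.p⊓q≤q (q ℚ.* x i ℚ.- a i) (a i ℚ.+ 1ℚ ℚ.- q ℚ.* x i)))))

    lonelinessℚ-shift : ∀ q k → lonelinessℚ v q ℚ.≤ lonelinessℚ v (q ℚ.+ ι k)
    lonelinessℚ-shift q k = lonelinessℚ-glb v (q ℚ.+ ι k) λ i → ℚ.≤-trans (lonelinessℚ-≤ v q i)
      (subst (λ z → distℤ (q ℚ.* x i) ℚ.≤ distℤ z)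
        (trans (cong (λ z → q ℚ.* x i ℚ.+ z) (ι-* k (+ Vec.lookup v i)))
          (sym (ℚ.*-distribʳ-+ (x i) q (ι k))))
        (distℤ-shift (q ℚ.* x i) (k ℤ.* + Vec.lookup v i)))

    -- A common multiple of all vᵢ + vⱼ.
    Q : ℕ
    Q = (Vec.sum v ℕ.+ Vec.sum v) !

    -- By `exchange` only the times k / (vᵢ + vⱼ) compete, i = j included. All of them are multiples
    -- of 1 / Q, and integer shifts of t change nothing, so the best of the Q residues is a maximum.
    maximum : ∃[ t ] ∀ q → lonelinessℚ v q ℚ.≤ lonelinessℚ v t
    maximum = attained Q (ℕ.1≤n! (Vec.sum v ℕ.+ Vec.sum v)) λ i j →
        ∣! (ℕ.<-≤-trans (v-pos i) (ℕ.m≤m+n _ _)) (ℕ.+-mono-≤ (lookup≤sum v i) (lookup≤sum v j))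
      where
      attained : ∀ Q → 1 ℕ.≤ Q → (∀ i j → Vec.lookup v i ℕ.+ Vec.lookup v j ℕ.∣ Q) →
        ∃[ t ] ∀ q → lonelinessℚ v q ℚ.≤ lonelinessℚ v t
      attained Q@(suc Q-1) _ common = grid κ₀ , λ q → let i , j , k , improved = exchange q in
          ℚ.≤-trans improved (onGrid i j k (common i j))
        where
        0<Q : 0ℚ ℚ.< ι (+ Q)
        0<Q = ι-pos {+ Q} (ℤ.+<+ (ℕ.s≤s ℕ.z≤n))
        s = proj₁ (recip 0<Q)
        Qs≡1 : ι (+ Q) ℚ.* s ≡ 1ℚ
        Qs≡1 = proj₂ (proj₂ (recip 0<Q))
        grid : Fin Q → ℚ
        grid κ = ι (+ Fin.toℕ κ) ℚ.* s
        neg-involutive : ∀ p → ℚ.- (ℚ.- p) ≡ p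
        neg-involutive = solve 1 (λ p → :- (:- p) := p) refl
        best = argmin (λ κ → ℚ.- lonelinessℚ v (grid κ))
        κ₀ = proj₁ best
        greatest : ∀ κ → lonelinessℚ v (grid κ) ℚ.≤ lonelinessℚ v (grid κ₀)
        greatest κ = subst₂ ℚ._≤_ (neg-involutive _) (neg-involutive _) (ℚ.neg-antimono-≤ (proj₂ best κ))
        residue : ∀ k → lonelinessℚ v (ι k ℚ.* s) ℚ.≤ lonelinessℚ v (grid κ₀)
        residue k = ℚ.≤-trans (lonelinessℚ-shift (ι k ℚ.* s) (ℤ.- w))
          (subst (λ t → lonelinessℚ v t ℚ.≤ lonelinessℚ v (grid κ₀)) grid≡ (greatest κ))
          where
          w = k ℤ./ℕ Q
          ρ = k ℤ.%ℕ Q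
          κ = Fin.fromℕ< (ℤ.n%ℕd<d k Q)
          grid≡ : grid κ ≡ ι k ℚ.* s ℚ.+ ι (ℤ.- w)
          grid≡ = sym (trans (cong₂ (λ y z → y ℚ.* s ℚ.+ z)
              (trans (cong ι (ℤ.a≡a%ℕn+[a/ℕn]*n k Q)) (trans (ι-+ (+ ρ) (w ℤ.* + Q)) (cong (λ z → ι (+ ρ) ℚ.+ z) (ι-* w (+ Q)))))
              (ι-neg w))
            (trans (solve 4 (λ ρ w Q s → (ρ :+ w :* Q) :* s :+ :- w := ρ :* s :+ w :* (Q :* s) :- w) refl (ι (+ ρ)) (ι w) (ι (+ Q)) s)
            (trans (cong (λ z → ι (+ ρ) ℚ.* s ℚ.+ ι w ℚ.* z ℚ.- ι w) Qs≡1)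
            (trans (solve 2 (λ p w → p :+ w :* con 1ℚ :- w := p) refl (ι (+ ρ) ℚ.* s) (ι w))
              (cong (λ z → ι (+ z) ℚ.* s) (sym (Fin.toℕ-fromℕ< (ℤ.n%ℕd<d k Q))))))))
        onGrid : ∀ i j k → Vec.lookup v i ℕ.+ Vec.lookup v j ℕ.∣ Q →
          lonelinessℚ v (ι k ℚ.* proj₁ (reciprocal i j)) ℚ.≤ lonelinessℚ v (grid κ₀)
        onGrid i j k (ℕ.divides e Q≡) = subst (λ t → lonelinessℚ v t ℚ.≤ lonelinessℚ v (grid κ₀))
          (sym same) (residue (k ℤ.* + e))
          where
          r = proj₁ (reciprocal i j)
          ιQ≡ : ι (+ Q) ≡ ι (+ e) ℚ.* (x i ℚ.+ x j)
          ιQ≡ = trans (cong (λ z → ι (+ z)) Q≡) (trans (cong ι (ℤ.pos-* e (Vec.lookup v i ℕ.+ Vec.lookup v j)))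
            (trans (ι-* (+ e) (+ (Vec.lookup v i ℕ.+ Vec.lookup v j)))
              (cong (ι (+ e) ℚ.*_) (ι-+ (+ Vec.lookup v i) (+ Vec.lookup v j)))))
          same : ι k ℚ.* r ≡ ι (k ℤ.* + e) ℚ.* s
          same = trans (sym (ℚ.*-identityʳ (ι k ℚ.* r))) (trans (cong (ι k ℚ.* r ℚ.*_) (sym Qs≡1))
            (trans (cong (λ z → ι k ℚ.* r ℚ.* (z ℚ.* s)) ιQ≡)
            (trans (solve 5 (λ k r e y s → k :* r :* (e :* y :* s) := k :* e :* s :* (y :* r)) refl (ι k) r (ι (+ e)) (x i ℚ.+ x j) s)
            (trans (cong (ι k ℚ.* ι (+ e) ℚ.* s ℚ.*_) (inverse i j))
            (trans (ℚ.*-identityʳ _) (cong (ℚ._* s) (sym (ι-* k (+ e)))))))))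

open Exchange using (maximum)

-- Counting the subsets that satisfy a short relation.

module Counting where

  count : ∀ {A : Set} → (A → Bool) → List A → ℕ
  count p xs = length (filterᵇ p xs)

  module _ {A : Set} where

    count-++ : ∀ (p : A → Bool) xs ys → count p (xs ++ ys) ≡ count p xs ℕ.+ count p ys
    count-++ p []       ys = refl
    count-++ p (x ∷ xs) ys with p x
    ... | true  = cong suc (count-++ p xs ys)
    ... | false = count-++ p xs ys

    count-map : ∀ {B : Set} (p : A → Bool) (f : B → A) xs → count p (List.map f xs) ≡ count (p ∘ f) xs
    count-map p f []       = refl
    count-map p f (x ∷ xs) with p (f x)
    ... | true  = cong suc (count-map p f xs)
    ... | false = count-map p f xs

    count-not : ∀ (p : A → Bool) xs → count (not ∘ p) xs ℕ.+ count p xs ≡ length xs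
    count-not p []       = refl
    count-not p (x ∷ xs) with p x
    ... | true  = trans (ℕ.+-suc _ _) (cong suc (count-not p xs))
    ... | false = cong suc (count-not p xs)

    count-∨ : ∀ (p q : A → Bool) xs → count (λ x → p x ∨ q x) xs ℕ.≤ count p xs ℕ.+ count q xs
    count-∨ p q []       = ℕ.z≤n
    count-∨ p q (x ∷ xs) with p x | q x
    ... | true  | true  = ℕ.s≤s (ℕ.≤-trans (count-∨ p q xs) (ℕ.+-monoʳ-≤ (count p xs) (ℕ.n≤1+n _)))
    ... | true  | false = ℕ.s≤s (count-∨ p q xs)
    ... | false | true  = subst (suc (count (λ x → p x ∨ q x) xs) ℕ.≤_) (sym (ℕ.+-suc _ _))
                            (ℕ.s≤s (count-∨ p q xs))
    ... | false | false = count-∨ p q xs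

    count-mono : ∀ (p q : A → Bool) xs → (∀ x → T (p x) → T (q x)) → count p xs ℕ.≤ count q xs
    count-mono p q []       h = ℕ.z≤n
    count-mono p q (x ∷ xs) h with p x | q x | h x
    ... | true  | true  | _ = ℕ.s≤s (count-mono p q xs h)
    ... | true  | false | g = ⊥-elim (g _)
    ... | false | true  | _ = ℕ.m≤n⇒m≤1+n (count-mono p q xs h)
    ... | false | false | _ = count-mono p q xs h

    count-zero : ∀ (p : A → Bool) xs → (∀ x → x ∈ xs → ¬ T (p x)) → count p xs ≡ 0
    count-zero p []       h = refl
    count-zero p (x ∷ xs) h with p x | h x (here refl)
    ... | true  | g = ⊥-elim (g _)
    ... | false | _ = count-zero p xs (λ y y∈ → h y (there y∈))

    count-any : ∀ {C : Set} (p : C → A → Bool) cs xs K → (∀ c → count (p c) xs ℕ.≤ K) →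
      count (λ x → any (λ c → p c x) cs) xs ℕ.≤ length cs ℕ.* K
    count-any p []       xs K h = ℕ.≤-reflexive (count-zero (λ _ → false) xs (λ _ _ ()))
    count-any p (c ∷ cs) xs K h = ℕ.≤-trans
      (count-∨ (p c) (λ x → any (λ c → p c x) cs) xs)
      (ℕ.+-mono-≤ (h c) (count-any p cs xs K h))

  subsets-mono : ∀ {A : Set} k (x : A) xs → length (subsets k xs) ℕ.≤ length (subsets k (x ∷ xs))
  subsets-mono zero    x xs = ℕ.≤-refl
  subsets-mono (suc k) x xs = subst (length (subsets (suc k) xs) ℕ.≤_)
    (sym (List.length-++ (List.map (x ∷_) (subsets k xs)))) (ℕ.m≤n+m _ _)

  length-subsets-∷ : ∀ {A : Set} k (x : A) xs →
    length (subsets (suc k) (x ∷ xs)) ≡ length (subsets k xs) ℕ.+ length (subsets (suc k) xs)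
  length-subsets-∷ k x xs = trans (List.length-++ (List.map (x ∷_) (subsets k xs)))
    (cong (ℕ._+ length (subsets (suc k) xs)) (List.length-map (x ∷_) (subsets k xs)))

  -- (k + 1) C(N, k + 1) = (N - k) C(N, k), without subtraction.
  subsets-absorption : ∀ {A : Set} k (xs : List A) →
    suc k ℕ.* length (subsets (suc k) xs) ℕ.+ k ℕ.* length (subsets k xs) ≡ length xs ℕ.* length (subsets k xs)
  subsets-absorption zero    []       = refl
  subsets-absorption (suc k) []       = cong₂ ℕ._+_ (ℕ.*-zeroʳ k) (ℕ.*-zeroʳ k)
  subsets-absorption zero    (x ∷ xs) rewrite length-subsets-∷ 0 x xs =
    cong suc (subsets-absorption zero xs)
  subsets-absorption (suc k) (x ∷ xs)
    rewrite length-subsets-∷ (suc k) x xs | length-subsets-∷ k x xs =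
    trans (solve 4 (λ k a b c →
        (con 2 :+ k) :* (b :+ c) :+ (con 1 :+ k) :* (a :+ b)
        := ((con 2 :+ k) :* c :+ (con 1 :+ k) :* b) :+ ((con 1 :+ k) :* b :+ k :* a) :+ (a :+ b))
        refl k (length (subsets k xs)) (length (subsets (suc k) xs)) (length (subsets (suc (suc k)) xs)))
      (trans (cong₂ (λ s t → s ℕ.+ t ℕ.+ (length (subsets k xs) ℕ.+ length (subsets (suc k) xs)))
          (subsets-absorption (suc k) xs) (subsets-absorption k xs))
        (solve 3 (λ n a b → n :* b :+ n :* a :+ (a :+ b) := (con 1 :+ n) :* (a :+ b))
          refl (length xs) (length (subsets k xs)) (length (subsets (suc k) xs))))
    where open ℕ-Solver

  subsets-∈ : ∀ {A : Set} n {S : List A} {v} → v ∈ subsets n S → ∀ i → Vec.lookup v i ∈ S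
  subsets-∈ (suc n) {x ∷ xs} v∈ i with ∈.∈-++⁻ (List.map (x ∷_) (subsets n xs)) v∈
  ... | inj₂ v∈xs = there (subsets-∈ (suc n) v∈xs i)
  ... | inj₁ v∈map with ∈.∈-map⁻ (x ∷_) v∈map
  subsets-∈ (suc n) {x ∷ xs} v∈ zero    | inj₁ _ | w , w∈ , refl = here refl
  subsets-∈ (suc n) {x ∷ xs} v∈ (suc i) | inj₁ _ | w , w∈ , refl = there (subsets-∈ n w∈ i)

  subsets-nonempty : ∀ {A : Set} n (S : List A) → n ℕ.≤ length S → 0 ℕ.< length (subsets n S)
  subsets-nonempty zero    S        _         = ℕ.s≤s ℕ.z≤n
  subsets-nonempty (suc n) (x ∷ xs) (ℕ.s≤s h) = subst (0 ℕ.<_) (sym (length-subsets-∷ n x xs))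
    (ℕ.<-≤-trans (subsets-nonempty n xs h) (ℕ.m≤m+n _ _))

  witness : ∀ {P : Set} (P? : Dec P) → T (does P?) → P
  witness (yes p) _ = p

  reflect : ∀ {P : Set} (P? : Dec P) → P → T (does P?)
  reflect (yes _) _ = _
  reflect (no ¬p) p = ¬p p

  solves : ∀ {n} → Vec ℤ n → ℤ → Vec ℕ n → Bool
  solves c z v = does (dot c (toℤ v) ℤ.≟ z)

  -- The equation fixes the first entry of v. As S has no duplicates, at most one position of the
  -- list can supply it, and the other k entries come from the later part of the list.
  count-solutions-head : ∀ {k} c₀ (c : Vec ℤ k) → c₀ ≢ 0ℤ → VecAll.All (_≡ 0ℤ) c → ∀ z S → Unique S →
    count (solves (c₀ ∷ c) z) (subsets (suc k) S) ℕ.≤ length (subsets k S)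
  count-solutions-head c₀ c c₀≢0 c≡0 z [] _ = ℕ.z≤n
  count-solutions-head {k} c₀ c c₀≢0 c≡0 z (x ∷ xs) (x∉xs ∷ unique) = subst (ℕ._≤ length (subsets k (x ∷ xs)))
    (sym (trans (count-++ p (List.map (x ∷_) (subsets k xs)) _)
      (cong (ℕ._+ count p (subsets (suc k) xs)) (count-map p (x ∷_) (subsets k xs)))))
    (ℕ.≤-trans (cases (c₀ ℤ.* + x ℤ.≟ z)) (subsets-mono k x xs))
    where
    p = solves (c₀ ∷ c) z
    head-solves : ∀ v → T (p v) → c₀ ℤ.* + Vec.lookup v zero ≡ z
    head-solves (y ∷ w) Tp = trans (sym (trans (cong (λ t → c₀ ℤ.* + y ℤ.+ t) (IntegerVectors.dot-zeroˡ c≡0 (toℤ w)))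
      (ℤ.+-identityʳ _))) (witness (dot (c₀ ∷ c) (toℤ (y ∷ w)) ℤ.≟ z) Tp)
    cases : Dec (c₀ ℤ.* + x ≡ z) →
      count (p ∘ (x ∷_)) (subsets k xs) ℕ.+ count p (subsets (suc k) xs) ℕ.≤ length (subsets k xs)
    cases (yes e) = subst (ℕ._≤ length (subsets k xs))
      (sym (trans (cong (λ t → count (p ∘ (x ∷_)) (subsets k xs) ℕ.+ t) (count-zero p (subsets (suc k) xs) other)) (ℕ.+-identityʳ _)))
      (List.length-filter _ (subsets k xs))
      where
      other : ∀ v → v ∈ subsets (suc k) xs → ¬ T (p v)
      other v v∈ Tp = All.lookup x∉xs (subsets-∈ (suc k) v∈ zero) (ℤ.+-injective
        (ℤ.*-cancelˡ-≡ c₀ _ _ {{ℤ.≢-nonZero c₀≢0}} (trans e (sym (head-solves v Tp)))))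
    cases (no ¬e) = subst (ℕ._≤ length (subsets k xs))
      (cong (ℕ._+ count p (subsets (suc k) xs)) (sym (count-zero (p ∘ (x ∷_)) (subsets k xs) (λ w _ Tp → ¬e (head-solves (x ∷ w) Tp)))))
      (count-solutions-head c₀ c c₀≢0 c≡0 z xs unique)

  -- If the tail of c is nonzero, the solutions split according to whether the first element x of
  -- the list is the first entry. If it is, the tail of c gives an equation for the other entries
  -- with a shifted right side. The two bounds add up by Pascal's rule.
  count-solutions : ∀ {k} (c : Vec ℤ (suc k)) → ¬ VecAll.All (_≡ 0ℤ) c → ∀ z S → Unique S →
    count (solves c z) (subsets (suc k) S) ℕ.≤ length (subsets k S)
  count-solutions (c₀ ∷ c) c≢0 z S unique with VecAll.all? (ℤ._≟ 0ℤ) c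
  ... | yes c≡0 = count-solutions-head c₀ c (λ c₀≡0 → c≢0 (c₀≡0 ∷ c≡0)) c≡0 z S unique
  count-solutions (c₀ ∷ [])         c≢0 z S unique | no c≢0′ = ⊥-elim (c≢0′ [])
  count-solutions {suc k} (c₀ ∷ c@(_ ∷ _)) c≢0 z []       unique            | no c≢0′ = ℕ.z≤n
  count-solutions {suc k} (c₀ ∷ c@(_ ∷ _)) c≢0 z (x ∷ xs) (x∉xs ∷ unique) | no c≢0′ =
    subst₂ ℕ._≤_
      (sym (trans (count-++ p (List.map (x ∷_) (subsets (suc k) xs)) _)
        (cong (ℕ._+ count p (subsets (suc (suc k)) xs)) (count-map p (x ∷_) (subsets (suc k) xs)))))
      (sym (length-subsets-∷ k x xs))
      (ℕ.+-mono-≤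
        (ℕ.≤-trans (count-mono (p ∘ (x ∷_)) (solves c (z ℤ.- c₀ ℤ.* + x)) (subsets (suc k) xs) rest)
          (count-solutions c c≢0′ (z ℤ.- c₀ ℤ.* + x) xs unique))
        (count-solutions (c₀ ∷ c) c≢0 z xs unique))
    where
    p = solves (c₀ ∷ c) z
    move : ∀ {i j z} → i ℤ.+ j ≡ z → j ≡ z ℤ.- i
    move {i} {j} refl = sym (trans (cong (ℤ._- i) (ℤ.+-comm i j)) (trans (ℤ.+-assoc j i (ℤ.- i))
      (trans (cong (λ t → j ℤ.+ t) (ℤ.+-inverseʳ i)) (ℤ.+-identityʳ j))))
    rest : ∀ w → T (p (x ∷ w)) → T (solves c (z ℤ.- c₀ ℤ.* + x) w)
    rest w Tp = reflect (dot c (toℤ w) ℤ.≟ _) (move (witness (dot (c₀ ∷ c) (toℤ (x ∷ w)) ℤ.≟ z) Tp))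

  range : ℕ → List ℤ
  range zero    = 0ℤ ∷ []
  range (suc M) = + suc M ∷ -[1+ M ] ∷ range M

  length-range : ∀ M → length (range M) ≡ 2 ℕ.* M ℕ.+ 1
  length-range zero    = refl
  length-range (suc M) = trans (cong (2 ℕ.+_) (length-range M))
    (cong (ℕ._+ 1) (sym (ℕ.*-suc 2 M)))

  ∈-range : ∀ M x → ℤ.∣ x ∣ ℕ.≤ M → x ∈ range M
  ∈-range zero    (+ zero)  _ = here refl
  ∈-range (suc M) x         h with ℤ.∣ x ∣ ℕ.≤? M
  ∈-range (suc M) x         h | yes ≤M = there (there (∈-range M x ≤M))
  ∈-range (suc M) (+ n)     h | no  ≰M = here (cong (λ t → + t) (ℕ.≤-antisym h (ℕ.≰⇒> ≰M)))
  ∈-range (suc M) -[1+ n ]  h | no  ≰M = there (here (cong -[1+_] (ℕ.suc-injective (ℕ.≤-antisym h (ℕ.≰⇒> ≰M)))))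

  box : ℕ → ∀ n → List (Vec ℤ n)
  box M zero    = [] ∷ []
  box M (suc n) = cartesianProductWith _∷_ (range M) (box M n)

  length-box : ∀ M n → length (box M n) ≡ (2 ℕ.* M ℕ.+ 1) ℕ.^ n
  length-box M zero    = refl
  length-box M (suc n) = trans (length-product (range M) (box M n))
    (cong₂ ℕ._*_ (length-range M) (length-box M n))
    where
    length-product : ∀ {n} (xs : List ℤ) (ys : List (Vec ℤ n)) →
      length (cartesianProductWith _∷_ xs ys) ≡ length xs ℕ.* length ys
    length-product []       ys = refl
    length-product (x ∷ xs) ys = trans (List.length-++ (List.map (x ∷_) ys))
      (cong₂ ℕ._+_ (List.length-map (x ∷_) ys) (length-product xs ys))

  ∈-box : ∀ M {n} {c : Vec ℤ n} → VecAll.All (λ x → ℤ.∣ x ∣ ℕ.≤ M) c → c ∈ box M n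
  ∈-box M []       = here refl
  ∈-box M (h ∷ hs) = ∈.∈-cartesianProductWith⁺ _∷_ (∈-range M _ h) (∈-box M hs)

  relation : ∀ {n} → Vec ℤ n → Vec ℕ n → Bool
  relation c v = not (does (VecAll.all? (ℤ._≟ 0ℤ) c)) ∧ solves c 0ℤ v

  hasRelation : ∀ {n} → ℕ → Vec ℕ n → Bool
  hasRelation {n} M v = any (λ c → relation c v) (box M n)

  relationFree : ∀ {n} M (v : Vec ℕ n) → T (not (hasRelation M v)) → RelationFree M (toℤ v)
  relationFree {n} M v none c small c·v≡0 = conclude (VecAll.all? (ℤ._≟ 0ℤ) c) refl
    where
    absent : ∀ {p : Vec ℤ n → Bool} cs → T (not (any p cs)) → c ∈ cs → ¬ T (p c)
    absent {p} (c ∷ cs) none (here refl) with p c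
    ... | false = λ ()
    absent {p} (d ∷ cs) none (there c∈) with p d
    ... | false = absent cs none c∈
    conclude : (d : Dec (VecAll.All (_≡ 0ℤ) c)) → VecAll.all? (ℤ._≟ 0ℤ) c ≡ d → VecAll.All (_≡ 0ℤ) c
    conclude (yes c≡0) _ = c≡0
    conclude (no c≢0)  e = ⊥-elim (absent (box M n) none (∈-box M small)
      (subst (λ d → T (not (does d) ∧ solves c 0ℤ v)) (sym e) (reflect (dot c (toℤ v) ℤ.≟ 0ℤ) c·v≡0)))

  count-hasRelation : ∀ M k S → Unique S →
    count (hasRelation M) (subsets (suc k) S) ℕ.≤ (2 ℕ.* M ℕ.+ 1) ℕ.^ suc k ℕ.* length (subsets k S)
  count-hasRelation M k S unique = subst (λ b → count (hasRelation M) (subsets (suc k) S) ℕ.≤ b ℕ.* length (subsets k S))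
    (length-box M (suc k)) (count-any relation (box M (suc k)) (subsets (suc k) S) (length (subsets k S)) single)
    where
    single : ∀ c → count (relation c) (subsets (suc k) S) ℕ.≤ length (subsets k S)
    single c with VecAll.all? (ℤ._≟ 0ℤ) c
    ... | yes _   = subst (ℕ._≤ length (subsets k S)) (sym (count-zero (λ _ → false) (subsets (suc k) S) (λ _ _ ()))) ℕ.z≤n
    ... | no  c≢0 = count-solutions c c≢0 0ℤ S unique

open Counting

-- The height H and the bound on the failure probability.

module Heights where

  open ℕ.≤-Reasoning
  open ℕ-Solver

  -- The base 6 = 3 · 4 / 2 is the one the hypothesis supplies: 3 from its numerator, 2 from its
  -- denominator, and 4 from ε ≤ ½.
  transferenceConstant≤ : ∀ k → transferenceConstant (suc k) ℕ.≤ 6 ℕ.^ k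
  transferenceConstant≤ zero    = ℕ.≤-refl
  transferenceConstant≤ (suc k) = begin
    1 ℕ.+ 2 ℕ.* transferenceConstant (suc k)  ≤⟨ ℕ.+-mono-≤ (ℕ.m^n>0 6 k) (ℕ.*-monoʳ-≤ 2 (transferenceConstant≤ k)) ⟩
    6 ℕ.^ k ℕ.+ 2 ℕ.* 6 ℕ.^ k                 ≤⟨ ℕ.m≤n*m (6 ℕ.^ k ℕ.+ 2 ℕ.* 6 ℕ.^ k) 2 ⟩
    2 ℕ.* (6 ℕ.^ k ℕ.+ 2 ℕ.* 6 ℕ.^ k)         ≡⟨ solve 1 (λ x → con 2 :* (x :+ con 2 :* x) := con 6 :* x) refl (6 ℕ.^ k) ⟩
    6 ℕ.* 6 ℕ.^ k                             ∎

  -- Induction on the exponent n from 2: raising it costs the factor (n + 1) (M + 1) / n on the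
  -- left, which is at most 2M + 1.
  dimension-factor : ∀ M j → 1 ℕ.≤ M → (2 ℕ.+ j) ℕ.* (M ℕ.+ 1) ℕ.^ (2 ℕ.+ j) ℕ.≤ (2 ℕ.* M ℕ.+ 1) ℕ.^ (2 ℕ.+ j)
  dimension-factor M@(suc M-1) zero 1≤M = subst (2 ℕ.* (M ℕ.+ 1) ℕ.^ 2 ℕ.≤_)
    (solve 1 (λ m → con 2 :* ((con 1 :+ m :+ con 1) :* ((con 1 :+ m :+ con 1) :* con 1)) :+ (con 1 :+ con 4 :* m :+ con 2 :* m :* m)
      := (con 2 :* (con 1 :+ m) :+ con 1) :* ((con 2 :* (con 1 :+ m) :+ con 1) :* con 1)) refl M-1)
    (ℕ.m≤m+n _ _)
  dimension-factor M@(suc M-1) (suc j) 1≤M = begin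
    (3 ℕ.+ j) ℕ.* ((M ℕ.+ 1) ℕ.* P)            ≡⟨ solve 3 (λ j m p → (con 3 :+ j) :* ((con 1 :+ m :+ con 1) :* p)
                                                    := (con 3 :+ j) :* (con 1 :+ m :+ con 1) :* p) refl j M-1 P ⟩
    (3 ℕ.+ j) ℕ.* (M ℕ.+ 1) ℕ.* P              ≤⟨ ℕ.*-monoˡ-≤ P (subst ((3 ℕ.+ j) ℕ.* (M ℕ.+ 1) ℕ.≤_)
                                                    (solve 2 (λ j m → (con 3 :+ j) :* (con 1 :+ m :+ con 1) :+ (m :+ j :* (con 1 :+ m))
                                                      := (con 2 :* (con 1 :+ m) :+ con 1) :* (con 2 :+ j)) refl j M-1)
                                                    (ℕ.m≤m+n _ _)) ⟩
    (2 ℕ.* M ℕ.+ 1) ℕ.* (2 ℕ.+ j) ℕ.* P        ≡⟨ ℕ.*-assoc (2 ℕ.* M ℕ.+ 1) (2 ℕ.+ j) P ⟩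
    (2 ℕ.* M ℕ.+ 1) ℕ.* ((2 ℕ.+ j) ℕ.* P)      ≤⟨ ℕ.*-monoʳ-≤ (2 ℕ.* M ℕ.+ 1) (dimension-factor M j 1≤M) ⟩
    (2 ℕ.* M ℕ.+ 1) ℕ.* (2 ℕ.* M ℕ.+ 1) ℕ.^ (2 ℕ.+ j) ∎
    where P = (M ℕ.+ 1) ℕ.^ (2 ℕ.+ j)

  -- A relation c · v = 0 is counted with v in the order of the list, which costs a factor n compared with
  -- random order. For n ≥ 2 it suffices to exclude relations of height ⌊M / 2⌋, and this regains the factor.
  height : ∀ k M → 1 ℕ.≤ M → ∃[ H ] suc k ℕ.* (2 ℕ.* H ℕ.+ 1) ℕ.^ suc k ℕ.≤ (2 ℕ.* M ℕ.+ 1) ℕ.^ suc k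
    × transferenceConstant (suc k) ℕ.* (M ℕ.* M) ℕ.≤ suc k ℕ.^ 3 ℕ.* 6 ℕ.^ k ℕ.* (suc H ℕ.* suc H)
  height zero    M 1≤M = M , ℕ.≤-reflexive (ℕ.*-identityˡ _) ,
    ℕ.*-monoʳ-≤ 1 (ℕ.*-mono-≤ (ℕ.n≤1+n M) (ℕ.n≤1+n M))
  height (suc j) M 1≤M = H , (begin
      n ℕ.* (2 ℕ.* H ℕ.+ 1) ℕ.^ n  ≤⟨ ℕ.*-monoʳ-≤ n (ℕ.^-monoˡ-≤ n (ℕ.+-monoˡ-≤ 1 2H≤M)) ⟩
      n ℕ.* (M ℕ.+ 1) ℕ.^ n        ≤⟨ dimension-factor M j 1≤M ⟩
      (2 ℕ.* M ℕ.+ 1) ℕ.^ n        ∎) , (begin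
      transferenceConstant n ℕ.* (M ℕ.* M)
        ≤⟨ ℕ.*-mono-≤ (transferenceConstant≤ (suc j)) (ℕ.*-mono-≤ M≤2H M≤2H) ⟩
      6 ℕ.^ suc j ℕ.* (2 ℕ.* suc H ℕ.* (2 ℕ.* suc H))
        ≡⟨ solve 2 (λ x h → x :* (con 2 :* h :* (con 2 :* h)) := con 4 :* x :* (h :* h)) refl (6 ℕ.^ suc j) (suc H) ⟩
      4 ℕ.* 6 ℕ.^ suc j ℕ.* (suc H ℕ.* suc H)
        ≤⟨ ℕ.*-monoˡ-≤ (suc H ℕ.* suc H) (ℕ.*-monoˡ-≤ (6 ℕ.^ suc j) 4≤n³) ⟩
      n ℕ.^ 3 ℕ.* 6 ℕ.^ suc j ℕ.* (suc H ℕ.* suc H) ∎)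
    where
    n = suc (suc j)
    H = M ℕ./ 2
    2H≤M : 2 ℕ.* H ℕ.≤ M
    2H≤M = subst (ℕ._≤ M) (ℕ.*-comm H 2) (ℕ.m/n*n≤m M 2)
    M≤2H : M ℕ.≤ 2 ℕ.* suc H
    M≤2H = begin
      M                        ≡⟨ ℕ.m≡m%n+[m/n]*n M 2 ⟩
      M ℕ.% 2 ℕ.+ H ℕ.* 2      ≤⟨ ℕ.+-monoˡ-≤ (H ℕ.* 2) (ℕ.<⇒≤ (ℕ.m%n<n M 2)) ⟩
      2 ℕ.+ H ℕ.* 2            ≡⟨ ℕ.*-comm (suc H) 2 ⟩
      2 ℕ.* suc H              ∎
    -- The factor n³ of the hypothesis absorbs the 4 that arises on squaring M ≤ 2 (H + 1).
    4≤n³ : 4 ℕ.≤ n ℕ.^ 3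
    4≤n³ = ℕ.≤-trans (ℕ.m≤n+m 4 4) (ℕ.^-monoˡ-≤ 3 {2} {n} (ℕ.s≤s (ℕ.s≤s ℕ.z≤n)))

  integerRoot : ∀ k N → ∃[ M ] M ℕ.^ suc k ℕ.≤ N × N ℕ.< suc M ℕ.^ suc k
  integerRoot k N = M , holds (largest-holds P? N) , ℕ.≰⇒> (largest-fails P? N above)
    where
    P? : ∀ j → Dec (j ℕ.^ suc k ℕ.≤ N)
    P? j = j ℕ.^ suc k ℕ.≤? N
    M = largest P? N
    above : ¬ suc N ℕ.^ suc k ℕ.≤ N
    above = ℕ.<⇒≱ (ℕ.m≤m*n (suc N) (suc N ℕ.^ k) {{ℕ.>-nonZero (ℕ.m^n>0 (suc N) k)}})
    holds : ∀ {j} → j ℕ.^ suc k ℕ.≤ N ⊎ j ≡ 0 → j ℕ.^ suc k ℕ.≤ N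
    holds (inj₁ h)    = h
    holds (inj₂ refl) = ℕ.z≤n

  -- Here s and L count the subsets of sizes k and n = k + 1, and e = N - n. Absorption gives n L =
  -- (e + 1) s, so each relation has probability at most n / (e + 1). Strictness comes from e < e +
  -- 1, or, if nothing is bad, from the right side being positive.
  failure-bound : ∀ {k e B s L p bad} → bad ℕ.≤ B ℕ.* s → suc k ℕ.* L ℕ.+ k ℕ.* s ≡ (suc k ℕ.+ e) ℕ.* s →
    suc k ℕ.* B ℕ.≤ p → 0 ℕ.< p → 0 ℕ.< L → bad ℕ.* e ℕ.< p ℕ.* L
  failure-bound {k} {e} {B} {s} {L} {p} {zero}      _  _  _  0<p 0<L = ℕ.*-mono-< 0<p 0<L
  failure-bound {k} {e} {B} {s} {L} {p} {bad@(suc _)} h eq nB 0<p 0<L = begin-strict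
    bad ℕ.* e                <⟨ ℕ.m<n+m (bad ℕ.* e) {bad} (ℕ.s≤s ℕ.z≤n) ⟩
    bad ℕ.+ bad ℕ.* e        ≡⟨ ℕ.*-suc bad e ⟨
    bad ℕ.* suc e            ≤⟨ ℕ.*-monoˡ-≤ (suc e) h ⟩
    B ℕ.* s ℕ.* suc e        ≡⟨ solve 3 (λ B s e → B :* s :* (con 1 :+ e) := B :* ((con 1 :+ e) :* s)) refl B s e ⟩
    B ℕ.* (suc e ℕ.* s)      ≡⟨ cong (B ℕ.*_) (ℕ.+-cancelʳ-≡ (k ℕ.* s) (suc e ℕ.* s) (suc k ℕ.* L) (trans
                                  (solve 3 (λ k e s → (con 1 :+ e) :* s :+ k :* s := (con 1 :+ k :+ e) :* s) refl k e s) (sym eq))) ⟩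
    B ℕ.* (suc k ℕ.* L)      ≡⟨ solve 3 (λ B k L → B :* ((con 1 :+ k) :* L) := (con 1 :+ k) :* B :* L) refl B k L ⟩
    suc k ℕ.* B ℕ.* L        ≤⟨ ℕ.*-monoˡ-≤ L nB ⟩
    p ℕ.* L                  ∎

-- Extracting the transference threshold from the hypothesis.

module Powers where

  open ℚ.≤-Reasoning
  open ℚ-Solver

  ι-ℕ* : ∀ m n → ι (+ (m ℕ.* n)) ≡ ι (+ m) ℚ.* ι (+ n)
  ι-ℕ* m n = trans (cong ι (ℤ.pos-* m n)) (ι-* (+ m) (+ n))

  ι-ℕ^ : ∀ m k → ι (+ (m ℕ.^ k)) ≡ ι (+ m) Rational.^ k
  ι-ℕ^ m zero    = refl
  ι-ℕ^ m (suc k) = trans (ι-ℕ* m (m ℕ.^ k)) (cong (ι (+ m) ℚ.*_) (ι-ℕ^ m k))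

  ι-mono-< : ∀ {m n} → m ℕ.< n → ι (+ m) ℚ.< ι (+ n)
  ι-mono-< {m} {n} m<n = /-< (+ m) (+ n) 1 1
    (subst₂ ℤ._<_ (sym (ℤ.*-identityʳ (+ m))) (sym (ℤ.*-identityʳ (+ n))) (ℤ.+<+ m<n))

  ι-mono-≤ : ∀ {m n} → m ℕ.≤ n → ι (+ m) ℚ.≤ ι (+ n)
  ι-mono-≤ {m} {n} m≤n = /1-mono-≤ {+ m} {+ n} (ℤ.+≤+ m≤n)

  ^-double : ∀ q k → q Rational.^ (2 ℕ.* suc k) ≡ q ℚ.* q ℚ.* q Rational.^ (2 ℕ.* k)
  ^-double q k = trans (cong (q Rational.^_) (ℕ.*-suc 2 k)) (sym (ℚ.*-assoc q q (q Rational.^ (2 ℕ.* k))))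

  4q²≤1 : ∀ {q} → 0ℚ ℚ.≤ q → q ℚ.≤ ½ → ι (+ 4) ℚ.* (q ℚ.* q) ℚ.≤ 1ℚ
  4q²≤1 {q} 0≤q q≤½ = ℚ.*-monoˡ-≤-nonNeg (ι (+ 4)) (*-mono {q} {½} {q} {½} 0≤q (ℚ.nonNegative⁻¹ ½) q≤½ q≤½)

  4^k*q^2k≤1 : ∀ {q} → 0ℚ ℚ.≤ q → q ℚ.≤ ½ → ∀ k → ι (+ (4 ℕ.^ k)) ℚ.* q Rational.^ (2 ℕ.* k) ℚ.≤ 1ℚ
  4^k*q^2k≤1 {q} 0≤q q≤½ zero    = ℚ.≤-refl
  4^k*q^2k≤1 {q} 0≤q q≤½ (suc k) = begin
    ι (+ (4 ℕ.^ suc k)) ℚ.* q Rational.^ (2 ℕ.* suc k)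
      ≡⟨ cong₂ ℚ._*_ (ι-ℕ* 4 (4 ℕ.^ k)) (^-double q k) ⟩
    ι (+ 4) ℚ.* f ℚ.* (q ℚ.* q ℚ.* u)
      ≡⟨ solve 4 (λ c f e u → c :* f :* (e :* u) := c :* e :* (f :* u)) refl (ι (+ 4)) f (q ℚ.* q) u ⟩
    ι (+ 4) ℚ.* (q ℚ.* q) ℚ.* (f ℚ.* u)
      ≤⟨ *-mono {ι (+ 4) ℚ.* (q ℚ.* q)} {1ℚ} {f ℚ.* u} {1ℚ} (*-nonNeg (ι-nonNeg (4 ℕ.^ k)) (^-nonNeg 0≤q (2 ℕ.* k)))
           (ℚ.nonNegative⁻¹ 1ℚ) (4q²≤1 0≤q q≤½) (4^k*q^2k≤1 0≤q q≤½ k) ⟩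
    1ℚ ∎
    where
    f = ι (+ (4 ℕ.^ k))
    u = q Rational.^ (2 ℕ.* k)

  -- With n = k + 1, the inequality (4ε²)ᵏ ≤ 1 trades ε²ⁿ for ε² / 4ᵏ. Since 3ᵏ 4ᵏ = 2ᵏ 6ᵏ, the last
  -- hypothesis becomes n³ 6ᵏ ≤ 4 ε² M², and M² cancels against the choice of H.
  large-enough : ∀ k M H {ε} → 1 ℕ.≤ M → 0ℚ ℚ.≤ ε → ε ℚ.≤ ½ →
    transferenceConstant (suc k) ℕ.* (M ℕ.* M) ℕ.≤ suc k ℕ.^ 3 ℕ.* 6 ℕ.^ k ℕ.* (suc H ℕ.* suc H) →
    ι (+ (suc k ℕ.^ 3 ℕ.* 3 ℕ.^ k)) ℚ.≤
      ι (+ M) ℚ.* ι (+ M) ℚ.* (ι (+ (2 ℕ.^ (suc k ℕ.+ 1))) ℚ.* ε Rational.^ (2 ℕ.* suc k)) →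
    ι (+ transferenceConstant (suc k)) ℚ.≤ ι (+ 4) ℚ.* (ε ℚ.* ε) ℚ.* ι (+ (suc H ℕ.* suc H))
  large-enough k M H {ε} 1≤M 0≤ε ε≤½ aM²≤ C≤ = *-cancelˡ-≤ {r = ι (+ (M ℕ.* M))}
      (ι-mono-< (ℕ.*-mono-< 1≤M 1≤M)) (begin
    ι (+ (M ℕ.* M)) ℚ.* ι (+ a)              ≡⟨ trans (sym (ι-ℕ* (M ℕ.* M) a)) (cong (λ z → ι (+ z)) (ℕ.*-comm (M ℕ.* M) a)) ⟩
    ι (+ (a ℕ.* (M ℕ.* M)))                  ≤⟨ ι-mono-≤ aM²≤ ⟩
    ι (+ (n³ ℕ.* 6 ℕ.^ k ℕ.* h))             ≡⟨ ι-ℕ* (n³ ℕ.* 6 ℕ.^ k) h ⟩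
    ι (+ (n³ ℕ.* 6 ℕ.^ k)) ℚ.* ι (+ h)       ≤⟨ ℚ.*-monoʳ-≤-nonNeg (ι (+ h)) {{ℚ.nonNegative (ι-nonNeg h)}} core ⟩
    ι (+ (M ℕ.* M)) ℚ.* (ι (+ 4) ℚ.* (ε ℚ.* ε)) ℚ.* ι (+ h)
                                             ≡⟨ ℚ.*-assoc (ι (+ (M ℕ.* M))) (ι (+ 4) ℚ.* (ε ℚ.* ε)) (ι (+ h)) ⟩
    ι (+ (M ℕ.* M)) ℚ.* (ι (+ 4) ℚ.* (ε ℚ.* ε) ℚ.* ι (+ h)) ∎)
    where
    a  = transferenceConstant (suc k)
    n³ = suc k ℕ.^ 3
    h  = suc H ℕ.* suc H
    t  = 2 ℕ.^ k
    f  = 4 ℕ.^ k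
    u  = ε Rational.^ (2 ℕ.* k)
    powers : ∀ j → 2 ℕ.^ j ℕ.* 6 ℕ.^ j ≡ 3 ℕ.^ j ℕ.* 4 ℕ.^ j
    powers zero    = refl
    powers (suc j) = trans (twist 2 6 (2 ℕ.^ j) (6 ℕ.^ j)) (trans (cong (12 ℕ.*_) (powers j)) (sym (twist 3 4 (3 ℕ.^ j) (4 ℕ.^ j))))
      where
      twist : ∀ c d x y → c ℕ.* x ℕ.* (d ℕ.* y) ≡ c ℕ.* d ℕ.* (x ℕ.* y)
      twist = ℕ-Solver.solve 4 (λ c d x y → c ℕ-Solver.:* x ℕ-Solver.:* (d ℕ-Solver.:* y)
        ℕ-Solver.:= c ℕ-Solver.:* d ℕ-Solver.:* (x ℕ-Solver.:* y)) refl
    rearrange : t ℕ.* (n³ ℕ.* 6 ℕ.^ k) ≡ n³ ℕ.* 3 ℕ.^ k ℕ.* f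
    rearrange = trans (swap t n³ (6 ℕ.^ k)) (trans (cong (n³ ℕ.*_) (powers k)) (sym (ℕ.*-assoc n³ (3 ℕ.^ k) f)))
      where
      swap : ∀ x y z → x ℕ.* (y ℕ.* z) ≡ y ℕ.* (x ℕ.* z)
      swap = ℕ-Solver.solve 3 (λ x y z → x ℕ-Solver.:* (y ℕ-Solver.:* z) ℕ-Solver.:= y ℕ-Solver.:* (x ℕ-Solver.:* z)) refl
    2^ : ι (+ (2 ℕ.^ (suc k ℕ.+ 1))) ≡ ι (+ 4) ℚ.* ι (+ t)
    2^ = trans (cong (λ z → ι (+ z)) (trans (ℕ.^-distribˡ-+-* 2 (suc k) 1)
      (ℕ-Solver.solve 1 (λ t → ℕ-Solver.con 2 ℕ-Solver.:* t ℕ-Solver.:* ℕ-Solver.con 2 ℕ-Solver.:= ℕ-Solver.con 4 ℕ-Solver.:* t) refl t)))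
      (ι-ℕ* 4 t)
    X = ι (+ (M ℕ.* M)) ℚ.* (ι (+ 4) ℚ.* (ε ℚ.* ε))
    0≤X : 0ℚ ℚ.≤ X
    0≤X = *-nonNeg (ι-nonNeg (M ℕ.* M)) (*-nonNeg (ι-nonNeg 4) (square-nonNeg ε))
    core : ι (+ (n³ ℕ.* 6 ℕ.^ k)) ℚ.≤ X
    core = *-cancelˡ-≤ {r = ι (+ t)} (ι-mono-< (ℕ.m^n>0 2 k)) (begin
      ι (+ t) ℚ.* ι (+ (n³ ℕ.* 6 ℕ.^ k))
        ≡⟨ trans (sym (ι-ℕ* t (n³ ℕ.* 6 ℕ.^ k))) (trans (cong (λ z → ι (+ z)) rearrange) (ι-ℕ* (n³ ℕ.* 3 ℕ.^ k) f)) ⟩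
      ι (+ (n³ ℕ.* 3 ℕ.^ k)) ℚ.* ι (+ f)
        ≤⟨ ℚ.*-monoʳ-≤-nonNeg (ι (+ f)) {{ℚ.nonNegative (ι-nonNeg f)}} C≤ ⟩
      ι (+ M) ℚ.* ι (+ M) ℚ.* (ι (+ (2 ℕ.^ (suc k ℕ.+ 1))) ℚ.* ε Rational.^ (2 ℕ.* suc k)) ℚ.* ι (+ f)
        ≡⟨ cong₂ (λ x y → x ℚ.* y ℚ.* ι (+ f)) (sym (ι-ℕ* M M)) (cong₂ ℚ._*_ 2^ (^-double ε k)) ⟩
      ι (+ (M ℕ.* M)) ℚ.* (ι (+ 4) ℚ.* ι (+ t) ℚ.* (ε ℚ.* ε ℚ.* u)) ℚ.* ι (+ f)
        ≡⟨ solve 6 (λ m c t e u f → m :* (c :* t :* (e :* u)) :* f := t :* (m :* (c :* e)) :* (f :* u)) refl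
             (ι (+ (M ℕ.* M))) (ι (+ 4)) (ι (+ t)) (ε ℚ.* ε) u (ι (+ f)) ⟩
      ι (+ t) ℚ.* X ℚ.* (ι (+ f) ℚ.* u)
        ≤⟨ ℚ.*-monoˡ-≤-nonNeg (ι (+ t) ℚ.* X) {{ℚ.nonNegative (*-nonNeg (ι-nonNeg t) 0≤X)}} (4^k*q^2k≤1 0≤ε ε≤½ k) ⟩
      ι (+ t) ℚ.* X ℚ.* 1ℚ
        ≡⟨ ℚ.*-identityʳ (ι (+ t) ℚ.* X) ⟩
      ι (+ t) ℚ.* X ∎)

open Heights
open Powers

-- Passage from rational terms to real numbers.

seq-loneliness : ∀ {n} (v : Vec ℕ (suc n)) t k → seq (loneliness v t) k ≡ lonelinessℚ v (seq t k)
seq-loneliness (x ∷ [])         t k = refl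
seq-loneliness (x ∷ v@(_ ∷ _)) t k = cong (distℤ (seq t k ℚ.* ι (+ x)) ℚ.⊓_) (seq-loneliness v t k)

≈-refl : ∀ x → x ≈ x
≈-refl x δ 0<δ = 0 , λ n _ → subst (ℚ._≤ δ) (sym (cong ℚ.∣_∣ (ℚ.+-inverseʳ (seq x n)))) (ℚ.<⇒≤ 0<δ)

-- Each term of the loneliness at a real time is the rational loneliness at a term of that time, so
-- the rational maximum dominates it termwise. The witness q may therefore change with the term.
ML-attained : ∀ {n} (v : Vec ℕ (suc n)) → (∀ i → 0 ℕ.< Vec.lookup v i) → ∀ x →
  Eventually (λ k → ∃[ q ] seq x k ℚ.≤ lonelinessℚ v q) → ML v ≥ x
ML-attained v v-pos x (K , below) = loneliness v (fromℚ t) , ((fromℚ t , ≈-refl (loneliness v (fromℚ t))) , upper) , lower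
  where
  t = proj₁ (maximum v v-pos)
  greatest : ∀ q k → lonelinessℚ v q ℚ.≤ seq (loneliness v (fromℚ t)) k
  greatest q k = subst (lonelinessℚ v q ℚ.≤_) (sym (seq-loneliness v (fromℚ t) k)) (proj₂ (maximum v v-pos) q)
  upper : ∀ s → loneliness v s ≤ loneliness v (fromℚ t)
  upper s δ 0<δ = 0 , λ k _ → ℚ.≤-trans
    (subst (ℚ._≤ seq (loneliness v (fromℚ t)) k) (sym (seq-loneliness v s k)) (greatest (seq s k) k)) (≤-+ʳ (ℚ.<⇒≤ 0<δ))
  lower : x ≤ loneliness v (fromℚ t)
  lower δ 0<δ = K , λ k K≤k → let q , x≤ = below k K≤k in
    ℚ.≤-trans x≤ (ℚ.≤-trans (greatest q k) (≤-+ʳ (ℚ.<⇒≤ 0<δ)))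

opaque
  unfolding rootApprox

  rootApprox-fraction : ∀ k m q → ∃[ i ] rootApprox k m q ≡ + i ℚ./ suc m
  rootApprox-fraction k m q = rootNumerator k m q , refl

module RootBounds (k N M : ℕ) (M^≤N : M ℕ.^ suc k ℕ.≤ N) (N<^ : N ℕ.< suc M ℕ.^ suc k) (j : ℕ) where

  r : ℚ
  r = rootApprox (suc k) j (ι (+ N))

  N⊔0 : ι (+ N) ℚ.⊔ 0ℚ ≡ ι (+ N)
  N⊔0 = ℚ.p≥q⇒p⊔q≡p (ι-nonNeg N)

  r<suc[M] : r ℚ.< ι (+ suc M)
  r<suc[M] = ^-cancel-< (ι-nonNeg (suc M)) (suc k) (ℚ.≤-<-trans
    (subst (r Rational.^ suc k ℚ.≤_) N⊔0 (rootApprox-≤ k j (ι (+ N))))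
    (subst (ι (+ N) ℚ.<_) (ι-ℕ^ (suc M) (suc k)) (ι-mono-< N<^)))

  -- There is no rounding loss: M is itself a multiple of 1 / (j + 1), so M < r + 1 / (j + 1) with r
  -- such a multiple forces M ≤ r. This lets M replace the root in every term of the final bound.
  M≤r : ι (+ M) ℚ.≤ r
  M≤r = fraction (rootApprox-fraction (suc k) j (ι (+ N)))
    where
    M<r+ : ι (+ M) ℚ.< r ℚ.+ + 1 ℚ./ suc j
    M<r+ = ^-cancel-< (+-nonNeg (rootApprox-nonNeg (suc k) j (ι (+ N))) (/-nonNeg 1 j)) (suc k)
      (ℚ.≤-<-trans (subst₂ ℚ._≤_ (ι-ℕ^ M (suc k)) (sym N⊔0) (ι-mono-≤ M^≤N)) (<-rootApprox k j (ι (+ N))))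
    fraction : ∃[ i ] r ≡ + i ℚ./ suc j → ι (+ M) ℚ.≤ r
    fraction (i , e) = cases (M ℕ.* suc j ℕ.≤? i)
      where
      cases : Dec (M ℕ.* suc j ℕ.≤ i) → ι (+ M) ℚ.≤ r
      cases (yes h) = subst (ι (+ M) ℚ.≤_) (sym e) (/-≤ (+ M) (+ i) 1 (suc j)
        (subst₂ ℤ._≤_ (ℤ.pos-* M (suc j)) (sym (ℤ.*-identityʳ (+ i))) (ℤ.+≤+ h)))
      cases (no ¬h) = ⊥-elim (ℚ.<-irrefl refl (ℚ.<-≤-trans M<r+ (subst (ℚ._≤ ι (+ M))
        (trans (/-suc i j) (cong (ℚ._+ + 1 ℚ./ suc j) (sym e)))
        (/-≤ (+ suc i) (+ M) (suc j) 1
          (subst₂ ℤ._≤_ (sym (ℤ.*-identityʳ (+ suc i))) (ℤ.pos-* M (suc j)) (ℤ.+≤+ (ℕ.≰⇒> ¬h)))))))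

-- The margin δ of the strict inequality between reals outweighs the error 1 / (j + 1) of the
-- approximate root. The summand 1 cancels against r < m + 1.
sqrt-bound : ∀ {j z δ r m} → rootApprox 2 j z ℚ.+ 1ℚ ℚ.+ δ ℚ.≤ r → r ℚ.< m ℚ.+ 1ℚ → + 1 ℚ./ suc j ℚ.≤ δ →
  z ℚ.≤ m ℚ.* m
sqrt-bound {j} {z} {δ} {r} {m} h r< s≤δ = begin
  z                          ≤⟨ ℚ.p≤p⊔q z 0ℚ ⟩
  z ℚ.⊔ 0ℚ                   ≤⟨ ℚ.<⇒≤ (<-rootApprox 1 j z) ⟩
  (a ℚ.+ s) Rational.^ 2     ≤⟨ ^-mono-≤ (+-nonNeg (rootApprox-nonNeg 2 j z) (/-nonNeg 1 j)) a+s≤m 2 ⟩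
  m Rational.^ 2             ≡⟨ cong (m ℚ.*_) (ℚ.*-identityʳ m) ⟩
  m ℚ.* m                    ∎
  where
  open ℚ.≤-Reasoning
  open ℚ-Solver
  a = rootApprox 2 j z
  s = + 1 ℚ./ suc j
  a+s≤m : a ℚ.+ s ℚ.≤ m
  a+s≤m = begin
    a ℚ.+ s                    ≤⟨ ℚ.+-monoʳ-≤ a s≤δ ⟩
    a ℚ.+ δ                    ≡⟨ solve 2 (λ a δ → a :+ δ := a :+ con 1ℚ :+ δ :- con 1ℚ) refl a δ ⟩
    a ℚ.+ 1ℚ ℚ.+ δ ℚ.- 1ℚ      ≤⟨ ℚ.+-monoˡ-≤ (ℚ.- 1ℚ) (ℚ.≤-trans h (ℚ.<⇒≤ r<)) ⟩
    m ℚ.+ 1ℚ ℚ.- 1ℚ            ≡⟨ solve 1 (λ m → m :+ con 1ℚ :- con 1ℚ := m) refl m ⟩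
    m                          ∎

clear-denominator : ∀ {c d m} → 0ℚ ℚ.< d → c ℚ.* inv d ℚ.≤ m → c ℚ.≤ m ℚ.* d
clear-denominator {c} {d} {m} 0<d h = subst (ℚ._≤ m ℚ.* d)
  (trans (ℚ.*-assoc c (inv d) d) (trans (cong (c ℚ.*_) (trans (ℚ.*-comm (inv d) d) (*-inv 0<d))) (ℚ.*-identityʳ c)))
  (ℚ.*-monoʳ-≤-nonNeg d {{ℚ.nonNegative (ℚ.<⇒≤ 0<d)}} h)

inv-pos : ∀ {d} → 0ℚ ℚ.< d → 0ℚ ℚ.< inv d
inv-pos {d} 0<d = let r , 0<r , dr≡1 = recip 0<d in subst (0ℚ ℚ.<_)
  (trans (sym (ℚ.*-identityʳ r)) (trans (cong (r ℚ.*_) (sym (*-inv 0<d)))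
    (trans (sym (ℚ.*-assoc r d (inv d))) (trans (cong (ℚ._* inv d) (trans (ℚ.*-comm r d) dr≡1)) (ℚ.*-identityˡ (inv d))))))
  0<r

/-cancel : ∀ i n → (i ℚ./ suc n) ℚ.* ι (+ suc n) ≡ ι i
/-cancel i n = ℚ.toℚᵘ-injective
  (ℚᵘ.≃-trans (ℚ.toℚᵘ-homo-* (i ℚ./ suc n) (ι (+ suc n)))
  (ℚᵘ.≃-trans (ℚᵘ.*-cong (ℚ.toℚᵘ-fromℚᵘ (ℚᵘ.mkℚᵘ i n)) (ℚ.toℚᵘ-fromℚᵘ (ℚᵘ.mkℚᵘ (+ suc n) 0)))
  (ℚᵘ.≃-trans (ℚᵘ.*≡* (trans (ℤ.*-identityʳ (i ℤ.* + suc n)) (cong (λ z → i ℤ.* + z) (sym (ℕ.*-identityʳ (suc n))))))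
    (ℚᵘ.≃-sym (ℚ.toℚᵘ-fromℚᵘ (ℚᵘ.mkℚᵘ i 0))))))

ratio-cancel : ∀ a {L} → 0 ℕ.< L → ratio a L ℚ.* ι (+ L) ≡ ι (+ a)
ratio-cancel a {suc n} _ = /-cancel (+ a) n

ratio-complement : ∀ a b {L} → 0 ℕ.< L → a ℕ.+ b ≡ L → ratio a L ≡ 1ℚ ℚ.- ratio b L
ratio-complement a b {L} 0<L a+b≡L = *-cancelʳ (begin
    ratio a L ℚ.* l             ≡⟨ ratio-cancel a 0<L ⟩
    ι (+ a)                     ≡⟨ solve 2 (λ a b → a := (a :+ b) :- b) refl (ι (+ a)) (ι (+ b)) ⟩
    ι (+ a) ℚ.+ ι (+ b) ℚ.- ι (+ b) ≡⟨ cong (ℚ._- ι (+ b)) (trans (sym (ι-+ (+ a) (+ b))) (cong (λ z → ι (+ z)) a+b≡L)) ⟩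
    l ℚ.- ι (+ b)               ≡⟨ cong (λ z → l ℚ.- z) (sym (ratio-cancel b 0<L)) ⟩
    l ℚ.- ratio b L ℚ.* l       ≡⟨ solve 2 (λ l r → l :- r :* l := (con 1ℚ :- r) :* l) refl l (ratio b L) ⟩
    (1ℚ ℚ.- ratio b L) ℚ.* l    ∎)
  where
  open ≡-Reasoning
  open ℚ-Solver
  l = ι (+ L)
  0<l : 0ℚ ℚ.< l
  0<l = ι-mono-< 0<L
  *-cancelʳ : ∀ {p q} → p ℚ.* l ≡ q ℚ.* l → p ≡ q
  *-cancelʳ e = ℚ.≤-antisym
    (ℚ.*-cancelʳ-≤-pos l {{ℚ.positive 0<l}} (ℚ.≤-reflexive e))
    (ℚ.*-cancelʳ-≤-pos l {{ℚ.positive 0<l}} (ℚ.≤-reflexive (sym e)))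

ratio-< : ∀ {b L p e d} → 0 ℕ.< L → 0ℚ ℚ.< d → ι (+ e) ≡ d → b ℕ.* e ℕ.< p ℕ.* L → ratio b L ℚ.< ι (+ p) ℚ.* inv d
ratio-< {b} {L} {p} {e} {d} 0<L 0<d refl h = ℚ.*-cancelʳ-<-nonNeg (ι (+ L) ℚ.* d)
    {{ℚ.nonNegative (*-nonNeg (ι-nonNeg L) (ℚ.<⇒≤ 0<d))}} (begin-strict
  ratio b L ℚ.* (ι (+ L) ℚ.* d)            ≡⟨ ℚ.*-assoc (ratio b L) (ι (+ L)) d ⟨
  ratio b L ℚ.* ι (+ L) ℚ.* d              ≡⟨ cong (ℚ._* d) (ratio-cancel b 0<L) ⟩
  ι (+ b) ℚ.* d                            ≡⟨ ι-ℕ* b e ⟨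
  ι (+ (b ℕ.* e))                          <⟨ ι-mono-< h ⟩
  ι (+ (p ℕ.* L))                          ≡⟨ ι-ℕ* p L ⟩
  ι (+ p) ℚ.* ι (+ L)                      ≡⟨ ℚ.*-identityʳ _ ⟨
  ι (+ p) ℚ.* ι (+ L) ℚ.* 1ℚ               ≡⟨ cong (ι (+ p) ℚ.* ι (+ L) ℚ.*_) (*-inv 0<d) ⟨
  ι (+ p) ℚ.* ι (+ L) ℚ.* (d ℚ.* inv d)
    ≡⟨ solve 4 (λ p l d i → p :* l :* (d :* i) := p :* i :* (l :* d)) refl (ι (+ p)) (ι (+ L)) d (inv d) ⟩
  ι (+ p) ℚ.* inv d ℚ.* (ι (+ L) ℚ.* d)    ∎)
  where
  open ℚ.≤-Reasoning
  open ℚ-Solver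

toℤ-positive : ∀ {n} (v : Vec ℕ (suc n)) → (∀ i → 0 ℕ.< Vec.lookup v i) → 0ℤ ℤ.< dot (toℤ v) (toℤ v)
toℤ-positive (x ∷ v) v-pos = ℤ.<-≤-trans (ℤ-Order.*-pos (ℤ.+<+ (v-pos zero)) (ℤ.+<+ (v-pos zero)))
  (ℤ-Order.≤-by (IntegerVectors.dot-nonNeg (toℤ v)) refl)

-- The time used is the maximiser of v, whatever ε is; transference only shows that some time is
-- good enough, hence that the maximiser is.
lonely-enough : ∀ {k} M H (v : Vec ℕ (suc k)) → 1 ℕ.≤ M → (v-pos : ∀ i → 0 ℕ.< Vec.lookup v i) →
  RelationFree H (toℤ v) →
  transferenceConstant (suc k) ℕ.* (M ℕ.* M) ℕ.≤ suc k ℕ.^ 3 ℕ.* 6 ℕ.^ k ℕ.* (suc H ℕ.* suc H) →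
  ∀ ε → 0ℚ ℚ.≤ ε → ι (+ (suc k ℕ.^ 3 ℕ.* 3 ℕ.^ k)) ℚ.≤
      ι (+ M) ℚ.* ι (+ M) ℚ.* (ι (+ (2 ℕ.^ (suc k ℕ.+ 1))) ℚ.* ε Rational.^ (2 ℕ.* suc k)) →
  ∃[ q ] ½ ℚ.- ε ℚ.≤ lonelinessℚ v q
lonely-enough {k} M H v 1≤M v-pos free aM²≤ ε 0≤ε C≤ = t , bound
  where
  t = proj₁ (maximum v v-pos)
  bound : ½ ℚ.- ε ℚ.≤ lonelinessℚ v t
  -- A comparison of two rationals is decidable, which discharges the double negation left by
  -- transference.
  bound = decidable-stable (½ ℚ.- ε ℚ.≤? lonelinessℚ v t) (cases (ε ℚ.≤? ½))
    where
    cases : Dec (ε ℚ.≤ ½) → ¬ ¬ (½ ℚ.- ε ℚ.≤ lonelinessℚ v t)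
    cases (yes ε≤½) h = lonelyTime H v free (toℤ-positive v v-pos) ε 0≤ε
      (large-enough k M H 1≤M 0≤ε ε≤½ aM²≤ C≤)
      λ (s , far) → h (ℚ.≤-trans (lonelinessℚ-glb v s far) (proj₂ (maximum v v-pos) s))
    -- For ε > ½ the bound ½ - ε is negative and any time will do.
    cases (no ε≰½) h = h (ℚ.≤-trans
      (subst (½ ℚ.- ε ℚ.≤_) (ℚ.+-inverseʳ ½) (ℚ.+-monoʳ-≤ ½ (ℚ.neg-antimono-≤ (ℚ.<⇒≤ (ℚ.≰⇒> ε≰½)))))
      (lonelinessℚ-glb v t (λ i → distℤ-nonNeg (t ℚ.* ι (+ Vec.lookup v i)))))

seq-fromℕ* : ∀ a x j → seq (fromℕ a * x) j ≡ ι (+ a) ℚ.* seq x j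
seq-fromℕ* a x j = refl

seq-fromℕ*+1 : ∀ a x j → seq (fromℕ a * x + 1ℝ) j ≡ ι (+ a) ℚ.* seq x j ℚ.+ 1ℚ
seq-fromℕ*+1 a x j = refl

seq-fromℕ-- : ∀ a b j → seq (fromℕ a - fromℕ b) j ≡ ι (+ a) ℚ.- ι (+ b)
seq-fromℕ-- a b j = refl

seq-root : ∀ k x j → seq (root (suc k) x) j ≡ rootApprox (suc k) j (seq x j)
seq-root k x j = refl

quotient-bound : ∀ {c y z m} (0<y : 0ℝ < y) → √ (c / y [ 0<y ]) + 1ℝ < z → (∀ j → seq z j ℚ.< m ℚ.+ 1ℚ) →
  Eventually (λ j → seq c j ℚ.≤ m ℚ.* m ℚ.* seq y j)
quotient-bound {c} {y} {z} {m} 0<y (δ , 0<δ , K , gap) z<m+1 =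
  let b , 0<b , b≤y = positiveBound {y} 0<y
      K′ , h = both b≤y (both (K , gap) (archimedean 0<δ)) in
  K′ , λ j K′≤j → let b≤yj , gapj , s≤δ = h j K′≤j in
    clear-denominator (ℚ.<-≤-trans 0<b b≤yj)
      (sqrt-bound {j} {seq c j ℚ.* inv (seq y j)} {δ} {seq z j} {m} gapj (z<m+1 j) s≤δ)

-- The margin p / d - β is a fixed rational, and p bounds X from below in every term, so the same
-- margin serves from the first term on.
ℙ-complement : ∀ {A : Set} (Ω : List A) D {β p d X y} (0<y : 0ℝ < y) →
  ratio (count D Ω) (length Ω) ≡ 1ℚ ℚ.- β → (∀ j → seq y j ≡ d) → 0ℚ ℚ.< d → β ℚ.< p ℚ.* inv d →
  (∀ j → p ℚ.≤ seq X j) → 1ℝ - X / y [ 0<y ] < ℙ Ω D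
ℙ-complement Ω D {β} {p} {d} {X} {y} 0<y complement y≡d 0<d β< p≤X = δ , 0<δ , 0 , λ j _ →
  subst₂ (λ r g → 1ℚ ℚ.- seq X j ℚ.* inv r ℚ.+ δ ℚ.≤ g) (sym (y≡d j)) (sym complement)
    (cancel (seq X j ℚ.* inv d)
      (ℚ.*-monoʳ-≤-nonNeg (inv d) {{ℚ.nonNegative (ℚ.<⇒≤ (inv-pos 0<d))}} (p≤X j)))
  where
  open ℚ-Solver
  δ = p ℚ.* inv d ℚ.- β
  0<δ : 0ℚ ℚ.< δ
  0<δ = subst (ℚ._< δ) (ℚ.+-inverseʳ β) (ℚ.+-monoˡ-< (ℚ.- β) β<)
  cancel : ∀ a → p ℚ.* inv d ℚ.≤ a → 1ℚ ℚ.- a ℚ.+ δ ℚ.≤ 1ℚ ℚ.- β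
  cancel a ≤a = subst (1ℚ ℚ.- a ℚ.+ δ ℚ.≤_)
    (solve 2 (λ a c → con 1ℚ :- a :+ (a :- c) := con 1ℚ :- c) refl a β)
    (ℚ.+-monoʳ-≤ (1ℚ ℚ.- a) (ℚ.+-monoˡ-≤ (ℚ.- β) ≤a))

theorem12p3 : (n : ℕ) .{{_ : NonZero n}} (ε : ℝ) (ε>0 : 0ℝ < ε)
    (N : ℕ) (S : List ℕ) → Unique S → All (λ s → 0 ℕ.< s) S → length S ≡ N →
    (n<N : n ℕ.< N) →
    √ (fromℕ (n ℕ.^ 3 ℕ.* 3 ℕ.^ (n ℕ.∸ 1)) / (fromℕ (2 ℕ.^ (n ℕ.+ 1)) * ε ^ (2 ℕ.* n)) [ denominator>0 n ε>0 ]) + 1ℝ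
    < root (suc n) (fromℕ N) →
    ℙ[ subsets n S ∣ (λ v → ML v ≥ (½ℝ - ε)) ]>
    (1ℝ - (fromℕ 2 * root (suc n) (fromℕ N) + 1ℝ) ^ n / (fromℕ N - fromℕ n) [ N-n>0 n<N ])
theorem12p3 zero = ⊥-elim (ℕ.<-irrefl refl (ℕ.>-nonZero⁻¹ 0))
theorem12p3 n@(suc k) ε ε>0 N S unique positive refl n<N hyp =
  D , good , ℙ-complement (subsets n S) D {ratio bad L} {ι (+ p)} {d}
    {(fromℕ 2 * root (suc n) (fromℕ N) + 1ℝ) ^ n} {fromℕ N - fromℕ n} (N-n>0 n<N)
    complement (seq-fromℕ-- N n) 0<d (ratio-< {bad} {L} {p} {e} 0<L 0<d ιe≡d few) p≤
  where
  M-root = integerRoot n N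
  M = proj₁ M-root
  1≤M : 1 ℕ.≤ M
  -- If M were 0, then N would be less than 1, against n < N.
  1≤M = ℕ.n≢0⇒n>0 λ M≡0 → ℕ.<⇒≱ (proj₂ (proj₂ M-root))
    (subst (λ m → suc m ℕ.^ suc n ℕ.≤ N) (sym M≡0) (subst (ℕ._≤ N) (sym (ℕ.^-zeroˡ (suc n))) (ℕ.≤-trans (ℕ.s≤s ℕ.z≤n) n<N)))
  H-choice = height k M 1≤M
  H = proj₁ H-choice
  D : Vec ℕ n → Bool
  D v = not (hasRelation H v)
  module R = RootBounds n N M (proj₁ (proj₂ M-root)) (proj₂ (proj₂ M-root))

  C = ι (+ (n ℕ.^ 3 ℕ.* 3 ℕ.^ k))
  2^n+1 = ι (+ (2 ℕ.^ (n ℕ.+ 1)))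

  -- The real hypothesis is used only through its late terms: M and H stay fixed while ε runs
  -- through its rational approximations.
  large-M : Eventually (λ j → 0ℚ ℚ.< seq ε j ×
    C ℚ.≤ ι (+ M) ℚ.* ι (+ M) ℚ.* (2^n+1 ℚ.* seq ε j Rational.^ (2 ℕ.* n)))
  large-M =
    let c , 0<c , c≤ε = positiveBound {ε} ε>0
        K , h = both c≤ε (quotient-bound {fromℕ (n ℕ.^ 3 ℕ.* 3 ℕ.^ k)} {fromℕ (2 ℕ.^ (n ℕ.+ 1)) * ε ^ (2 ℕ.* n)}
          {root (suc n) (fromℕ N)} {ι (+ M)} (denominator>0 n ε>0) hyp z<) in
    K , λ j K≤j → let c≤εj , C≤ = h j K≤j in
      ℚ.<-≤-trans 0<c c≤εj ,
      subst (λ w → C ℚ.≤ ι (+ M) ℚ.* ι (+ M) ℚ.* w)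
        (trans (seq-fromℕ* (2 ℕ.^ (n ℕ.+ 1)) (ε ^ (2 ℕ.* n)) j) (cong (2^n+1 ℚ.*_) (seq-^ ε (2 ℕ.* n) j))) C≤
    where
    z<  : ∀ j → seq (root (suc n) (fromℕ N)) j ℚ.< ι (+ M) ℚ.+ 1ℚ
    z< j = subst₂ ℚ._<_ (sym (seq-root n (fromℕ N) j)) (trans (ι-+ 1ℤ (+ M)) (ℚ.+-comm 1ℚ (ι (+ M)))) (R.r<suc[M] j)

  good : ∀ v → v ∈ subsets n S → T (D v) → ML v ≥ (½ℝ - ε)
  good v v∈ Dv = ML-attained v v-pos (½ℝ - ε) (let K , h = large-M in K , λ j K≤j →
      let 0<εj , C≤ = h j K≤j in
      lonely-enough M H v 1≤M v-pos (relationFree H v Dv) (proj₂ (proj₂ H-choice)) (seq ε j) (ℚ.<⇒≤ 0<εj) C≤)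
    where
    v-pos : ∀ i → 0 ℕ.< Vec.lookup v i
    v-pos i = All.lookup positive (subsets-∈ n v∈ i)

  Ω = subsets n S
  L = length Ω
  bad = count (hasRelation H) Ω
  p = (2 ℕ.* M ℕ.+ 1) ℕ.^ n
  e = N ℕ.∸ n
  d = ι (+ N) ℚ.- ι (+ n)
  0<L : 0 ℕ.< L
  0<L = subsets-nonempty n S (ℕ.<⇒≤ n<N)
  ιe≡d : ι (+ e) ≡ d
  ιe≡d = trans (cong ι (sym (trans (ℤ.m-n≡m⊖n N n) (ℤ.⊖-≥ (ℕ.<⇒≤ n<N))))) (ι-- (+ N) (+ n))
  0<d : 0ℚ ℚ.< d
  0<d = subst (0ℚ ℚ.<_) ιe≡d (ι-mono-< (ℕ.m<n⇒0<n∸m n<N))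
  few : bad ℕ.* e ℕ.< p ℕ.* L
  few = failure-bound {k} {e} {(2 ℕ.* H ℕ.+ 1) ℕ.^ n} {length (subsets k S)} {L} {p} {bad}
    (count-hasRelation H k S unique)
    (trans (subsets-absorption k S) (cong (ℕ._* length (subsets k S)) (sym (ℕ.m+[n∸m]≡n (ℕ.<⇒≤ n<N)))))
    (proj₁ (proj₂ H-choice)) (ℕ.m^n>0 (2 ℕ.* M ℕ.+ 1) {{ℕ.>-nonZero (ℕ.m≤n+m 1 (2 ℕ.* M))}} n) 0<L
  complement : ratio (count D Ω) L ≡ 1ℚ ℚ.- ratio bad L
  complement = ratio-complement (count D Ω) bad 0<L (count-not (hasRelation H) Ω)
  p≤ : ∀ j → ι (+ p) ℚ.≤ seq ((fromℕ 2 * root (suc n) (fromℕ N) + 1ℝ) ^ n) j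
  p≤ j = subst₂ ℚ._≤_ (sym (ι-ℕ^ (2 ℕ.* M ℕ.+ 1) n)) (sym (seq-^ (fromℕ 2 * root (suc n) (fromℕ N) + 1ℝ) n j))
    (^-mono-≤ (ι-nonNeg (2 ℕ.* M ℕ.+ 1)) (subst₂ ℚ._≤_
      (sym (trans (ι-+ (+ (2 ℕ.* M)) 1ℤ) (cong (ℚ._+ 1ℚ) (ι-ℕ* 2 M))))
      (sym (trans (seq-fromℕ*+1 2 (root (suc n) (fromℕ N)) j) (cong (λ r → ι (+ 2) ℚ.* r ℚ.+ 1ℚ) (seq-root n (fromℕ N) j))))
      (ℚ.+-monoˡ-≤ 1ℚ (ℚ.*-monoˡ-≤-nonNeg (ι (+ 2)) (R.M≤r j)))) n)
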